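{- For all $n,\Delta\in\mathbb Z_+$, letting $\Pi=\{p_1,\dots,p_{\log(n)}\}$ (identifier symbols), there exists a $(\Pi,\Delta)$-program of $\mathrm{MPMSC}$ with the following properties, where asymptotic bounds are in terms of $n$ and $\Delta$: (1) it defines a proper $(\Delta+1)$-coloring on the Kripke models corresponding to graphs with $n$ nodes, unique identifiers from $\{1,\dots,n\}$ and maximum degree at most $\Delta$; (2) it has $\mathcal{O}(\Delta\log(n))+\mathcal{O}(3^\Delta)$ head predicates and its size is $\mathcal{O}(\Delta^2\log(n))+\mathcal{O}(3^\Delta)$; (3) the number of iterations (rounds) needed is $\mathcal{O}(\log(n)\log\log(n)\log^*(n))+\mathcal{O}(\Delta 3^\Delta)$; (4) there are exactly $\log^*(n)+3^\Delta-\Delta+11$ global communication rounds.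
   Context: Notation: $\log(k):=\lfloor\log_2 k\rfloor+1$ (number of bits of $k$ in binary); $\log^*$ is the iterated logarithm. Graphs: a graph $G=(N,E)$ has a symmetric irreflexive edge relation. Given $G$ with $n$ nodes carrying unique identifiers in $\{1,\dots,n\}$ and maximum degree $\Delta$, its corresponding Kripke model is $(W,R,V)$ over $\Pi=\{p_1,\dots,p_{\log(n)}\}$ with $W=N$, $R=E$, and $v\in V(p_i)$ iff the $i$th bit of the identifier of $v$ is $1$. In a Kripke model with identifiers, if the successors of $w$ have identifier strings $s_1<\dots<s_d$ lexicographically, the one with $s_i$ is the $i$th neighbour of $w$. MPMSC: schemata built by $\varphi::=\top\mid p\mid X\mid\neg\varphi\mid(\varphi\wedge\varphi)\mid\Diamond_i\varphi$ ($p\in\Pi$, $X$ a schema variable, $i\in[\Delta]$); $\Diamond_i\varphi$ holds at $w$ iff $w$ has an $i$th neighbour and $\varphi$ holds there. A $(\Pi,\Delta)$-program has distinct head predicates $Y_1,\dots,Y_k$ (fixed order), diamond- and variable-free terminal clauses $Y_i(0):=\varphi_i$, and for each $i$ an iteration clause, either standard $Y_i:=\psi$ or conditional $Y_i:=_{\varphi_1,\dots,\varphi_m}\psi_1;\dots;\psi_m;\chi$, with conditions of modal depth $0$ and $\psi,\psi_j,\chi$ of modal depth at most $1$; plus sets of attention and print predicates. Semantics: $Y_i^0=\varphi_i$; standard: $Y_i^{r+1}=\psi^{r+1}$; conditional: $Y_i^{r+1}=\bigvee_{j\le m}\big(\bigwedge_{j'<j}\neg\varphi_{j'}^{r+1}\wedge\varphi_j^{r+1}\wedge\psi_j^{r+1}\big)\vee\big(\bigwedge_{j\le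 m}\neg\varphi_j^{r+1}\wedge\chi^{r+1}\big)$, $\theta^{r+1}$ being $\theta$ with each $Y_j$ replaced by $Y_j^r$. The round-$r$ configuration at $w$ is the $k$-bit string with $i$th bit $1$ iff $(M,w)\models Y_i^r$; $w$ outputs in round $r$ if $r$ is the first round in which some attention predicate is true at $w$, and the output is the string of truth values of the print predicates in that round. A condition is hot at $w$ in round $r\ge1$ if it holds and no earlier condition of the clause holds; otherwise the backup is hot. A communication clause is an iteration clause containing a diamond; it broadcasts at $w$ in round $r\ge1$ if the hot consequence or hot backup contains a diamond, or the clause is standard with a diamond. A global communication round is a round $r\ge1$ in which some communication clause broadcasts at some node. Size = number of occurrences of proposition symbols, head predicates, $\top,\neg,\wedge,\Diamond_i$. Coloring: the program defines a $k$-coloring (on a class of models) if in each model every node $w$ outputs some $\overline p_w$ of the form $0^a10^b$ with $a\in\{0,\dots,k-1\}$, $b\in\mathbb N$; it is proper if $\overline p_w\ne\overline p_v$ whenever $(w,v)\in R$. -}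

module Defs where

open import Data.Nat using (ℕ; zero; suc; _+_; _*_; _∸_; _^_; _≤_; _<_; _≤ᵇ_; _≡ᵇ_)
import Data.Nat.ListAction
open import Data.Nat.DivMod using (_/_; _%_)
open import Data.Nat.Logarithm using (⌊log₂_⌋)
open import Data.Bool using (Bool; true; false; not; _∧_; _∨_; if_then_else_)
open import Data.Fin using (Fin; toℕ)
open import Data.Vec using (Vec; []; _∷_; reverse; lookup)
open import Data.List using (List; []; _∷_; length; allFin; map; replicate; _++_)
open import Data.Maybe using (Maybe; just; nothing)
open import Data.Product using (Σ; _×_; _,_)
open import Relation.Binary.PropositionalEquality using (_≡_)

-- log(k) := ⌊log₂ k⌋ + 1  (number of bits of k)
lg : ℕ → ℕ
lg k = suc ⌊log₂ k ⌋

tower : ℕ → ℕ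
tower zero = 1
tower (suc i) = 2 ^ tower i

-- Iterated (base-2, real) logarithm: log* n = least i with log₂^(i) n ≤ 1,
-- equivalently least i with n ≤ tower i.  Search from 0 with fuel n
-- (tower i ≥ i + 1, so the answer is ≤ n).
logStarFrom : ℕ → ℕ → ℕ → ℕ
logStarFrom n zero i = i
logStarFrom n (suc f) i = if n ≤ᵇ tower i then i else logStarFrom n f (suc i)

logStar : ℕ → ℕ
logStar n = logStarFrom n n 0

bfilter : {A : Set} → (A → Bool) → List A → List A
bfilter p [] = []
bfilter p (x ∷ xs) = if p x then x ∷ bfilter p xs else bfilter p xs

nthMaybe : {A : Set} → List A → ℕ → Maybe A
nthMaybe [] _ = nothing
nthMaybe (x ∷ xs) zero = just x
nthMaybe (x ∷ xs) (suc i) = nthMaybe xs i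

anyL : {A : Set} → (A → Bool) → List A → Bool
anyL p [] = false
anyL p (x ∷ xs) = p x ∨ anyL p xs

anyFin : (k : ℕ) → (Fin k → Bool) → Bool
anyFin k p = anyL p (allFin k)

sumFin : (k : ℕ) → (Fin k → ℕ) → ℕ
sumFin k f = Data.Nat.ListAction.sum (map f (allFin k))

-- Graphs with n nodes, identifiers 1..n, max degree ≤ Δ.
-- Nodes are Fin n; node v carries the identifier toℕ v + 1
-- (so identifiers are unique and range over {1,…,n}).

record Graph (n Δ : ℕ) : Set where
  field
    adj    : Fin n → Fin n → Bool
    sym    : ∀ u v → adj u v ≡ adj v u
    irrefl : ∀ v → adj v v ≡ false
    maxDeg : ∀ v → length (bfilter (adj v) (allFin n)) ≤ Δ
open Graph public

ident : {n : ℕ} → Fin n → ℕ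
ident v = suc (toℕ v)

bitsLE : (L : ℕ) → ℕ → Vec Bool L
bitsLE zero x = []
bitsLE (suc L) x = (x % 2 ≡ᵇ 1) ∷ bitsLE L (x / 2)

-- identifier string of length L, most significant bit first: p_1 = MSB
idString : (L : ℕ) → ℕ → Vec Bool L
idString L x = reverse (bitsLE L x)

val : {n : ℕ} → Fin (lg n) → Fin n → Bool
val {n} i v = lookup (idString (lg n) (ident v)) i

-- successors of w, listed in increasing order of identifier; with
-- MSB-first padded identifier strings this is the lexicographic order.
nbrs : {n Δ : ℕ} → Graph n Δ → Fin n → List (Fin n)
nbrs {n} G w = bfilter (adj G w) (allFin n)

-- the (j+1)-th neighbour (diamond index j : Fin Δ stands for ◇_{j+1})
nthNbr : {n Δ : ℕ} → Graph n Δ → Fin n → Fin Δ → Maybe (Fin n)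
nthNbr G w j = nthMaybe (nbrs G w) (toℕ j)

-- MPMSC syntax: schemata over L proposition symbols, k head predicates,
-- diamonds ◇_1..◇_Δ.

data Sch (L k Δ : ℕ) : Set where
  top  : Sch L k Δ
  prop : Fin L → Sch L k Δ
  var  : Fin k → Sch L k Δ
  neg  : Sch L k Δ → Sch L k Δ
  and  : Sch L k Δ → Sch L k Δ → Sch L k Δ
  dia  : Fin Δ → Sch L k Δ → Sch L k Δ

md : {L k Δ : ℕ} → Sch L k Δ → ℕ
md top = 0
md (prop _) = 0
md (var _) = 0
md (neg φ) = md φ
md (and φ ψ) = md φ Data.Nat.⊔ md ψ
md (dia _ φ) = suc (md φ)

hasDia : {L k Δ : ℕ} → Sch L k Δ → Bool
hasDia top = false
hasDia (prop _) = false
hasDia (var _) = false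
hasDia (neg φ) = hasDia φ
hasDia (and φ ψ) = hasDia φ ∨ hasDia ψ
hasDia (dia _ _) = true

hasVar : {L k Δ : ℕ} → Sch L k Δ → Bool
hasVar top = false
hasVar (prop _) = false
hasVar (var _) = true
hasVar (neg φ) = hasVar φ
hasVar (and φ ψ) = hasVar φ ∨ hasVar ψ
hasVar (dia _ φ) = hasVar φ

sizeSch : {L k Δ : ℕ} → Sch L k Δ → ℕ
sizeSch top = 1
sizeSch (prop _) = 1
sizeSch (var _) = 1
sizeSch (neg φ) = suc (sizeSch φ)
sizeSch (and φ ψ) = suc (sizeSch φ + sizeSch ψ)
sizeSch (dia _ φ) = suc (sizeSch φ)

-- iteration clauses: standard Y := ψ, or conditional
-- Y :=_{φ1..φm} ψ1;…;ψm;χ  with m ≥ 1 (first pair, remaining pairs, backup)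
data Clause (L k Δ : ℕ) : Set where
  std : Sch L k Δ → Clause L k Δ
  cnd : (Sch L k Δ × Sch L k Δ) → List (Sch L k Δ × Sch L k Δ) → Sch L k Δ → Clause L k Δ

AllL : {A : Set} → (A → Set) → List A → Set
AllL P [] = Data.Unit.⊤ where import Data.Unit
AllL P (x ∷ xs) = P x × AllL P xs

ClauseWF : {L k Δ : ℕ} → Clause L k Δ → Set
ClauseWF (std ψ) = md ψ ≤ 1
ClauseWF (cnd c cs χ) =
  AllL (λ p → md (Data.Product.proj₁ p) ≡ 0 × md (Data.Product.proj₂ p) ≤ 1) (c ∷ cs)
  × md χ ≤ 1

sizePairs : {L k Δ : ℕ} → List (Sch L k Δ × Sch L k Δ) → ℕ
sizePairs [] = 0
sizePairs ((φ , ψ) ∷ cs) = sizeSch φ + sizeSch ψ + sizePairs cs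

sizeClause : {L k Δ : ℕ} → Clause L k Δ → ℕ
sizeClause (std ψ) = sizeSch ψ
sizeClause (cnd c cs χ) = sizePairs (c ∷ cs) + sizeSch χ

-- a (Π,Δ)-program with |Π| = L; head predicates Y_1..Y_k are Fin k
record Program (L Δ : ℕ) : Set where
  field
    k     : ℕ
    term  : Fin k → Sch L k Δ
    iter  : Fin k → Clause L k Δ
    att   : Fin k → Bool
    prt   : Fin k → Bool
open Program public

ProgramWF : {L Δ : ℕ} → Program L Δ → Set
ProgramWF P =
  (∀ i → hasDia (term P i) ≡ false × hasVar (term P i) ≡ false)
  × (∀ i → ClauseWF (iter P i))

-- size: every clause, counting the head predicate on its left-hand side
progSize : {L Δ : ℕ} → Program L Δ → ℕ
progSize P = sumFin (k P) (λ i → suc (sizeSch (term P i)))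
           + sumFin (k P) (λ i → suc (sizeClause (iter P i)))

module Sem {n Δ : ℕ} (G : Graph n Δ) {K : ℕ} where

  -- X i w : truth value of head predicate Y_i at w (previous round)
  eval : (Fin K → Fin n → Bool) → Sch (lg n) K Δ → Fin n → Bool
  evalDia : (Fin K → Fin n → Bool) → Sch (lg n) K Δ → Maybe (Fin n) → Bool
  eval X top w = true
  eval X (prop p) w = val p w
  eval X (var i) w = X i w
  eval X (neg φ) w = not (eval X φ w)
  eval X (and φ ψ) w = eval X φ w ∧ eval X ψ w
  eval X (dia j φ) w = evalDia X φ (nthNbr G w j)
  evalDia X φ nothing = false
  evalDia X φ (just u) = eval X φ u

  hotIn : (Fin K → Fin n → Bool) → List (Sch (lg n) K Δ × Sch (lg n) K Δ) → Sch (lg n) K Δ → Fin n → Sch (lg n) K Δ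
  hotIn X [] χ w = χ
  hotIn X ((φ , ψ) ∷ cs) χ w = if eval X φ w then ψ else hotIn X cs χ w

  body : (Fin K → Fin n → Bool) → Clause (lg n) K Δ → Fin n → Sch (lg n) K Δ
  body X (std ψ) w = ψ
  body X (cnd c cs χ) w = hotIn X (c ∷ cs) χ w

  broadcasts : (Fin K → Fin n → Bool) → Clause (lg n) K Δ → Fin n → Bool
  broadcasts X cl w = hasDia (body X cl w)

module Run {n Δ : ℕ} (G : Graph n Δ) (P : Program (lg n) Δ) where
  open Sem G {k P}

  conf : ℕ → Fin (k P) → Fin n → Bool
  conf zero i w = eval (λ _ _ → false) (term P i) w
  conf (suc r) i w = eval (conf r) (body (conf r) (iter P i) w) w

  attentive : ℕ → Fin n → Bool
  attentive r w = anyFin (k P) (λ i → att P i ∧ conf r i w)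

  OutputsAt : ℕ → Fin n → Set
  OutputsAt r w = attentive r w ≡ true × (∀ r' → r' < r → attentive r' w ≡ false)

  output : ℕ → Fin n → List Bool
  output r w = map (λ i → conf r i w) (bfilter (prt P) (allFin (k P)))

  gcr : ℕ → Bool
  gcr zero = false
  gcr (suc r) = anyFin n (λ w → anyFin (k P) (λ i → broadcasts (conf r) (iter P i) w))

  gcrCount : ℕ → ℕ
  gcrCount zero = 0
  gcrCount (suc T) = (if gcr (suc T) then 1 else 0) + gcrCount T

IsColorString : ℕ → List Bool → Set
IsColorString c s = Σ ℕ (λ a → Σ ℕ (λ b → a < c × s ≡ replicate a false ++ (true ∷ replicate b false)))

ColorsProperlyWithin : (n Δ : ℕ) → Program (lg n) Δ → ℕ → Set
ColorsProperlyWithin n Δ P R =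
  (G : Graph n Δ) → let open Run G P in
    (∀ w → Σ ℕ (λ r → OutputsAt r w × IsColorString (suc Δ) (output r w) × r ≤ R))
    × (∀ u v r r' → adj G u v ≡ true → OutputsAt r u → OutputsAt r' v → output r u ≡ output r' v → Data.Empty.⊥)
  where import Data.Empty

ExactlyGCR : (n Δ : ℕ) → Program (lg n) Δ → ℕ → Set
ExactlyGCR n Δ P c =
  (G : Graph n Δ) → let open Run G P in
    Σ ℕ (λ T → (∀ r → T < r → gcr r ≡ false) × gcrCount T ≡ c)

{-# OPTIONS --safe #-}
module Submission where

-- Let the i-th neighbour of a node be its parent in "forest" i. Every edge {u,v} is a
-- parent edge of one of these Δ functional graphs (they may contain 2-cycles, which is
-- harmless), so proper 3-colourings of all of them combine to a proper 3^Δ-colouring.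
-- Cole–Vishkin needs only the parent's colour: a w-bit colour is replaced by a position
-- where it differs from the parent's, together with the bit there, i.e. by about
-- log w + 1 bits; after log* n + 2 steps three bits are left. Five rounds of shifting
-- colours down (so that all children of a node share one colour) and recolouring local
-- maxima leave three colours. The 3^Δ combined classes choose their final colours one
-- after the other: the a-th class takes colour a if a ≤ Δ, which needs no communication,
-- and the others take the least colour free among their neighbours. This makes
-- (log* n + 2) + 10 + (3^Δ − Δ − 1) communication rounds.
-- The widths shrink so fast that the whole schedule has O(log n + 3^Δ) rounds, so it can
-- be driven by a one-hot clock. The positions are computed by a sequential scan with a
-- binary counter, which keeps the clauses of constant size.

open import Defs hiding (sym)
open import Data.Nat
open import Data.Nat.Properties
open import Data.Nat.DivMod using (_/_; _%_; m≡m%n+[m/n]*n; m%n<n; m<n*o⇒m/o<n)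
open import Data.Nat.Induction using (<-rec)
open import Data.Nat.ListAction using (sum)
open import Data.Nat.ListAction.Properties using (sum-++)
open import Data.Nat.Logarithm using (⌊log₂_⌋; ⌊log₂⌋-mono-≤; ⌊log₂⌊n/2⌋⌋≡⌊log₂n⌋∸1; ⌊log₂[2^n]⌋≡n)
open import Data.Nat.Tactic.RingSolver using (solve-∀)
open import Data.Bool using (Bool; true; false; not; _∧_; _∨_; _xor_; if_then_else_; T)
import Data.Bool as Bool
open import Data.Bool.Properties using (T-≡; ∧-zeroʳ; ∧-identityʳ; ∨-zeroʳ; ∨-identityʳ; xor-same)
open import Data.Empty using (⊥; ⊥-elim)
open import Data.Fin using (Fin; zero; suc; toℕ; fromℕ<)
import Data.Fin as Fin
open import Data.Fin.Properties using (toℕ<n; toℕ-fromℕ<; fromℕ<-toℕ; toℕ-injective; any?; pigeonhole)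
open import Data.List using (List; []; _∷_; length; map; _++_; replicate; allFin; upTo; applyUpTo; lookup; concat; cartesianProductWith)
open import Data.List.Properties using (map-∘; map-cong; map-++; map-upTo; map-tabulate; tabulate-lookup; length-++; length-replicate; length-upTo; ∷-injectiveˡ; ∷-injectiveʳ)
open import Data.List.Relation.Unary.All using (All; []; _∷_)
import Data.List.Relation.Unary.All.Properties as All
open import Data.List.Relation.Unary.Any using (here; there; index)
open import Data.List.Relation.Unary.Any.Properties using (lookup-index)
open import Data.List.Membership.Propositional using (_∈_)
open import Data.List.Membership.Propositional.Properties using (∈-map⁺; ∈-upTo⁺; ∈-upTo⁻; ∈-concat⁺′; ∈-cartesianProductWith⁺; ∈-allFin; ∈-lookup)
import Data.List.Membership.DecPropositional as DecMembership
open import Data.Maybe using (Maybe; just; nothing)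
open import Data.Product using (Σ; ∃; _×_; _,_; proj₁; proj₂)
open import Data.Product.Properties using (≡-dec)
open import Data.Sum using (_⊎_; inj₁; inj₂)
open import Data.Unit using (⊤; tt)
open import Data.Vec using (Vec; []; _∷_)
import Data.Vec as Vec
import Data.Vec.Properties as Vec
open import Function using (_∘_; id)
open import Function.Bundles using (Equivalence)
open import Relation.Nullary using (¬_; yes; no)
open import Relation.Nullary.Decidable using (map′; ¬?; decidable-stable)
open import Relation.Nullary.Negation using (contradiction)
open import Relation.Binary.Definitions using (DecidableEquality; tri<; tri≈; tri>)
open import Relation.Binary.PropositionalEquality

-- The 2-cycles are harmless because every step uses only that the colours of a node and of its
-- parent differ, never that following parents ends at a root. A node without parent compares itself
-- with the zero colour. The exact number of communication rounds shapes the schedule. A round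
-- counts as soon as some hot formula contains a diamond, whatever the graph looks like, so the
-- count is a function of the instruction list alone. In fact `log* n` Cole-Vishkin steps already
-- reach three bits; a width of at most three persists, so the two further steps do no harm and
-- supply the rounds that the prescribed total asks for. Going from 8 to 3 colours takes one shift
-- and one recolouring for each of five colours, which gives the 10. A node recognises its turn
-- without comparing its class with the clock: the base-3 class number is incremented in every round
-- of the last phase, and the turn comes when all digits are 2. The classes therefore act in
-- decreasing order of their numbers.

≡ᵇ-true : ∀ {m n} → (m ≡ᵇ n) ≡ true → m ≡ n
≡ᵇ-true {m} {n} e = ≡ᵇ⇒≡ m n (Equivalence.from T-≡ e)

≡ᵇ-refl : ∀ n → (n ≡ᵇ n) ≡ true
≡ᵇ-refl n = Equivalence.to T-≡ (≡⇒≡ᵇ n n refl)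

≢⇒≡ᵇ-false : ∀ {m n} → m ≢ n → (m ≡ᵇ n) ≡ false
≢⇒≡ᵇ-false {m} {n} m≢n with m ≡ᵇ n in e
... | true  = contradiction (≡ᵇ-true e) m≢n
... | false = refl

<ᵇ-true : ∀ {m n} → (m <ᵇ n) ≡ true → m < n
<ᵇ-true {m} {n} e = <ᵇ⇒< m n (Equivalence.from T-≡ e)

<⇒<ᵇ-true : ∀ {m n} → m < n → (m <ᵇ n) ≡ true
<⇒<ᵇ-true m<n = Equivalence.to T-≡ (<⇒<ᵇ m<n)

≥⇒<ᵇ-false : ∀ {m n} → n ≤ m → (m <ᵇ n) ≡ false
≥⇒<ᵇ-false {m} {n} n≤m with m <ᵇ n in e
... | true  = contradiction (<ᵇ-true e) (≤⇒≯ n≤m)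
... | false = refl

-- Bounded quantifiers with Boolean values

allBelow : ℕ → (ℕ → Bool) → Bool
allBelow zero    g = true
allBelow (suc m) g = g m ∧ allBelow m g

allBelow-cong : ∀ m {g h} → (∀ i → i < m → g i ≡ h i) → allBelow m g ≡ allBelow m h
allBelow-cong zero    e = refl
allBelow-cong (suc m) e = cong₂ _∧_ (e m ≤-refl) (allBelow-cong m λ i i<m → e i (m<n⇒m<1+n i<m))

allBelow-true : ∀ m g → (∀ i → i < m → g i ≡ true) → allBelow m g ≡ true
allBelow-true zero    g e = refl
allBelow-true (suc m) g e rewrite e m ≤-refl = allBelow-true m g λ i i<m → e i (m<n⇒m<1+n i<m)

allBelow-elim : ∀ m g → allBelow m g ≡ true → ∀ i → i < m → g i ≡ true
allBelow-elim (suc m) g e i i<1+m with g m in gm | m<1+n⇒m<n∨m≡n i<1+m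
... | true | inj₁ i<m  = allBelow-elim m g e i i<m
... | true | inj₂ refl = gm

allBelow-false : ∀ m g → allBelow m g ≡ false → ∃ λ i → i < m × g i ≡ false
allBelow-false (suc m) g e with g m in gm
... | false = m , ≤-refl , gm
... | true with allBelow-false m g e
...   | i , i<m , gi = i , m<n⇒m<1+n i<m , gi

anyBelow : ℕ → (ℕ → Bool) → Bool
anyBelow m g = not (allBelow m (not ∘ g))

not-true : ∀ {b} → not b ≡ true → b ≡ false
not-true {false} _ = refl

not-false : ∀ {b} → not b ≡ false → b ≡ true
not-false {true} _ = refl

anyBelow-intro : ∀ m g i → i < m → g i ≡ true → anyBelow m g ≡ true
anyBelow-intro m g i i<m gi with allBelow m (not ∘ g) in e
... | false = refl
... | true with () ← trans (sym (cong not gi)) (allBelow-elim m (not ∘ g) e i i<m)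

anyBelow-elim : ∀ m g → anyBelow m g ≡ true → ∃ λ i → i < m × g i ≡ true
anyBelow-elim m g e with allBelow-false m (not ∘ g) (not-true e)
... | i , i<m , gi = i , i<m , not-false gi

anyBelow-false : ∀ m g → (∀ i → i < m → g i ≡ false) → anyBelow m g ≡ false
anyBelow-false m g e = cong not (allBelow-true m (not ∘ g) λ i i<m → cong not (e i i<m))

-- Positional numerals

value : ℕ → ℕ → (ℕ → ℕ) → ℕ
value β zero    d = 0
value β (suc m) d = value β m d + β ^ m * d m

value-cong : ∀ β m {d e} → (∀ i → i < m → d i ≡ e i) → value β m d ≡ value β m e
value-cong β zero    h = refl
value-cong β (suc m) h =
  cong₂ (λ a b → a + β ^ m * b) (value-cong β m λ i i<m → h i (m<n⇒m<1+n i<m)) (h m ≤-refl)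

value-< : ∀ β m {d} → (∀ i → i < m → d i < β) → value β m d < β ^ m
value-< β zero    h = ≤-refl
value-< β (suc m) {d} h = begin-strict
  value β m d + β ^ m * d m <⟨ +-monoˡ-< (β ^ m * d m) (value-< β m λ i i<m → h i (m<n⇒m<1+n i<m)) ⟩
  β ^ m + β ^ m * d m       ≡⟨ *-suc (β ^ m) (d m) ⟨
  β ^ m * suc (d m)         ≤⟨ *-monoʳ-≤ (β ^ m) (h m ≤-refl) ⟩
  β ^ m * β                 ≡⟨ *-comm (β ^ m) β ⟩
  β ^ suc m                 ∎
  where open ≤-Reasoning

private
  -- The lower digits together are worth less than one unit of the leading digit, so they cannot
  -- make up for a smaller one.
  lead-≮ : ∀ {a a' b x x'} → a < b → a + b * x ≡ a' + b * x' → ¬ (x < x')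
  lead-≮ {a} {a'} {b} {x} {x'} a<b e x<x' = <-irrefl e (begin-strict
    a + b * x   <⟨ +-monoˡ-< (b * x) a<b ⟩
    b + b * x   ≡⟨ *-suc b x ⟨
    b * suc x   ≤⟨ *-monoʳ-≤ b x<x' ⟩
    b * x'      ≤⟨ m≤n+m (b * x') a' ⟩
    a' + b * x' ∎)
    where open ≤-Reasoning

value-injective : ∀ β m {d e} → (∀ i → i < m → d i < β) → (∀ i → i < m → e i < β) →
                  value β m d ≡ value β m e → ∀ i → i < m → d i ≡ e i
value-injective β (suc m) {d} {e} hd he eq i i<1+m = go (<-cmp (d m) (e m))
  where
  vd = value-< β m {d} λ j j<m → hd j (m<n⇒m<1+n j<m)
  ve = value-< β m {e} λ j j<m → he j (m<n⇒m<1+n j<m)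
  go : _ → d i ≡ e i
  go (tri< lt _ _) = contradiction lt (lead-≮ vd eq)
  go (tri> _ _ gt) = contradiction gt (lead-≮ ve (sym eq))
  go (tri≈ _ dm≡em _) with m<1+n⇒m<n∨m≡n i<1+m
  ... | inj₂ refl = dm≡em
  ... | inj₁ i<m  = value-injective β m
          (λ j j<m → hd j (m<n⇒m<1+n j<m)) (λ j j<m → he j (m<n⇒m<1+n j<m))
          (+-cancelʳ-≡ (β ^ m * e m) _ _ (trans (cong (λ x → value β m d + β ^ m * x) (sym dm≡em)) eq))
          i i<m

bump : ℕ → ℕ → ℕ
bump hi x = if x ≡ᵇ hi then 0 else suc x

-- The carry rule of a counter in base `suc hi`, given separately for each digit, as clauses
-- require. It serves twice: with `hi` = 1 for positions in a scan, with `hi` = 2 for class numbers.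
ripple : ℕ → (ℕ → ℕ) → ℕ → ℕ
ripple hi d i = if allBelow i (λ j → d j ≡ᵇ hi) then bump hi (d i) else d i

-- The alternatives are absence and presence of overflow. Overflow happens exactly when all digits
-- are maximal, and this is the test by which a node detects its turn.
value-ripple : ∀ hi m {d e} → (∀ i → i < m → e i ≡ ripple hi d i) →
  (allBelow m (λ j → d j ≡ᵇ hi) ≡ false × value (suc hi) m e ≡ suc (value (suc hi) m d))
  ⊎ (allBelow m (λ j → d j ≡ᵇ hi) ≡ true × value (suc hi) m e ≡ 0
     × suc (value (suc hi) m d) ≡ suc hi ^ m)
value-ripple hi zero    h = inj₂ (refl , refl , refl)
value-ripple hi (suc m) {d} {e} h
  with value-ripple hi m {d} {e} (λ i i<m → h i (m<n⇒m<1+n i<m)) | h m ≤-refl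
... | inj₁ (a , v) | hm rewrite a | hm | v = inj₁ (∧-zeroʳ _ , refl)
... | inj₂ (a , v , w) | hm rewrite a | hm | v with d m ≡ᵇ hi in dm
...   | true  = inj₂ (refl , *-zeroʳ (suc hi ^ m) , (begin
                  suc (value (suc hi) m d) + suc hi ^ m * d m ≡⟨ cong₂ (λ x y → x + suc hi ^ m * y) w (≡ᵇ-true dm) ⟩
                  suc hi ^ m + suc hi ^ m * hi               ≡⟨ *-suc (suc hi ^ m) hi ⟨
                  suc hi ^ m * suc hi                         ≡⟨ *-comm (suc hi ^ m) (suc hi) ⟩
                  suc hi ^ suc m                               ∎))
  where open ≡-Reasoning
...   | false = inj₁ (refl , trans (*-suc (suc hi ^ m) (d m)) (cong (_+ suc hi ^ m * d m) (sym w)))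

bitℕ : Bool → ℕ
bitℕ true  = 1
bitℕ false = 0

-- The recursion is the update rule of a binary counter.
bit : ℕ → ℕ → Bool
bit b zero    = false
bit b (suc x) = if allBelow b (λ a → bit a x) then not (bit b x) else bit b x

bits : ℕ → ℕ → ℕ
bits x b = bitℕ (bit b x)

bitℕ-≡ᵇ1 : ∀ a → (bitℕ a ≡ᵇ 1) ≡ a
bitℕ-≡ᵇ1 true  = refl
bitℕ-≡ᵇ1 false = refl

bits-suc : ∀ x b → bits (suc x) b ≡ ripple 1 (bits x) b
bits-suc x b
  rewrite allBelow-cong b {λ j → bits x j ≡ᵇ 1} {λ j → bit j x} (λ j _ → bitℕ-≡ᵇ1 (bit j x))
  with allBelow b (λ j → bit j x)
... | false = refl
... | true with bit b x
...   | true  = refl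
...   | false = refl

value-bits : ∀ m x → x < 2 ^ m → value 2 m (bits x) ≡ x
value-bits m zero    _ = zeros m
  where
  zeros : ∀ m → value 2 m (bits 0) ≡ 0
  zeros zero    = refl
  zeros (suc m) rewrite zeros m = *-zeroʳ (2 ^ m)
value-bits m (suc x) x<2^m with value-bits m x (m<1+n⇒m≤n (m<n⇒m<1+n x<2^m)) | value-ripple 1 m {bits x} {bits (suc x)} (λ i _ → bits-suc x i)
... | ih | inj₁ (_ , v) = trans v (cong suc ih)
... | ih | inj₂ (_ , _ , w) = contradiction (trans (sym (cong suc ih)) w) (<⇒≢ x<2^m)

-- A one at place b alone contributes 2^b to the value.
bit-high : ∀ b x → x < 2 ^ b → bit b x ≡ false
bit-high b x x<2^b with bit b x in e
... | false = refl
... | true  = contradiction (begin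
    2 ^ b                        ≡⟨ *-identityʳ (2 ^ b) ⟨
    2 ^ b * 1                    ≡⟨ cong (λ t → 2 ^ b * bitℕ t) e ⟨
    2 ^ b * bits x b             ≤⟨ m≤n+m _ (value 2 b (bits x)) ⟩
    value 2 (suc b) (bits x)     ≡⟨ value-bits (suc b) x (≤-trans x<2^b (^-monoʳ-≤ 2 (n≤1+n b))) ⟩
    x                            ∎) (<⇒≱ x<2^b)
  where open ≤-Reasoning

bit-separates : ∀ m {x y} → x < 2 ^ m → y < 2 ^ m → x ≢ y → ∃ λ b → b < m × bit b x ≢ bit b y
bit-separates m {x} {y} hx hy x≢y with allBelow m (λ b → bits x b ≡ᵇ bits y b) in e
... | true  = contradiction
                (trans (sym (value-bits m x hx))
                  (trans (value-cong 2 m λ i i<m → ≡ᵇ-true (allBelow-elim m _ e i i<m)) (value-bits m y hy)))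
                x≢y
... | false with allBelow-false m _ e
...   | b , b<m , ne = b , b<m , λ eq → contradiction
                          (trans (sym (≡ᵇ-refl (bits x b))) (trans (cong (λ t → bits x b ≡ᵇ bitℕ t) eq) ne)) λ ()

-- Logarithms

⌊n/2⌋+⌊n/2⌋≤n : ∀ n → 2 * ⌊ n /2⌋ ≤ n
⌊n/2⌋+⌊n/2⌋≤n n = begin
  2 * ⌊ n /2⌋         ≡⟨ cong (⌊ n /2⌋ +_) (+-identityʳ _) ⟩
  ⌊ n /2⌋ + ⌊ n /2⌋   ≤⟨ +-monoʳ-≤ ⌊ n /2⌋ (⌊n/2⌋≤⌈n/2⌉ n) ⟩
  ⌊ n /2⌋ + ⌈ n /2⌉   ≡⟨ ⌊n/2⌋+⌈n/2⌉≡n n ⟩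
  n                   ∎
  where open ≤-Reasoning

2^⌊log₂⌋≤ : ∀ n → 1 ≤ n → 2 ^ ⌊log₂ n ⌋ ≤ n
2^⌊log₂⌋≤ = <-rec _ go
  where
  go : ∀ n → (∀ {m} → m < n → 1 ≤ m → 2 ^ ⌊log₂ m ⌋ ≤ m) → 1 ≤ n → 2 ^ ⌊log₂ n ⌋ ≤ n
  go 1 rec _ = ≤-refl
  go n@(suc (suc n')) rec _ = begin
    2 ^ ⌊log₂ n ⌋               ≤⟨ ^-monoʳ-≤ 2 (m≤n+m∸n ⌊log₂ n ⌋ 1) ⟩
    2 ^ suc (⌊log₂ n ⌋ ∸ 1)     ≡⟨ cong (λ l → 2 ^ suc l) (⌊log₂⌊n/2⌋⌋≡⌊log₂n⌋∸1 n) ⟨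
    2 * 2 ^ ⌊log₂ ⌊ n /2⌋ ⌋     ≤⟨ *-monoʳ-≤ 2 (rec (⌊n/2⌋<n (suc n')) (s≤s z≤n)) ⟩
    2 * ⌊ n /2⌋                 ≤⟨ ⌊n/2⌋+⌊n/2⌋≤n n ⟩
    n                           ∎
    where open ≤-Reasoning

<2^lg : ∀ n → n < 2 ^ lg n
<2^lg n = ≰⇒> λ h → <-irrefl refl (subst (_≤ ⌊log₂ n ⌋) (⌊log₂[2^n]⌋≡n (lg n)) (⌊log₂⌋-mono-≤ h))

≤2^⇒⌊log₂⌋≤ : ∀ {n t} → n ≤ 2 ^ t → ⌊log₂ n ⌋ ≤ t
≤2^⇒⌊log₂⌋≤ {n} {t} h = subst (⌊log₂ n ⌋ ≤_) (⌊log₂[2^n]⌋≡n t) (⌊log₂⌋-mono-≤ h)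

2^≤⇒≤⌊log₂⌋ : ∀ {n t} → 2 ^ t ≤ n → t ≤ ⌊log₂ n ⌋
2^≤⇒≤⌊log₂⌋ {n} {t} h = subst (_≤ ⌊log₂ n ⌋) (⌊log₂[2^n]⌋≡n t) (⌊log₂⌋-mono-≤ h)

<2^⇒⌊log₂⌋< : ∀ {n t} → 1 ≤ n → n < 2 ^ t → ⌊log₂ n ⌋ < t
<2^⇒⌊log₂⌋< {n} {t} 1≤n h = ≰⇒> λ t≤ →
  <⇒≱ h (≤-trans (^-monoʳ-≤ 2 t≤) (2^⌊log₂⌋≤ n 1≤n))

1+n≤2^n : ∀ n → suc n ≤ 2 ^ n
1+n≤2^n zero    = ≤-refl
1+n≤2^n (suc n) = begin
  1 + suc n             ≤⟨ +-mono-≤ (m^n>0 2 n) (1+n≤2^n n) ⟩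
  2 ^ n + 2 ^ n         ≡⟨ cong (2 ^ n +_) (+-identityʳ (2 ^ n)) ⟨
  2 ^ suc n             ∎
  where open ≤-Reasoning

tower-≥ : ∀ i → suc i ≤ tower i
tower-≥ zero    = ≤-refl
tower-≥ (suc i) = ≤-trans (s≤s (tower-≥ i)) (1+n≤2^n (tower i))

private
  ≤ᵇ-true : ∀ {m n} → (m ≤ᵇ n) ≡ true → m ≤ n
  ≤ᵇ-true {m} {n} e = ≤ᵇ⇒≤ m n (Equivalence.from T-≡ e)

  ≤ᵇ-false : ∀ {m n} → (m ≤ᵇ n) ≡ false → n < m
  ≤ᵇ-false {m} {n} e = ≰⇒> λ m≤n → contradiction (trans (sym (Equivalence.to T-≡ (≤⇒≤ᵇ m≤n))) e) λ ()

  logStarFrom-upper : ∀ n f i → n ≤ f + i → n ≤ tower (logStarFrom n f i)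
  logStarFrom-upper n zero    i h = ≤-trans h (≤-trans (n≤1+n i) (tower-≥ i))
  logStarFrom-upper n (suc f) i h with n ≤ᵇ tower i in e
  ... | true  = ≤ᵇ-true e
  ... | false = logStarFrom-upper n f (suc i) (subst (n ≤_) (sym (+-suc f i)) h)

  logStarFrom-least : ∀ n f i j → i ≤ j → j < logStarFrom n f i → tower j < n
  logStarFrom-least n zero    i j i≤j j< = contradiction j< (≤⇒≯ i≤j)
  logStarFrom-least n (suc f) i j i≤j j< with n ≤ᵇ tower i in e
  ... | true  = contradiction j< (≤⇒≯ i≤j)
  ... | false with m≤n⇒m<n∨m≡n i≤j
  ...   | inj₂ refl = ≤ᵇ-false e
  ...   | inj₁ i<j  = logStarFrom-least n f (suc i) j i<j j<

≤tower-logStar : ∀ n → n ≤ tower (logStar n)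
≤tower-logStar n = logStarFrom-upper n n 0 (m≤m+n n 0)

-- If `logStar n` is s + 2, minimality gives `tower (suc s)` < n, and this tower is 2 to a power of
-- at least s + 1.
logStar≤lg : ∀ n → logStar n ≤ lg n
logStar≤lg n with logStar n in e
... | 0 = z≤n
... | 1 = s≤s z≤n
... | suc (suc s) = s≤s (2^≤⇒≤⌊log₂⌋ (≤-trans (^-monoʳ-≤ 2 (tower-≥ s))
        (<⇒≤ (logStarFrom-least n n 0 (suc s) z≤n (subst (suc s <_) (sym e) ≤-refl)))))

-- Widths of the Cole–Vishkin colours

-- One Cole–Vishkin step replaces a w-bit colour by one bit and a position below w.
nextWidth : ℕ → ℕ
nextWidth w = suc (lg (w ∸ 1))

width : ℕ → ℕ → ℕ
width zero    w = w
width (suc m) w = width m (nextWidth w)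

w≤2^lg : ∀ w → w ≤ 2 ^ lg (w ∸ 1)
w≤2^lg w = ≤-trans (m≤n+m∸n w 1) (<2^lg (w ∸ 1))

lg-pred-≤ : ∀ {w t} → w ≤ 2 ^ suc t → lg (w ∸ 1) ≤ suc t
lg-pred-≤ {0}           h = s≤s z≤n
lg-pred-≤ {1}           h = s≤s z≤n
lg-pred-≤ {suc (suc w)} h = <2^⇒⌊log₂⌋< (s≤s z≤n) h

nextWidth-≤3 : ∀ {w} → w ≤ 4 → nextWidth w ≤ 3
nextWidth-≤3 h = s≤s (lg-pred-≤ {t = 1} h)

width-≤3 : ∀ m {w} → w ≤ 3 → width m w ≤ 3
width-≤3 zero    h = h
width-≤3 (suc m) h = width-≤3 m (nextWidth-≤3 (≤-trans h (n≤1+n 3)))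

-- The offset 3 absorbs the constant lost in a step: 2^t + 3 ≤ 2^(t+2), so the next width is at most
-- t + 3 and the tower loses one level. At the bottom, width 4 drops to 3 in one more step and stays
-- there.
width-tower : ∀ s m {w} → w ≤ tower s + 3 → width (s + suc m) w ≤ 3
width-tower zero    m h = width-≤3 m (nextWidth-≤3 h)
width-tower (suc s) m {w} h = width-tower s m (subst (nextWidth w ≤_) (+-comm 3 (tower s)) (s≤s (lg-pred-≤ (begin
  w                        ≤⟨ h ⟩
  2 ^ t + 3                ≤⟨ +-monoʳ-≤ (2 ^ t) (*-monoʳ-≤ 3 (m^n>0 2 t)) ⟩
  2 ^ t + 3 * 2 ^ t        ≡⟨ quadruple (2 ^ t) ⟩
  2 * (2 * 2 ^ t)          ∎))))
  where
  open ≤-Reasoning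
  t = tower s
  quadruple : ∀ x → x + 3 * x ≡ 2 * (2 * x)
  quadruple = solve-∀

-- For `logStar n` = s + 1 the bound n ≤ 2^`tower s` makes the initial width at most `tower s` + 3,
-- so s + 1 of the s + 3 steps already reach width 3.
width-logStar : ∀ n → 1 ≤ n → width (logStar n + 2) (lg n + 2) ≤ 3
width-logStar n 1≤n with logStar n | ≤tower-logStar n
... | zero  | n≤1 = width-tower 0 1 (+-monoˡ-≤ 2 (s≤s (≤2^⇒⌊log₂⌋≤ {t = 1} (≤-trans n≤1 (n≤1+n 1)))))
... | suc s | n≤t = subst (λ m → width m (lg n + 2) ≤ 3) (+-suc s 2)
      (width-tower s 2 (subst (lg n + 2 ≤_) (sym (+-suc (tower s) 2)) (+-monoˡ-≤ 2 (s≤s (≤2^⇒⌊log₂⌋≤ n≤t)))))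

-- Registers of the initial length thus serve every phase. Applied to `W` itself it says that a
-- position and one bit fit into a colour, that is `B` < `W`.
nextWidth-≤ : ∀ {w v} → 2 ≤ v → w ≤ v → nextWidth w ≤ v
nextWidth-≤ {0}           h _ = h
nextWidth-≤ {1}           h _ = h
nextWidth-≤ {suc (suc w)} h w≤v =
  ≤-trans (s≤s (≤-trans (1+n≤2^n _) (2^⌊log₂⌋≤ (suc w) (s≤s z≤n)))) w≤v

private
  2n≤2^n+1 : ∀ n → n + n ≤ 2 ^ n + 1
  2n≤2^n+1 0 = z≤n
  2n≤2^n+1 1 = s≤s (s≤s z≤n)
  2n≤2^n+1 (suc (suc n)) = begin
    suc (suc n) + suc (suc n)        ≡⟨ cong (λ x → suc (suc x)) (+-suc n (suc n)) ⟩
    suc (suc (suc n + suc n))        ≤⟨ +-monoʳ-≤ 2 (2n≤2^n+1 (suc n)) ⟩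
    2 + (2 ^ suc n + 1)              ≡⟨ +-assoc 2 (2 ^ suc n) 1 ⟨
    2 + 2 ^ suc n + 1                ≤⟨ +-monoˡ-≤ 1 (+-monoˡ-≤ (2 ^ suc n) (^-monoʳ-≤ 2 {1} {suc n} (s≤s z≤n))) ⟩
    2 ^ suc n + 2 ^ suc n + 1        ≡⟨ cong (λ x → 2 ^ suc n + x + 1) (+-identityʳ (2 ^ suc n)) ⟨
    2 ^ suc (suc n) + 1              ∎
    where open ≤-Reasoning

-- A weak form of the logarithmic decrease, but enough to make the lengths of successive scans a
-- geometric series, up to a constant per phase.
nextWidth-half : ∀ w → 2 * nextWidth w ≤ w + 5
nextWidth-half 0 = s≤s (s≤s (s≤s (s≤s z≤n)))
nextWidth-half 1 = s≤s (s≤s (s≤s (s≤s z≤n)))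
nextWidth-half (suc (suc w)) = begin
  2 * suc (suc l)  ≡⟨ double l ⟩
  l + l + 4        ≤⟨ +-monoˡ-≤ 4 (2n≤2^n+1 l) ⟩
  2 ^ l + 1 + 4    ≤⟨ +-monoˡ-≤ 4 (+-monoˡ-≤ 1 (2^⌊log₂⌋≤ (suc w) (s≤s z≤n))) ⟩
  suc w + 1 + 4    ≡⟨ +-assoc (suc w) 1 4 ⟩
  suc w + 5        ≤⟨ n≤1+n _ ⟩
  suc (suc w) + 5  ∎
  where
  open ≤-Reasoning
  l = ⌊log₂ suc w ⌋
  double : ∀ x → 2 * suc (suc x) ≡ x + x + 4
  double = solve-∀

-- Boolean expressions

-- A `table` is an arbitrary Boolean function of a few atoms. Keeping it as a function makes its
-- meaning immediate. It compiles to a decision tree, exponential in the number of inputs, so tables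
-- have at most nine inputs and conjunctions of unbounded length use `_∧ₑ_`.
data Expr (A : Set) : Set where
  table : ∀ {m} → Vec A m → (Vec Bool m → Bool) → Expr A
  ¬ₑ_   : Expr A → Expr A
  _∧ₑ_  : Expr A → Expr A → Expr A

infixr 6 _∧ₑ_
infixr 5 _∨ₑ_

⟦_⟧ : {A : Set} → Expr A → (A → Bool) → Bool
⟦ table as f ⟧ ρ = f (Vec.map ρ as)
⟦ ¬ₑ e ⟧       ρ = not (⟦ e ⟧ ρ)
⟦ e ∧ₑ e' ⟧    ρ = ⟦ e ⟧ ρ ∧ ⟦ e' ⟧ ρ

_∨ₑ_ : {A : Set} → Expr A → Expr A → Expr A
e ∨ₑ e' = ¬ₑ (¬ₑ e ∧ₑ ¬ₑ e')

constₑ : {A : Set} → Bool → Expr A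
constₑ b = table [] (λ _ → b)

muxₑ : {A : Set} → Expr A → Expr A → Expr A → Expr A
muxₑ c e e' = (c ∧ₑ e) ∨ₑ (¬ₑ c ∧ₑ e')

allₑ : {A : Set} → ℕ → (ℕ → Expr A) → Expr A
allₑ zero    f = constₑ true
allₑ (suc m) f = f m ∧ₑ allₑ m f

anyₑ : {A : Set} → ℕ → (ℕ → Expr A) → Expr A
anyₑ m f = ¬ₑ allₑ m (λ i → ¬ₑ f i)

⟦∨ₑ⟧ : {A : Set} (e e' : Expr A) (ρ : A → Bool) → ⟦ e ∨ₑ e' ⟧ ρ ≡ ⟦ e ⟧ ρ ∨ ⟦ e' ⟧ ρ
⟦∨ₑ⟧ e e' ρ with ⟦ e ⟧ ρ | ⟦ e' ⟧ ρ
... | true  | _     = refl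
... | false | true  = refl
... | false | false = refl

⟦muxₑ⟧ : {A : Set} (c e e' : Expr A) (ρ : A → Bool) →
         ⟦ muxₑ c e e' ⟧ ρ ≡ (if ⟦ c ⟧ ρ then ⟦ e ⟧ ρ else ⟦ e' ⟧ ρ)
⟦muxₑ⟧ c e e' ρ with ⟦ c ⟧ ρ | ⟦ e ⟧ ρ | ⟦ e' ⟧ ρ
... | true  | true  | _     = refl
... | true  | false | _     = refl
... | false | _     | true  = refl
... | false | _     | false = refl

⟦allₑ⟧ : {A : Set} (m : ℕ) (f : ℕ → Expr A) (ρ : A → Bool) →
         ⟦ allₑ m f ⟧ ρ ≡ allBelow m (λ i → ⟦ f i ⟧ ρ)
⟦allₑ⟧ zero    f ρ = refl
⟦allₑ⟧ (suc m) f ρ = cong (⟦ f m ⟧ ρ ∧_) (⟦allₑ⟧ m f ρ)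

⟦anyₑ⟧ : {A : Set} (m : ℕ) (f : ℕ → Expr A) (ρ : A → Bool) →
         ⟦ anyₑ m f ⟧ ρ ≡ anyBelow m (λ i → ⟦ f i ⟧ ρ)
⟦anyₑ⟧ m f ρ = cong not (⟦allₑ⟧ m (λ i → ¬ₑ f i) ρ)

-- Compilation of expressions to schemata

module _ {L k Δ : ℕ} where

  iteS : Sch L k Δ → Sch L k Δ → Sch L k Δ → Sch L k Δ
  iteS a s s' = neg (and (neg (and a s)) (neg (and (neg a) s')))

  boolS : Bool → Sch L k Δ
  boolS true  = top
  boolS false = neg top

  tableS : {A : Set} → (A → Sch L k Δ) → ∀ {m} → Vec A m → (Vec Bool m → Bool) → Sch L k Δ
  tableS atm []       f = boolS (f [])
  tableS atm (a ∷ as) f = iteS (atm a) (tableS atm as (f ∘ (true ∷_))) (tableS atm as (f ∘ (false ∷_)))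

  compile : {A : Set} → (A → Sch L k Δ) → Expr A → Sch L k Δ
  compile atm (table as f) = tableS atm as f
  compile atm (¬ₑ e)       = neg (compile atm e)
  compile atm (e ∧ₑ e')    = and (compile atm e) (compile atm e')

  module _ {A : Set} (atm : A → Sch L k Δ) where

    md-compile : (∀ a → md (atm a) ≤ 1) → ∀ e → md (compile atm e) ≤ 1
    md-compile h (table as f) = go as f
      where
      go : ∀ {m} (as : Vec A m) f → md (tableS atm as f) ≤ 1
      go []       f with f []
      ... | true  = z≤n
      ... | false = z≤n
      go (a ∷ as) f = ⊔-lub (⊔-lub (h a) (go as _)) (⊔-lub (h a) (go as _))
    md-compile h (¬ₑ e)    = md-compile h e
    md-compile h (e ∧ₑ e') = ⊔-lub (md-compile h e) (md-compile h e')

    hasDia-compile : (∀ a → hasDia (atm a) ≡ false) → ∀ e → hasDia (compile atm e) ≡ false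
    hasDia-compile h (table as f) = go as f
      where
      go : ∀ {m} (as : Vec A m) f → hasDia (tableS atm as f) ≡ false
      go []       f with f []
      ... | true  = refl
      ... | false = refl
      go (a ∷ as) f rewrite h a | go as (f ∘ (true ∷_)) | go as (f ∘ (false ∷_)) = refl
    hasDia-compile h (¬ₑ e)    = hasDia-compile h e
    hasDia-compile h (e ∧ₑ e') rewrite hasDia-compile h e | hasDia-compile h e' = refl

module _ {n Δ : ℕ} (G : Graph n Δ) {K : ℕ} where
  open Sem G {K}

  eval-compile : {A : Set} (atm : A → Sch (lg n) K Δ) (X : Fin K → Fin n → Bool) (w : Fin n) →
                 ∀ e → eval X (compile atm e) w ≡ ⟦ e ⟧ (λ a → eval X (atm a) w)
  eval-compile {A} atm X w (table as f) = go as f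
    where
    go : ∀ {m} (as : Vec A m) f → eval X (tableS atm as f) w ≡ f (Vec.map (λ a → eval X (atm a) w) as)
    go []       f with f []
    ... | true  = refl
    ... | false = refl
    go (a ∷ as) f rewrite go as (f ∘ (true ∷_)) | go as (f ∘ (false ∷_)) with eval X (atm a) w
    ... | true  with f (true ∷ Vec.map (λ a → eval X (atm a) w) as)
    ...   | true  = refl
    ...   | false = refl
    go (a ∷ as) f | false with f (false ∷ Vec.map (λ a → eval X (atm a) w) as)
    ...   | true  = refl
    ...   | false = refl
  eval-compile atm X w (¬ₑ e)    = cong not (eval-compile atm X w e)
  eval-compile atm X w (e ∧ₑ e') = cong₂ _∧_ (eval-compile atm X w e) (eval-compile atm X w e')

-- Instructions and registers

data Kind : Set where
  load scan copy shift reduce init greedy : Kind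

kinds : List Kind
kinds = load ∷ scan ∷ copy ∷ shift ∷ reduce ∷ init ∷ greedy ∷ []

kind∈ : ∀ κ → κ ∈ kinds
kind∈ load   = here refl
kind∈ scan   = there (here refl)
kind∈ copy   = there (there (here refl))
kind∈ shift  = there (there (there (here refl)))
kind∈ reduce = there (there (there (there (here refl))))
kind∈ init   = there (there (there (there (there (here refl)))))
kind∈ greedy = there (there (there (there (there (there (here refl))))))

comm : Kind → Bool
comm load   = true
comm scan   = false
comm copy   = false
comm shift  = true
comm reduce = true
comm init   = false
comm greedy = true

kindℕ : Kind → ℕ
kindℕ load   = 0
kindℕ scan   = 1
kindℕ copy   = 2
kindℕ shift  = 3
kindℕ reduce = 4
kindℕ init   = 5
kindℕ greedy = 6

ℕkind : ℕ → Kind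
ℕkind 0 = load
ℕkind 1 = scan
ℕkind 2 = copy
ℕkind 3 = shift
ℕkind 4 = reduce
ℕkind 5 = init
ℕkind _ = greedy

ℕkind-kindℕ : ∀ κ → ℕkind (kindℕ κ) ≡ κ
ℕkind-kindℕ load   = refl
ℕkind-kindℕ scan   = refl
ℕkind-kindℕ copy   = refl
ℕkind-kindℕ shift  = refl
ℕkind-kindℕ reduce = refl
ℕkind-kindℕ init   = refl
ℕkind-kindℕ greedy = refl

_==_ : Maybe Kind → Kind → Bool
nothing == _  = false
just κ  == κ' = kindℕ κ ≡ᵇ kindℕ κ'

==-refl : ∀ κ → (just κ == κ) ≡ true
==-refl κ = ≡ᵇ-refl (kindℕ κ)

==-sound : ∀ κ κ' → (just κ == κ') ≡ true → κ ≡ κ'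
==-sound κ κ' e = trans (sym (ℕkind-kindℕ κ)) (trans (cong ℕkind (≡ᵇ-true e)) (ℕkind-kindℕ κ'))

-- In forest i the parent of a node is its i-th neighbour.
--   colour i   the node's Cole–Vishkin colour (bit j at index j);
--   mine i, parent i   shift registers holding both colours while they are compared;
--   count      position of the bits under comparison, in binary;
--   found i    a differing position has been recorded;
--   small i    three-bit colour, later a base-3 digit;
--   prev i     the small colour before the last shift;
--   final a    the node has output colour a;
--   ptr a      the a-th init round is due.
data Reg : Set where
  count found final ptr           : ℕ → Reg
  mine parent colour small prev   : ℕ → ℕ → Reg

data Head : Set where
  clk : ℕ → Head
  kin : Kind → Head
  reg : Reg → Head

private
  -- Equality of heads is decided through this coding by triples instead of a case for each pair of
  -- constructors.
  code : Head → ℕ × ℕ × ℕ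
  code (clk t)              = 0 , t , 0
  code (kin κ)              = 1 , kindℕ κ , 0
  code (reg (count b))      = 2 , b , 0
  code (reg (found i))      = 3 , i , 0
  code (reg (final a))      = 4 , a , 0
  code (reg (ptr a))        = 5 , a , 0
  code (reg (mine i j))     = 6 , i , j
  code (reg (parent i j))   = 7 , i , j
  code (reg (colour i j))   = 8 , i , j
  code (reg (small i t))    = 9 , i , t
  code (reg (prev i t))     = 10 , i , t

  decode : ℕ × ℕ × ℕ → Head
  decode (0 , t , _) = clk t
  decode (1 , κ , _) = kin (ℕkind κ)
  decode (2 , b , _) = reg (count b)
  decode (3 , i , _) = reg (found i)
  decode (4 , a , _) = reg (final a)
  decode (5 , a , _) = reg (ptr a)
  decode (6 , i , j) = reg (mine i j)
  decode (7 , i , j) = reg (parent i j)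
  decode (8 , i , j) = reg (colour i j)
  decode (9 , i , t) = reg (small i t)
  decode (_ , i , t) = reg (prev i t)

  decode-code : ∀ h → decode (code h) ≡ h
  decode-code (clk t)              = refl
  decode-code (kin κ)              = cong kin (ℕkind-kindℕ κ)
  decode-code (reg (count b))      = refl
  decode-code (reg (found i))      = refl
  decode-code (reg (final a))      = refl
  decode-code (reg (ptr a))        = refl
  decode-code (reg (mine i j))     = refl
  decode-code (reg (parent i j))   = refl
  decode-code (reg (colour i j))   = refl
  decode-code (reg (small i t))    = refl
  decode-code (reg (prev i t))     = refl

_≟ₕ_ : DecidableEquality Head
h ≟ₕ h' = map′ (λ e → trans (sym (decode-code h)) (trans (cong decode e) (decode-code h')))
               (cong code) (≡-dec _≟_ (≡-dec _≟_ _≟_) (code h) (code h'))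

-- Indexed by whether the instruction communicates: local instructions
-- cannot mention a neighbour, hence compile to diamond-free schemata.
data Atom : Bool → Set where
  own  : ∀ {b} → Reg → Atom b
  nbr  : ℕ → Reg → Atom true
  has  : ℕ → Atom true

num3 : Bool → Bool → Bool → ℕ
num3 a b c = bitℕ a + 2 * bitℕ b + 4 * bitℕ c

-- A root has no colour to inherit. It takes 0 or 1, whichever it does not have, and so stays apart
-- from its children, who now carry its old colour.
shiftColour : Bool → ℕ → ℕ → ℕ
shiftColour hasParent q z = if hasParent then q else (if z ≡ᵇ 0 then 1 else 0)

-- Two colours are forbidden, the parent's and the common one of the children, so one of 0, 1, 2
-- remains.
spare : ℕ → ℕ → ℕ
spare q o = if not (q ≡ᵇ 0) ∧ not (o ≡ᵇ 0) then 0 else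
            (if not (q ≡ᵇ 1) ∧ not (o ≡ᵇ 1) then 1 else 2)

-- Recolouring local maxima, and not one designated colour per pass, lets all five passes share a
-- single instruction.
localMax : ℕ → ℕ → ℕ → Bool
localMax q z o = (2 <ᵇ z) ∧ ((q <ᵇ z) ∧ (o <ᵇ z))

reduceColour : ℕ → ℕ → ℕ → ℕ
reduceColour q z o = if localMax q z o then spare q o else z

ref : ∀ {b} → Reg → Expr (Atom b)
ref d = table (own d ∷ []) Vec.head

record? : Bool → Bool → Bool → Bool → Bool → Bool
record? f a b new old = if not f ∧ (a xor b) then new else old

digit : ∀ {b} → (ℕ → Bool) → ℕ → Expr (Atom b)
digit g i = table (own (small i 0) ∷ own (small i 1) ∷ own (small i 2) ∷ [])
              λ where (a ∷ b ∷ c ∷ []) → g (num3 a b c)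

turnBelow : ∀ {b} → ℕ → Expr (Atom b)
turnBelow m = allₑ m (digit (_≡ᵇ 2))

tick : ∀ {b} → ℕ → ℕ → Expr (Atom b)
tick i t = muxₑ (turnBelow i) (digit (λ x → bit t (bump 2 x)) i) (ref (small i t))

-- B is the width of the counter, W the number of bits of a Cole–Vishkin colour.
module Rules (Δ W B : ℕ) where

  nbrHas : ℕ → Expr (Atom true)
  nbrHas a = anyₑ Δ (λ i → table (nbr i (final a) ∷ []) Vec.head)

  leastFree : ℕ → Expr (Atom true)
  leastFree a = ¬ₑ nbrHas a ∧ₑ allₑ a nbrHas

  rule : (κ : Kind) → Reg → Expr (Atom (comm κ))
  rule load (count b)    = constₑ false
  rule load (found i)    = constₑ false
  rule load (mine i j)   = ref (colour i j)
  rule load (parent i j) = table (nbr i (colour i j) ∷ []) Vec.head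
  rule load (colour i j) = constₑ false
  rule scan (count b)    = muxₑ (allₑ b (ref ∘ count)) (¬ₑ ref (count b)) (ref (count b))
  rule scan (found i)    = table (own (found i) ∷ own (mine i 0) ∷ own (parent i 0) ∷ [])
                             λ where (f ∷ a ∷ b ∷ []) → f ∨ (a xor b)
  -- Both registers move down by one place, so the bits under comparison always stand at index 0 and
  -- no clause has to select a position.
  rule scan (mine i j)   = ref (mine i (suc j))
  rule scan (parent i j) = ref (parent i (suc j))
  rule scan (colour i zero) =
    table (own (found i) ∷ own (mine i 0) ∷ own (parent i 0) ∷ own (colour i 0) ∷ [])
      λ where (f ∷ a ∷ b ∷ y ∷ []) → record? f a b a y
  rule scan (colour i (suc j)) =
    -- Place 0 of the new colour holds the recorded bit; the position occupies the `B` places after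
    -- it.
    if j <ᵇ B
    then table (own (found i) ∷ own (mine i 0) ∷ own (parent i 0) ∷ own (count j) ∷ own (colour i (suc j)) ∷ [])
           (λ where (f ∷ a ∷ b ∷ p ∷ y ∷ []) → record? f a b p y)
    else ref (colour i (suc j))
  rule copy (small i t)   = ref (colour i t)
  rule shift (small i t)  =
    table (has i ∷ nbr i (small i 0) ∷ nbr i (small i 1) ∷ nbr i (small i 2)
           ∷ own (small i 0) ∷ own (small i 1) ∷ own (small i 2) ∷ [])
      λ where (h ∷ q₀ ∷ q₁ ∷ q₂ ∷ z₀ ∷ z₁ ∷ z₂ ∷ []) → bit t (shiftColour h (num3 q₀ q₁ q₂) (num3 z₀ z₁ z₂))
  rule shift (prev i t)   = ref (small i t)
  -- A root reads 0 for the absent parent. This only forbids one more colour, and it cannot prevent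
  -- a colour above 2 from being a local maximum.
  rule reduce (small i t) =
    table (nbr i (small i 0) ∷ nbr i (small i 1) ∷ nbr i (small i 2)
           ∷ own (small i 0) ∷ own (small i 1) ∷ own (small i 2)
           ∷ own (prev i 0) ∷ own (prev i 1) ∷ own (prev i 2) ∷ [])
      λ where (q₀ ∷ q₁ ∷ q₂ ∷ z₀ ∷ z₁ ∷ z₂ ∷ o₀ ∷ o₁ ∷ o₂ ∷ []) →
                bit t (reduceColour (num3 q₀ q₁ q₂) (num3 z₀ z₁ z₂) (num3 o₀ o₁ o₂))
  rule init (small i t)   = tick i t
  -- The one-hot pointer moves on by one place per round, so the class whose turn falls into `init`
  -- round a takes colour a.
  rule init (ptr zero)    = constₑ false
  rule init (ptr (suc a)) = ref (ptr a)
  rule init (final a)     = (ref (ptr a) ∧ₑ turnBelow Δ) ∨ₑ ref (final a)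
  rule greedy (small i t) = tick i t
  rule greedy (final a)   = (leastFree a ∧ₑ turnBelow Δ) ∨ₑ ref (final a)
  rule _ d                = ref d

  InBounds : Reg → Set
  InBounds (count b)      = b < B
  InBounds (found i)      = i < Δ
  InBounds (final a)      = a ≤ Δ
  InBounds (ptr a)        = a ≤ Δ
  InBounds (mine i j)     = i < Δ × j < W
  InBounds (parent i j)   = i < Δ × j < W
  InBounds (colour i j)   = i < Δ × j < W
  InBounds (small i t)    = i < Δ × t < 3
  InBounds (prev i t)     = i < Δ × t < 3

-- The program

module Machine (L Δ' W B : ℕ) (instrs : List Kind) where

  Δ M : ℕ
  Δ = suc Δ'
  M = length instrs

  open Rules Δ W B public

  -- The `final` heads are kept together in increasing order, because the order of the print
  -- predicates is the order of the output string.
  otherGroups groups : List (List Head)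
  otherGroups
         = map clk (upTo (suc M))
         ∷ map kin kinds
         ∷ map (reg ∘ count) (upTo B)
         ∷ map (reg ∘ found) (upTo Δ)
         ∷ map (reg ∘ ptr) (upTo (suc Δ))
         ∷ cartesianProductWith (λ i j → reg (mine i j)) (upTo Δ) (upTo W)
         ∷ cartesianProductWith (λ i j → reg (parent i j)) (upTo Δ) (upTo W)
         ∷ cartesianProductWith (λ i j → reg (colour i j)) (upTo Δ) (upTo W)
         ∷ cartesianProductWith (λ i j → reg (small i j)) (upTo Δ) (upTo 3)
         ∷ cartesianProductWith (λ i j → reg (prev i j)) (upTo Δ) (upTo 3)
         ∷ []
  groups = map (reg ∘ final) (upTo (suc Δ)) ∷ otherGroups

  heads : List Head
  heads = concat groups

  K : ℕ
  K = length heads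

  InRange : Head → Set
  InRange (clk t)              = t ≤ M
  InRange (kin κ)              = ⊤
  InRange (reg d) = InBounds d

  private
    grid∈ : (f : ℕ → ℕ → Head) → ∀ {i j m w} → i < m × j < w →
            f i j ∈ cartesianProductWith f (upTo m) (upTo w)
    grid∈ f (i<m , j<w) = ∈-cartesianProductWith⁺ f (∈-upTo⁺ i<m) (∈-upTo⁺ j<w)

    pick : ∀ {g h} → h ∈ g → g ∈ groups → h ∈ heads
    pick = ∈-concat⁺′

  head∈ : ∀ h → InRange h → h ∈ heads
  head∈ (reg (final a)) r    = pick (∈-map⁺ (reg ∘ final) (∈-upTo⁺ (s≤s r))) (here refl)
  head∈ (clk t) r            = pick (∈-map⁺ clk (∈-upTo⁺ (s≤s r))) (there (here refl))
  head∈ (kin κ) r            = pick (∈-map⁺ kin (kind∈ κ)) (there (there (here refl)))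
  head∈ (reg (count b)) r    = pick (∈-map⁺ (reg ∘ count) (∈-upTo⁺ r)) (there (there (there (here refl))))
  head∈ (reg (found i)) r    = pick (∈-map⁺ (reg ∘ found) (∈-upTo⁺ r)) (there (there (there (there (here refl)))))
  head∈ (reg (ptr a)) r      = pick (∈-map⁺ (reg ∘ ptr) (∈-upTo⁺ (s≤s r))) (there (there (there (there (there (here refl))))))
  head∈ (reg (mine i j)) r   = pick (grid∈ _ r) (there (there (there (there (there (there (here refl)))))))
  head∈ (reg (parent i j)) r = pick (grid∈ _ r) (there (there (there (there (there (there (there (here refl))))))))
  head∈ (reg (colour i j)) r = pick (grid∈ _ r) (there (there (there (there (there (there (there (there (here refl)))))))))
  head∈ (reg (small i t)) r  = pick (grid∈ _ r) (there (there (there (there (there (there (there (there (there (here refl))))))))))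
  head∈ (reg (prev i t)) r   = pick (grid∈ _ r) (there (there (there (there (there (there (there (there (there (there (here refl)))))))))))

  open DecMembership _≟ₕ_ using (_∈?_)

  -- Out-of-range heads are mapped to 0.
  enc : Head → Fin K
  enc h with h ∈? heads
  ... | yes p = index p
  ... | no _  = zero

  lookup-enc-∈ : ∀ {h} → h ∈ heads → lookup heads (enc h) ≡ h
  lookup-enc-∈ {h} r with h ∈? heads
  ... | yes p = sym (lookup-index p)
  ... | no ¬p = contradiction r ¬p

  lookup-enc : ∀ h → InRange h → lookup heads (enc h) ≡ h
  lookup-enc h r = lookup-enc-∈ (head∈ h r)

  -- Out-of-range diamond indices are mapped to 0.
  diaIx : ℕ → Fin Δ
  diaIx i with i <? Δ
  ... | yes i<Δ = fromℕ< i<Δ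
  ... | no _    = zero

  toℕ-diaIx : ∀ {i} → i < Δ → toℕ (diaIx i) ≡ i
  toℕ-diaIx {i} h with i <? Δ
  ... | yes i<Δ = toℕ-fromℕ< i<Δ
  ... | no i≮Δ  = contradiction h i≮Δ

  S : Set
  S = Sch L K Δ

  v : Head → S
  v h = var (enc h)

  atom : ∀ {b} → Atom b → S
  atom (own d)   = v (reg d)
  atom (nbr i d) = dia (diaIx i) (v (reg d))
  atom (has i)   = dia (diaIx i) top

  -- Every forest starts from the identifier bits; the padding places of a colour start as false.
  propOr⊥ : ℕ → S
  propOr⊥ j with j <? L
  ... | yes j<L = prop (fromℕ< j<L)
  ... | no _    = neg top

  termOf : Head → S
  termOf (clk zero)           = top
  termOf (kin κ)              = boolS (nthMaybe instrs 0 == κ)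
  termOf (reg (colour i j))   = propOr⊥ j
  termOf (reg (ptr zero))     = top
  termOf _                    = neg top

  -- The kind heads are decoded from the clock one round ahead.
  kindAt : Kind → ℕ → Expr Head
  kindAt κ t = table (clk t ∷ []) (λ c → Vec.head c ∧ (nthMaybe instrs (suc t) == κ))

  decodeKind : Kind → Expr Head
  decodeKind κ = anyₑ M (kindAt κ)

  ruleS : Kind → Reg → S
  ruleS κ d = compile atom (rule κ d)

  branch : Reg → Kind → S × S
  branch d κ = v (kin κ) , ruleS κ d

  -- The conditions are the one-hot kind heads, so only the branch of the current instruction is
  -- hot, and only its diamonds count as broadcasts. After the last instruction the backup preserves
  -- every register.
  clauseOf : Head → Clause L K Δ
  clauseOf (clk zero)    = std (neg top)
  clauseOf (clk (suc t)) = std (v (clk t))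
  clauseOf (kin κ)       = std (compile v (decodeKind κ))
  clauseOf (reg d)       = cnd (branch d load) (map (branch d) (scan ∷ copy ∷ shift ∷ reduce ∷ init ∷ greedy ∷ [])) (v (reg d))

  -- `clk M` is true in round `M` only, when all `M` instructions have taken effect.
  isLast isFinal : Head → Bool
  isLast (clk t) = t ≡ᵇ M
  isLast _       = false
  isFinal (reg (final a)) = true
  isFinal _               = false

  program : Program L Δ
  program = record
    { k    = K
    ; term = termOf ∘ lookup heads
    ; iter = clauseOf ∘ lookup heads
    ; att  = isLast ∘ lookup heads
    ; prt  = isFinal ∘ lookup heads
    }

  md-atom : ∀ {b} (a : Atom b) → md (atom a) ≤ 1
  md-atom (own _)   = z≤n
  md-atom (nbr _ _) = ≤-refl
  md-atom (has _)   = ≤-refl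

  program-wf : ProgramWF program
  program-wf = (λ i → termWF (lookup heads i)) , (λ i → clauseWF (lookup heads i))
    where
    termWF : ∀ h → hasDia (termOf h) ≡ false × hasVar (termOf h) ≡ false
    termWF (clk zero) = refl , refl
    termWF (clk (suc t)) = refl , refl
    termWF (kin κ) with nthMaybe instrs 0 == κ
    ... | true  = refl , refl
    ... | false = refl , refl
    termWF (reg (count b)) = refl , refl
    termWF (reg (found i)) = refl , refl
    termWF (reg (final a)) = refl , refl
    termWF (reg (ptr zero)) = refl , refl
    termWF (reg (ptr (suc a))) = refl , refl
    termWF (reg (mine i j)) = refl , refl
    termWF (reg (parent i j)) = refl , refl
    termWF (reg (colour i j)) with j <? L
    ... | yes _ = refl , refl
    ... | no _  = refl , refl
    termWF (reg (small i t)) = refl , refl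
    termWF (reg (prev i t)) = refl , refl

    clauseWF : ∀ h → ClauseWF (clauseOf h)
    clauseWF (clk zero)    = z≤n
    clauseWF (clk (suc t)) = z≤n
    clauseWF (kin κ)       = md-compile v (λ _ → z≤n) (decodeKind κ)
    clauseWF (reg d)       = (ok load , ok scan , ok copy , ok shift , ok reduce , ok init , ok greedy , tt) , z≤n
      where
      ok : ∀ κ → md (v (kin κ)) ≡ 0 × md (ruleS κ d) ≤ 1
      ok κ = refl , md-compile atom md-atom (rule κ d)

-- Access, search and filtering in lists

nthMaybe-beyond : {A : Set} (xs : List A) → ∀ {r} → length xs ≤ r → nthMaybe xs r ≡ nothing
nthMaybe-beyond []       h       = refl
nthMaybe-beyond (x ∷ xs) (s≤s h) = nthMaybe-beyond xs h

anyL-false : {A : Set} (p : A → Bool) (xs : List A) → (∀ x → p x ≡ false) → anyL p xs ≡ false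
anyL-false p []       h = refl
anyL-false p (x ∷ xs) h rewrite h x = anyL-false p xs h

anyL-intro : {A : Set} (p : A → Bool) {xs : List A} {x : A} → x ∈ xs → p x ≡ true → anyL p xs ≡ true
anyL-intro p (here refl) h rewrite h = refl
anyL-intro p {y ∷ _} (there i) h rewrite anyL-intro p i h = ∨-zeroʳ (p y)

anyL-elim : {A : Set} (p : A → Bool) (xs : List A) → anyL p xs ≡ true → ∃ λ x → p x ≡ true
anyL-elim p (x ∷ xs) h with p x in e
... | true  = x , e
... | false = anyL-elim p xs h

bfilter-map : {A B : Set} (p : B → Bool) (f : A → B) (xs : List A) →
              bfilter p (map f xs) ≡ map f (bfilter (p ∘ f) xs)
bfilter-map p f []       = refl
bfilter-map p f (x ∷ xs) with p (f x)
... | true  = cong (f x ∷_) (bfilter-map p f xs)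
... | false = bfilter-map p f xs

map-lookup-allFin : {A : Set} (xs : List A) → map (lookup xs) (allFin (length xs)) ≡ xs
map-lookup-allFin xs = trans (map-tabulate id (lookup xs)) (tabulate-lookup xs)

-- Executions

State : ℕ → Set
State n = Reg → Fin n → Bool

peek : {n : ℕ} → Maybe (Fin n) → (Fin n → Bool) → Bool
peek nothing  f = false
peek (just u) f = f u

-- Detaches executions from round numbers: correctness is proved by cutting the instruction list at
-- `_++_` and by loop invariants over `replicate`.
data Steps {S : Set} (Step : Kind → S → S → Set) : List Kind → S → S → Set where
  []  : ∀ {X} → Steps Step [] X X
  _∷_ : ∀ {κ κs X Y Z} → Step κ X Y → Steps Step κs Y Z → Steps Step (κ ∷ κs) X Z

steps-++ : ∀ {S Step} κs {κs' X Z} → Steps {S} Step (κs ++ κs') X Z →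
           ∃ λ Y → Steps Step κs X Y × Steps Step κs' Y Z
steps-++ []       ss       = _ , [] , ss
steps-++ (κ ∷ κs) (s ∷ ss) with steps-++ κs ss
... | Y , ss₁ , ss₂ = Y , s ∷ ss₁ , ss₂

steps-replicate : ∀ {S Step} κ m (I : ℕ → S → Set) →
  (∀ j {X Y} → j < m → Step κ X Y → I j X → I (suc j) Y) →
  ∀ {X Y} → Steps {S} Step (replicate m κ) X Y → I 0 X → I m Y
steps-replicate κ zero    I f []       i = i
steps-replicate κ (suc m) I f (s ∷ ss) i =
  steps-replicate κ m (I ∘ suc) (λ j j<m → f (suc j) (s≤s j<m)) ss (f 0 (s≤s z≤n) s i)

steps-trace : ∀ {S Step} κs (X : ℕ → S) →
  (∀ r κ → nthMaybe κs r ≡ just κ → Step κ (X r) (X (suc r))) → Steps {S} Step κs (X 0) (X (length κs))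
steps-trace []       X f = []
steps-trace (κ ∷ κs) X f = f 0 κ refl ∷ steps-trace κs (X ∘ suc) (λ r → f (suc r))

tally : Kind → ℕ
tally κ = if comm κ then 1 else 0

commCount : List Kind → ℕ
commCount []       = 0
commCount (κ ∷ κs) = tally κ + commCount κs

commCount-++ : ∀ κs κs' → commCount (κs ++ κs') ≡ commCount κs + commCount κs'
commCount-++ []       κs' = refl
commCount-++ (κ ∷ κs) κs' = trans (cong (tally κ +_) (commCount-++ κs κs')) (sym (+-assoc (tally κ) _ _))

commCount-replicate : ∀ m κ → commCount (replicate m κ) ≡ m * tally κ
commCount-replicate zero    κ = refl
commCount-replicate (suc m) κ = cong (tally κ +_) (commCount-replicate m κ)

module Dynamics {n : ℕ} (Δ W B : ℕ) (parentOf : Fin n → ℕ → Maybe (Fin n)) where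

  open Rules Δ W B

  env : ∀ {b} → State n → Fin n → Atom b → Bool
  env X w (own d)   = X d w
  env X w (nbr i d) = peek (parentOf w i) (X d)
  env X w (has i)   = peek (parentOf w i) (λ _ → true)

  -- Only registers in bounds are constrained. The others have no head of their own, and reading one
  -- of them may return the value of an unrelated head.
  Step : Kind → State n → State n → Set
  Step κ X Y = ∀ d → InBounds d → ∀ w → Y d w ≡ ⟦ rule κ d ⟧ (env X w)

module Exec {n Δ' W B : ℕ} (instrs : List Kind) (G : Graph n (suc Δ')) where

  open Machine (lg n) Δ' W B instrs
  open Run G program
  open Sem G {K}

  instr : ℕ → Maybe Kind
  instr = nthMaybe instrs

  parentOf : Fin n → ℕ → Maybe (Fin n)
  parentOf w i = nthNbr G w (diaIx i)

  headVal : ℕ → Head → Fin n → Bool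
  headVal r h w = conf r (enc h) w

  state : ℕ → State n
  state r d = headVal r (reg d)

  open Dynamics Δ W B parentOf

  -- A clause depends only on the head listed at its index, so equal entries have equal histories.
  -- This takes the place of a proof that `heads` has no repetitions.
  conf-cong : ∀ r {i j} w → lookup heads i ≡ lookup heads j → conf r i w ≡ conf r j w
  conf-cong zero    w e = cong (λ h → eval (λ _ _ → false) (termOf h) w) e
  conf-cong (suc r) w e = cong (λ h → eval (conf r) (body (conf r) (clauseOf h) w) w) e

  headVal-lookup : ∀ r i {h} w → InRange h → lookup heads i ≡ h → conf r i w ≡ headVal r h w
  headVal-lookup r i {h} w inr e = conf-cong r w (trans e (sym (lookup-enc h inr)))

  headVal-zero : ∀ h w → InRange h → headVal 0 h w ≡ eval (λ _ _ → false) (termOf h) w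
  headVal-zero h w inr = cong (λ g → eval (λ _ _ → false) (termOf g) w) (lookup-enc h inr)

  headVal-suc : ∀ r h w → InRange h → headVal (suc r) h w ≡ eval (conf r) (body (conf r) (clauseOf h) w) w
  headVal-suc r h w inr = cong (λ g → eval (conf r) (body (conf r) (clauseOf g) w) w) (lookup-enc h inr)

  clk-val : ∀ r t w → t ≤ M → headVal r (clk t) w ≡ (r ≡ᵇ t)
  clk-val zero    zero    w h = headVal-zero (clk 0) w h
  clk-val zero    (suc t) w h = headVal-zero (clk (suc t)) w h
  clk-val (suc r) zero    w h = headVal-suc r (clk 0) w h
  clk-val (suc r) (suc t) w h = trans (headVal-suc r (clk (suc t)) w h) (clk-val r t w (≤-trans (n≤1+n t) h))

  eval-boolS : ∀ X b w → eval X (boolS b) w ≡ b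
  eval-boolS X true  w = refl
  eval-boolS X false w = refl

  kin-val : ∀ r κ w → headVal r (kin κ) w ≡ (instr r == κ)
  kin-val zero    κ w = trans (headVal-zero (kin κ) w tt) (eval-boolS _ (instr 0 == κ) w)
  kin-val (suc r) κ w = begin
    headVal (suc r) (kin κ) w                       ≡⟨ headVal-suc r (kin κ) w tt ⟩
    eval (conf r) (compile v (decodeKind κ)) w   ≡⟨ eval-compile G v (conf r) w (decodeKind κ) ⟩
    ⟦ decodeKind κ ⟧ ρ                           ≡⟨ ⟦anyₑ⟧ M (kindAt κ) ρ ⟩
    anyBelow M (λ t → ⟦ kindAt κ t ⟧ ρ)                 ≡⟨ decoded ⟩
    (instr (suc r) == κ)                         ∎
    where
    open ≡-Reasoning
    ρ : Head → Bool
    ρ h = eval (conf r) (v h) w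
    at : ∀ t → t < M → ⟦ kindAt κ t ⟧ ρ ≡ (r ≡ᵇ t) ∧ (instr (suc t) == κ)
    at t t<M = cong (_∧ (instr (suc t) == κ)) (clk-val r t w (<⇒≤ t<M))
    decoded : anyBelow M (λ t → ⟦ kindAt κ t ⟧ ρ) ≡ (instr (suc r) == κ)
    decoded with instr (suc r) == κ in e
    ... | true  = anyBelow-intro M _ r r<M (trans (at r r<M) (cong₂ _∧_ (≡ᵇ-refl r) e))
      where
      r<M : r < M
      r<M = ≰⇒> λ M≤r → contradiction
              (trans (sym (cong (_== κ) (nthMaybe-beyond instrs (≤-trans M≤r (n≤1+n r))))) e) λ ()
    ... | false = anyBelow-false M _ λ t t<M → trans (at t t<M) (off t)
      where
      off : ∀ t → (r ≡ᵇ t) ∧ (instr (suc t) == κ) ≡ false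
      off t with r ≡ᵇ t in r≡t
      ... | false = refl
      ... | true  = trans (cong (λ t → instr (suc t) == κ) (sym (≡ᵇ-true r≡t))) e

  -- The conditions before κ test other kinds and fail. Should a test succeed, its kind equals κ and
  -- the branch is the same.
  hot : ∀ r d w κ → instr r ≡ just κ → body (conf r) (clauseOf (reg d)) w ≡ ruleS κ d
  hot r d w κ e = go kinds (kind∈ κ)
    where
    go : ∀ κs {χ} → κ ∈ κs → hotIn (conf r) (map (branch d) κs) χ w ≡ ruleS κ d
    go (κ' ∷ κs) (here refl) rewrite kin-val r κ w | e | ==-refl κ = refl
    go (κ' ∷ κs) (there p) rewrite kin-val r κ' w | e with just κ == κ' in e'
    ... | true  = cong (λ κ → ruleS κ d) (sym (==-sound κ κ' e'))
    ... | false = go κs p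

  idle : ∀ r d w → instr r ≡ nothing → body (conf r) (clauseOf (reg d)) w ≡ v (reg d)
  idle r d w e
    rewrite kin-val r load w | kin-val r scan w | kin-val r copy w | kin-val r shift w
          | kin-val r reduce w | kin-val r init w | kin-val r greedy w | e = refl

  eval-atom : ∀ r w {b} (a : Atom b) → eval (conf r) (atom a) w ≡ env (state r) w a
  eval-atom r w (own d) = refl
  eval-atom r w (nbr i d) with parentOf w i
  ... | nothing = refl
  ... | just u  = refl
  eval-atom r w (has i) with parentOf w i
  ... | nothing = refl
  ... | just u  = refl

  ⟦⟧-cong : {A : Set} {ρ ρ' : A → Bool} → (∀ a → ρ a ≡ ρ' a) → ∀ e → ⟦ e ⟧ ρ ≡ ⟦ e ⟧ ρ'
  ⟦⟧-cong h (table as f) = cong f (Vec.map-cong h as)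
  ⟦⟧-cong h (¬ₑ e)       = cong not (⟦⟧-cong h e)
  ⟦⟧-cong h (e ∧ₑ e')    = cong₂ _∧_ (⟦⟧-cong h e) (⟦⟧-cong h e')

  steps : Steps Step instrs (state 0) (state M)
  steps = steps-trace instrs state λ r κ e d inr w → begin
    state (suc r) d w                                              ≡⟨ headVal-suc r (reg d) w inr ⟩
    eval (conf r) (body (conf r) (clauseOf (reg d)) w) w           ≡⟨ cong (λ s → eval (conf r) s w) (hot r d w κ e) ⟩
    eval (conf r) (ruleS κ d) w                                    ≡⟨ eval-compile G atom (conf r) w (rule κ d) ⟩
    ⟦ rule κ d ⟧ (λ a → eval (conf r) (atom a) w)                  ≡⟨ ⟦⟧-cong (eval-atom r w) (rule κ d) ⟩
    ⟦ rule κ d ⟧ (env (state r) w)                                 ∎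
    where open ≡-Reasoning

  lastHead : ∀ r i w → (att program i ∧ conf r i w) ≡ true → r ≡ M
  lastHead r i w h with lookup heads i in e
  ... | clk t with t ≡ᵇ M in t≡M
  ...   | true = trans (≡ᵇ-true (trans (sym (trans (headVal-lookup r i w t≤M e) (clk-val r t w t≤M))) h)) (≡ᵇ-true t≡M)
    where
    t≤M : t ≤ M
    t≤M = ≤-reflexive (≡ᵇ-true t≡M)

  attentive⇒last : ∀ r w → attentive r w ≡ true → r ≡ M
  attentive⇒last r w h with anyL-elim _ (allFin K) h
  ... | i , e = lastHead r i w e

  outputsAt-last : ∀ w → OutputsAt M w
  outputsAt-last w = anyL-intro (λ i → att program i ∧ conf M i w) (∈-allFin (enc (clk M))) lit , early
    where
    lit : (att program (enc (clk M)) ∧ conf M (enc (clk M)) w) ≡ true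
    lit rewrite lookup-enc (clk M) ≤-refl | ≡ᵇ-refl M | clk-val M M w ≤-refl = ≡ᵇ-refl M
    early : ∀ r → r < M → attentive r w ≡ false
    early r r<M with attentive r w in e
    ... | true  = contradiction (attentive⇒last r w e) (<⇒≢ r<M)
    ... | false = refl

  heads-final : bfilter isFinal heads ≡ map (reg ∘ final) (upTo (suc Δ))
  heads-final = keep (upTo (suc Δ)) (none otherGroups
    ( row clk (λ _ → refl) (upTo (suc M))
    ∷ row kin (λ _ → refl) kinds
    ∷ row (reg ∘ count) (λ _ → refl) (upTo B)
    ∷ row (reg ∘ found) (λ _ → refl) (upTo Δ)
    ∷ row (reg ∘ ptr) (λ _ → refl) (upTo (suc Δ))
    ∷ grid (λ i j → reg (mine i j)) (λ _ _ → refl) (upTo Δ) (upTo W)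
    ∷ grid (λ i j → reg (parent i j)) (λ _ _ → refl) (upTo Δ) (upTo W)
    ∷ grid (λ i j → reg (colour i j)) (λ _ _ → refl) (upTo Δ) (upTo W)
    ∷ grid (λ i j → reg (small i j)) (λ _ _ → refl) (upTo Δ) (upTo 3)
    ∷ grid (λ i j → reg (prev i j)) (λ _ _ → refl) (upTo Δ) (upTo 3)
    ∷ []))
    where
    keep : ∀ as {hs} → bfilter isFinal hs ≡ [] → bfilter isFinal (map (reg ∘ final) as ++ hs) ≡ map (reg ∘ final) as
    keep []       h = h
    keep (a ∷ as) h = cong (_ ∷_) (keep as h)
    drops : ∀ hs {hs'} → bfilter isFinal hs ≡ [] → bfilter isFinal hs' ≡ [] → bfilter isFinal (hs ++ hs') ≡ []
    drops []       h h' = h'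
    drops (g ∷ hs) h h' with isFinal g
    ... | false = drops hs h h'
    none : ∀ gs → All (λ g → bfilter isFinal g ≡ []) gs → bfilter isFinal (concat gs) ≡ []
    none []       []       = refl
    none (g ∷ gs) (h ∷ hs) = drops g h (none gs hs)
    row : {A : Set} (f : A → Head) → (∀ a → isFinal (f a) ≡ false) → ∀ as → bfilter isFinal (map f as) ≡ []
    row f h []       = refl
    row f h (a ∷ as) rewrite h a = row f h as
    grid : (f : ℕ → ℕ → Head) → (∀ i j → isFinal (f i j) ≡ false) → ∀ is js →
           bfilter isFinal (cartesianProductWith f is js) ≡ []
    grid f h []       js = refl
    grid f h (i ∷ is) js = drops (map (f i) js) (row (f i) (h i) js) (grid f h is js)

  output-final : ∀ r w → output r w ≡ map (λ a → state r (final a) w) (upTo (suc Δ))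
  output-final r w = begin
    map (λ i → conf r i w) (bfilter (isFinal ∘ lookup heads) (allFin K))
      ≡⟨ finals (bfilter (isFinal ∘ lookup heads) (allFin K)) ⟩
    map (λ h → headVal r h w) (map (lookup heads) (bfilter (isFinal ∘ lookup heads) (allFin K)))
      ≡⟨ cong (map (λ h → headVal r h w)) (bfilter-map isFinal (lookup heads) (allFin K)) ⟨
    map (λ h → headVal r h w) (bfilter isFinal (map (lookup heads) (allFin K)))
      ≡⟨ cong (λ hs → map (λ h → headVal r h w) (bfilter isFinal hs)) (map-lookup-allFin heads) ⟩
    map (λ h → headVal r h w) (bfilter isFinal heads)
      ≡⟨ cong (map (λ h → headVal r h w)) heads-final ⟩
    map (λ h → headVal r h w) (map (reg ∘ final) (upTo (suc Δ)))
      ≡⟨ map-∘ (upTo (suc Δ)) ⟨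
    map (λ a → state r (final a) w) (upTo (suc Δ)) ∎
    where
    open ≡-Reasoning
    listed : ∀ i → conf r i w ≡ headVal r (lookup heads i) w
    listed i = conf-cong r w (sym (lookup-enc-∈ (∈-lookup i)))
    finals : ∀ is → map (λ i → conf r i w) is ≡ map (λ h → headVal r h w) (map (lookup heads) is)
    finals is = trans (map-cong listed is) (map-∘ is)

  broadcast-local : ∀ r κ → instr r ≡ just κ → comm κ ≡ false → gcr (suc r) ≡ false
  broadcast-local r κ e loc = anyL-false _ (allFin n) λ w → anyL-false _ (allFin K) λ i → quiet w (lookup heads i)
    where
    atoms : ∀ {b} → b ≡ false → (a : Atom b) → hasDia (atom a) ≡ false
    atoms refl (own d) = refl
    quiet : ∀ w h → broadcasts (conf r) (clauseOf h) w ≡ false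
    quiet w (clk zero)    = refl
    quiet w (clk (suc t)) = refl
    quiet w (kin κ')      = hasDia-compile v (λ _ → refl) (decodeKind κ')
    quiet w (reg d)       = trans (cong hasDia (hot r d w κ e)) (hasDia-compile atom (atoms loc) (rule κ d))

  broadcast-none : ∀ r → instr r ≡ nothing → gcr (suc r) ≡ false
  broadcast-none r e = anyL-false _ (allFin n) λ w → anyL-false _ (allFin K) λ i → quiet w (lookup heads i)
    where
    quiet : ∀ w h → broadcasts (conf r) (clauseOf h) w ≡ false
    quiet w (clk zero)    = refl
    quiet w (clk (suc t)) = refl
    quiet w (kin κ')      = hasDia-compile v (λ _ → refl) (decodeKind κ')
    quiet w (reg d)       = cong hasDia (idle r d w e)

  -- Broadcasting is a syntactic matter: one register whose rule contains a diamond makes the round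
  -- count, even in a graph without edges.
  speaker : 0 < W → ∀ κ → comm κ ≡ true → ∃ λ d → InRange (reg d) × hasDia (ruleS κ d) ≡ true
  speaker 0<W load   _ = parent 0 0 , (s≤s z≤n , 0<W) , refl
  speaker 0<W shift  _ = small 0 0 , (s≤s z≤n , s≤s z≤n) , refl
  speaker 0<W reduce _ = small 0 0 , (s≤s z≤n , s≤s z≤n) , refl
  speaker 0<W greedy _ = final 0 , z≤n , refl

  broadcast-comm : Fin n → 0 < W → ∀ r κ → instr r ≡ just κ → comm κ ≡ true → gcr (suc r) ≡ true
  broadcast-comm w 0<W r κ e c = spoken (speaker 0<W κ c)
    where
    spoken : (∃ λ d → InRange (reg d) × hasDia (ruleS κ d) ≡ true) → gcr (suc r) ≡ true
    spoken (d , inr , h) = anyL-intro (λ w → anyFin K (λ i → broadcasts (conf r) (clauseOf (lookup heads i)) w)) (∈-allFin w)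
      (anyL-intro (λ i → broadcasts (conf r) (clauseOf (lookup heads i)) w) (∈-allFin (enc (reg d)))
        (trans (cong (λ g → broadcasts (conf r) (clauseOf g) w) (lookup-enc (reg d) inr))
               (trans (cong hasDia (hot r d w κ e)) h)))

  gcr-instr : Fin n → 0 < W → ∀ r κ → instr r ≡ just κ → gcr (suc r) ≡ comm κ
  gcr-instr w 0<W r κ e = by (comm κ) refl
    where
    by : ∀ b → comm κ ≡ b → gcr (suc r) ≡ b
    by true  c = broadcast-comm w 0<W r κ e c
    by false c = broadcast-local r κ e c

  gcr-after : ∀ r → M < r → gcr r ≡ false
  gcr-after (suc r) (s≤s M≤r) = broadcast-none r (nthMaybe-beyond instrs M≤r)

  gcrCount-instrs : Fin n → 0 < W → gcrCount M ≡ commCount instrs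
  gcrCount-instrs w 0<W = trans (as-sum M) (counted instrs (gcr ∘ suc) (gcr-instr w 0<W))
    where
    -- `gcrCount` peels off the last round, the instruction list its first; `total-suc` reverses the
    -- direction of the sum.
    total : (ℕ → Bool) → ℕ → ℕ
    total f zero    = 0
    total f (suc m) = (if f m then 1 else 0) + total f m
    as-sum : ∀ m → gcrCount m ≡ total (gcr ∘ suc) m
    as-sum zero    = refl
    as-sum (suc m) = cong (_ +_) (as-sum m)
    total-suc : ∀ f m → total f (suc m) ≡ (if f 0 then 1 else 0) + total (f ∘ suc) m
    total-suc f zero    = refl
    total-suc f (suc m) = begin
      x + total f (suc m)               ≡⟨ cong (x +_) (total-suc f m) ⟩
      x + (y + total (f ∘ suc) m)       ≡⟨ +-assoc x y _ ⟨
      x + y + total (f ∘ suc) m         ≡⟨ cong (_+ total (f ∘ suc) m) (+-comm x y) ⟩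
      y + x + total (f ∘ suc) m         ≡⟨ +-assoc y x _ ⟩
      y + (x + total (f ∘ suc) m)       ∎
      where
      open ≡-Reasoning
      x = if f (suc m) then 1 else 0
      y = if f 0 then 1 else 0
    counted : ∀ κs f → (∀ r κ → nthMaybe κs r ≡ just κ → f r ≡ comm κ) → total f (length κs) ≡ commCount κs
    counted []       f h = refl
    counted (κ ∷ κs) f h = trans (total-suc f (length κs))
      (cong₂ _+_ (cong (λ b → if b then 1 else 0) (h 0 κ refl)) (counted κs (f ∘ suc) (λ r → h (suc r))))

-- Cole–Vishkin colour reduction

coleVishkin : ℕ → ℕ → List Kind
coleVishkin zero    w = []
coleVishkin (suc m) w = (load ∷ replicate w scan) ++ coleVishkin m (nextWidth w)

xor-≢ : ∀ {a b} → a ≢ b → a xor b ≡ true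
xor-≢ {true}  {true}  h = contradiction refl h
xor-≢ {true}  {false} h = refl
xor-≢ {false} {true}  h = refl
xor-≢ {false} {false} h = contradiction refl h

module ColeVishkin {n : ℕ} (Δ W B : ℕ) (parentOf : Fin n → ℕ → Maybe (Fin n))
                   (W≤2^B : W ≤ 2 ^ B) (B<W : B < W) where

  open Rules Δ W B
  open Dynamics Δ W B parentOf

  -- The colours of a node and of its parent may differ anywhere below `W`, but since all bits from
  -- w on vanish, the difference lies among the w places that a scan visits.
  Coloured : ℕ → State n → Set
  Coloured w X = ∀ i → i < Δ → ∀ v →
      (∀ j → w ≤ j → j < W → X (colour i j) v ≡ false)
    × (∀ u → parentOf v i ≡ just u → ∃ λ j → j < W × X (colour i j) v ≢ X (colour i j) u)

  module Phase {w : ℕ} {X : State n} (w≤W : w ≤ W) (coloured : Coloured w X) where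

    Y Q : ℕ → Fin n → ℕ → Bool
    Y i v t = X (colour i t) v
    Q i v t = peek (parentOf v i) (X (colour i t))

    -- A recorded colour carries the bit at place 0 and the position p above it. Equal new colours
    -- would force the same p and the same bit at p.
    Pending Recorded : ℕ → State n → ℕ → Fin n → Set
    Pending j Z i v = Z (found i) v ≡ false
      × (∀ t → t < j → Y i v t ≡ Q i v t)
      × (∀ t → t < W → Z (colour i t) v ≡ false)
    Recorded j Z i v = Z (found i) v ≡ true
      × ∃ λ p → p < j × Y i v p ≢ Q i v p × Z (colour i 0) v ≡ Y i v p
        × (∀ b → suc b < W → Z (colour i (suc b)) v ≡ bit b p)

    Scanned : ℕ → State n → Set
    Scanned j Z =
        -- While the registers move down, values from outside the bounds enter at the top; the
        -- restriction j + t < `W` keeps the invariant away from them.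
        (∀ i → i < Δ → ∀ v t → j + t < W →
           Z (mine i t) v ≡ Y i v (j + t) × Z (parent i t) v ≡ Q i v (j + t))
      × (∀ b → b < B → ∀ v → Z (count b) v ≡ bit b j)
      × (∀ i → i < Δ → ∀ v → Pending j Z i v ⊎ Recorded j Z i v)

    loaded : ∀ {Z} → Step load X Z → Scanned 0 Z
    loaded s = (λ i i<Δ v t t<W → s (mine i t) (i<Δ , t<W) v , s (parent i t) (i<Δ , t<W) v)
             , (λ b b<B v → s (count b) b<B v)
             , (λ i i<Δ v → inj₁ (s (found i) i<Δ v , (λ t ()) , λ t t<W → s (colour i t) (i<Δ , t<W) v))

    module _ {j : ℕ} {Z Z' : State n} (j<w : j < w) (s : Step scan Z Z') (inv : Scanned j Z) where

      j<W : j < W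
      j<W = ≤-trans j<w w≤W

      module _ (i : ℕ) (i<Δ : i < Δ) (v : Fin n) where

        mine₀ : Z (mine i 0) v ≡ Y i v j
        mine₀ = subst (λ t → Z (mine i 0) v ≡ Y i v t) (+-identityʳ j)
                  (proj₁ (proj₁ inv i i<Δ v 0 (subst (_< W) (sym (+-identityʳ j)) j<W)))

        parent₀ : Z (parent i 0) v ≡ Q i v j
        parent₀ = subst (λ t → Z (parent i 0) v ≡ Q i v t) (+-identityʳ j)
                  (proj₂ (proj₁ inv i i<Δ v 0 (subst (_< W) (sym (+-identityʳ j)) j<W)))

        found' : Z' (found i) v ≡ Z (found i) v ∨ (Y i v j xor Q i v j)
        found' = trans (s (found i) i<Δ v) (cong₂ (λ a b → Z (found i) v ∨ (a xor b)) mine₀ parent₀)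

        colour₀' : Z' (colour i 0) v ≡ record? (Z (found i) v) (Y i v j) (Q i v j) (Y i v j) (Z (colour i 0) v)
        colour₀' = trans (s (colour i 0) (i<Δ , ≤-trans (s≤s z≤n) j<W) v)
                         (cong₂ (λ a b → record? (Z (found i) v) a b a (Z (colour i 0) v)) mine₀ parent₀)

        colourₛ' : ∀ b → suc b < W → Z' (colour i (suc b)) v ≡
          record? (Z (found i) v) (Y i v j) (Q i v j)
            (if b <ᵇ B then bit b j else Z (colour i (suc b)) v) (Z (colour i (suc b)) v)
        colourₛ' b b<W = trans (s (colour i (suc b)) (i<Δ , b<W) v) eq
          where
          idem : ∀ f x y z → z ≡ record? f x y z z
          idem f x y z with not f ∧ (x xor y)
          ... | true  = refl
          ... | false = refl
          eq : ⟦ rule scan (colour i (suc b)) ⟧ (env Z v) ≡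
               record? (Z (found i) v) (Y i v j) (Q i v j)
                 (if b <ᵇ B then bit b j else Z (colour i (suc b)) v) (Z (colour i (suc b)) v)
          eq with b <ᵇ B in b<B
          ... | false = idem (Z (found i) v) (Y i v j) (Q i v j) (Z (colour i (suc b)) v)
          ... | true  rewrite mine₀ | parent₀ | proj₁ (proj₂ inv) b (<ᵇ-true b<B) v = refl

        status : Pending j Z i v ⊎ Recorded j Z i v → Pending (suc j) Z' i v ⊎ Recorded (suc j) Z' i v
        status (inj₂ (f , p , p<j , ne , c₀ , cₛ)) = inj₂
          ( trans found' (cong (_∨ _) f)
          , p , m<n⇒m<1+n p<j , ne
          , trans colour₀' (trans (kept f) c₀)
          , λ b b<W → trans (colourₛ' b b<W) (trans (kept f) (cₛ b b<W)) )
          where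
          kept : ∀ {f new old} → f ≡ true → record? f (Y i v j) (Q i v j) new old ≡ old
          kept refl = refl
        status (inj₁ (f , eqs , zs)) with Y i v j Bool.≟ Q i v j
        ... | yes e = inj₁
          ( trans found' (cong₂ _∨_ f same)
          , (λ t t<1+j → agree t (m<1+n⇒m<n∨m≡n t<1+j))
          , λ { zero    t<W → trans colour₀' (trans (keep f) (zs 0 t<W))
              ; (suc b) t<W → trans (colourₛ' b t<W) (trans (keep f) (zs (suc b) t<W)) } )
          where
          same : Y i v j xor Q i v j ≡ false
          same = trans (cong (_xor Q i v j) e) (xor-same (Q i v j))
          keep : ∀ {f new old} → f ≡ false → record? f (Y i v j) (Q i v j) new old ≡ old
          keep refl rewrite same = refl
          agree : ∀ t → t < j ⊎ t ≡ j → Y i v t ≡ Q i v t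
          agree t (inj₁ t<j)  = eqs t t<j
          agree t (inj₂ refl) = e
        ... | no ne = inj₂
          ( trans found' (cong₂ _∨_ f (xor-≢ ne))
          , j , ≤-refl , ne
          , trans colour₀' (new f)
          , λ b b<W → trans (colourₛ' b b<W) (trans (new f) (position b b<W)) )
          where
          new : ∀ {f x old} → f ≡ false → record? f (Y i v j) (Q i v j) x old ≡ x
          new refl rewrite xor-≢ ne = refl
          position : ∀ b → suc b < W → (if b <ᵇ B then bit b j else Z (colour i (suc b)) v) ≡ bit b j
          position b b<W with b <ᵇ B in b<B
          ... | true  = refl
          -- A place beyond the counter is still false from `load`, and so is bit b of j, because j
          -- < `W` ≤ 2^`B` ≤ 2^b.
          ... | false = trans (zs (suc b) b<W) (sym (bit-high b j (begin-strict
                  j      <⟨ j<W ⟩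
                  W      ≤⟨ W≤2^B ⟩
                  2 ^ B  ≤⟨ ^-monoʳ-≤ 2 (≮⇒≥ {b} {B} λ b<B' → contradiction (trans (sym (<⇒<ᵇ-true b<B')) b<B) λ ()) ⟩
                  2 ^ b  ∎)))
            where open ≤-Reasoning

      scanned : Scanned (suc j) Z'
      scanned = registers , counter , λ i i<Δ v → status i i<Δ v (proj₂ (proj₂ inv) i i<Δ v)
        where
        registers : ∀ i → i < Δ → ∀ v t → suc j + t < W →
                    Z' (mine i t) v ≡ Y i v (suc j + t) × Z' (parent i t) v ≡ Q i v (suc j + t)
        registers i i<Δ v t h rewrite sym (+-suc j t) =
            trans (s (mine i t) (i<Δ , t<W) v) (proj₁ (proj₁ inv i i<Δ v (suc t) h))
          , trans (s (parent i t) (i<Δ , t<W) v) (proj₂ (proj₁ inv i i<Δ v (suc t) h))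
          where
          t<W : t < W
          t<W = ≤-trans (m≤n+m (suc t) j) (<⇒≤ h)
        counter : ∀ b → b < B → ∀ v → Z' (count b) v ≡ bit b (suc j)
        counter b b<B v = begin
          Z' (count b) v                                             ≡⟨ s (count b) b<B v ⟩
          ⟦ rule scan (count b) ⟧ ρ                                  ≡⟨ ⟦muxₑ⟧ (allₑ b (ref ∘ count)) (¬ₑ ref (count b)) (ref (count b)) ρ ⟩
          (if ⟦ allₑ b (ref ∘ count) ⟧ ρ then not (Z (count b) v) else Z (count b) v)
            ≡⟨ cong₂ (λ a x → if a then not x else x)
                 (trans (⟦allₑ⟧ b (ref ∘ count) ρ) (allBelow-cong b λ a a<b → proj₁ (proj₂ inv) a (<-trans a<b b<B) v))
                 (proj₁ (proj₂ inv) b b<B v) ⟩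
          bit b (suc j)                                              ∎
          where
          open ≡-Reasoning
          ρ : Atom false → Bool
          ρ = env Z v

    -- A node with a parent always records. If its parent records another position, the two
    -- positions differ in one of `B` bits; if the same position, the recorded bits differ by the
    -- choice of that position.
    recoloured : ∀ {Z} → Scanned w Z → Coloured (nextWidth w) Z
    recoloured {Z} (_ , _ , status) i i<Δ v = narrow , proper
      where
      0<W : 0 < W
      0<W = ≤-trans (s≤s z≤n) B<W

      narrow : ∀ j → nextWidth w ≤ j → j < W → Z (colour i j) v ≡ false
      narrow (suc b) (s≤s l≤b) j<W with status i i<Δ v
      ... | inj₁ (_ , _ , zs) = zs (suc b) j<W
      ... | inj₂ (_ , p , p<w , _ , _ , cₛ) = trans (cₛ b j<W) (bit-high b p
              (≤-trans p<w (≤-trans (w≤2^lg w) (^-monoʳ-≤ 2 l≤b))))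

      differ : ∀ x y → parentOf x i ≡ just y → ∃ λ t → t < w × Y i x t ≢ Q i x t
      differ x y e with proj₂ (coloured i i<Δ x) y e
      ... | t , t<W , ne with t <? w
      ...   | yes t<w = t , t<w , λ eq → ne (trans eq (cong (λ m → peek m (X (colour i t))) e))
      ...   | no t≮w  = contradiction
                          (trans (proj₁ (coloured i i<Δ x) t (≮⇒≥ t≮w) t<W)
                                 (sym (proj₁ (coloured i i<Δ y) t (≮⇒≥ t≮w) t<W))) ne

      proper : ∀ u → parentOf v i ≡ just u → ∃ λ j → j < W × Z (colour i j) v ≢ Z (colour i j) u
      proper u e with status i i<Δ v | status i i<Δ u
      ... | inj₁ (_ , eqs , _) | _ with differ v u e
      ...   | t , t<w , ne = contradiction (eqs t t<w) ne
      proper u e | inj₂ (_ , p , p<w , ne , c₀ , cₛ) | inj₂ (_ , p' , p'<w , _ , c₀' , cₛ') with p ≟ p'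
      ... | yes refl = 0 , 0<W , λ eq → ne (trans (sym c₀) (trans eq (trans c₀' (sym (cong (λ m → peek m (X (colour i p))) e)))))
      ... | no p≢p' with bit-separates B (≤-trans p<w (≤-trans w≤W W≤2^B)) (≤-trans p'<w (≤-trans w≤W W≤2^B)) p≢p'
      ...   | b , b<B , nb = suc b , ≤-trans (s≤s b<B) B<W , λ eq →
                nb (trans (sym (cₛ b (≤-trans (s≤s b<B) B<W))) (trans eq (cₛ' b (≤-trans (s≤s b<B) B<W))))
      proper u e | inj₂ (_ , p , p<w , ne , c₀ , cₛ) | inj₁ (_ , eqs , zs) with parentOf u i in e'
      ... | just x with differ u x e'
      ...   | t , t<w , ne' = contradiction (trans (eqs t t<w) (sym (cong (λ m → peek m (X (colour i t))) e'))) ne'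
      -- The root u compares itself with the zero colour; having found no
      -- difference it has colour 0, so the bit recorded by its child is 1.
      proper u e | inj₂ (_ , p , p<w , ne , c₀ , cₛ) | inj₁ (_ , eqs , zs) | nothing =
        0 , 0<W , λ eq → ne (trans (sym c₀) (trans eq (trans (zs 0 0<W)
          (sym (trans (cong (λ m → peek m (X (colour i p))) e) (eqs p p<w))))))

    phase : ∀ {Z} → Steps Step (load ∷ replicate w scan) X Z → Coloured (nextWidth w) Z
    phase {Z} (s ∷ ss) = recoloured {Z} (steps-replicate scan w Scanned (λ j j<w t → scanned j<w t) ss (loaded s))

  coleVishkin-correct : ∀ m {w X Z} → w ≤ W → 2 ≤ W → Coloured w X → Steps Step (coleVishkin m w) X Z →
                        Coloured (width m w) Z
  coleVishkin-correct zero    w≤W 2≤W c [] = c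
  coleVishkin-correct (suc m) {w} w≤W 2≤W c ss with steps-++ (load ∷ replicate w scan) ss
  ... | _ , ss₁ , ss₂ = coleVishkin-correct m (nextWidth-≤ 2≤W w≤W) 2≤W (Phase.phase w≤W c ss₁) ss₂

-- From eight to three colours

num3-bit : ∀ x → x < 8 → num3 (bit 0 x) (bit 1 x) (bit 2 x) ≡ x
num3-bit 0 _ = refl
num3-bit 1 _ = refl
num3-bit 2 _ = refl
num3-bit 3 _ = refl
num3-bit 4 _ = refl
num3-bit 5 _ = refl
num3-bit 6 _ = refl
num3-bit 7 _ = refl
num3-bit (suc (suc (suc (suc (suc (suc (suc (suc _))))))))
  (s≤s (s≤s (s≤s (s≤s (s≤s (s≤s (s≤s (s≤s ()))))))))

num3-<8 : ∀ a b c → num3 a b c < 8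
num3-<8 a b c = s≤s (+-mono-≤ (+-mono-≤ (le a) (*-monoʳ-≤ 2 (le b))) (*-monoʳ-≤ 4 (le c)))
  where
  le : ∀ a → bitℕ a ≤ 1
  le true  = ≤-refl
  le false = z≤n

num3-injective : ∀ {a b c a' b' c'} → num3 a b c ≡ num3 a' b' c' → a ≡ a' × b ≡ b' × c ≡ c'
num3-injective {a} {b} {c} {a'} {b'} {c'} e =
    trans (sym (bit₀ a b c)) (trans (cong (bit 0) e) (bit₀ a' b' c'))
  , trans (sym (bit₁ a b c)) (trans (cong (bit 1) e) (bit₁ a' b' c'))
  , trans (sym (bit₂ a b c)) (trans (cong (bit 2) e) (bit₂ a' b' c'))
  where
  bit₀ : ∀ a b c → bit 0 (num3 a b c) ≡ a
  bit₀ true  true  true  = refl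
  bit₀ true  true  false = refl
  bit₀ true  false true  = refl
  bit₀ true  false false = refl
  bit₀ false true  true  = refl
  bit₀ false true  false = refl
  bit₀ false false true  = refl
  bit₀ false false false = refl
  bit₁ : ∀ a b c → bit 1 (num3 a b c) ≡ b
  bit₁ true  true  true  = refl
  bit₁ true  true  false = refl
  bit₁ true  false true  = refl
  bit₁ true  false false = refl
  bit₁ false true  true  = refl
  bit₁ false true  false = refl
  bit₁ false false true  = refl
  bit₁ false false false = refl
  bit₂ : ∀ a b c → bit 2 (num3 a b c) ≡ c
  bit₂ true  true  true  = refl
  bit₂ true  true  false = refl
  bit₂ true  false true  = refl
  bit₂ true  false false = refl
  bit₂ false true  true  = refl
  bit₂ false true  false = refl
  bit₂ false false true  = refl
  bit₂ false false false = refl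

spare-<3 : ∀ q o → spare q o < 3
spare-<3 q o with not (q ≡ᵇ 0) ∧ not (o ≡ᵇ 0) | not (q ≡ᵇ 1) ∧ not (o ≡ᵇ 1)
... | true  | _     = s≤s z≤n
... | false | true  = s≤s (s≤s z≤n)
... | false | false = ≤-refl

spare-≢ : ∀ q o → spare q o ≢ q × spare q o ≢ o
spare-≢ 0 0 = (λ ()) , (λ ())
spare-≢ 0 1 = (λ ()) , (λ ())
spare-≢ 0 (suc (suc o)) = (λ ()) , (λ ())
spare-≢ 1 0 = (λ ()) , (λ ())
spare-≢ 1 1 = (λ ()) , (λ ())
spare-≢ 1 (suc (suc o)) = (λ ()) , (λ ())
spare-≢ (suc (suc q)) 0 = (λ ()) , (λ ())
spare-≢ (suc (suc q)) 1 = (λ ()) , (λ ())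
spare-≢ (suc (suc q)) (suc (suc o)) = (λ ()) , (λ ())

localMax-elim : ∀ q z o → localMax q z o ≡ true → 2 < z × q < z × o < z
localMax-elim q z o h with 2 <ᵇ z in a | q <ᵇ z in b | o <ᵇ z in c
... | true | true | true = <ᵇ-true a , <ᵇ-true b , <ᵇ-true c

localMax-intro : ∀ {q z o} → 2 < z → q < z → o < z → localMax q z o ≡ true
localMax-intro a b c rewrite <⇒<ᵇ-true a | <⇒<ᵇ-true b | <⇒<ᵇ-true c = refl

reductions : ℕ → List Kind
reductions zero    = []
reductions (suc m) = shift ∷ reduce ∷ reductions m

module SmallColours {n : ℕ} (Δ W B : ℕ) (parentOf : Fin n → ℕ → Maybe (Fin n)) where

  open Rules Δ W B
  open Dynamics Δ W B parentOf

  small# prev# : State n → ℕ → Fin n → ℕ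
  small# X i v = num3 (X (small i 0) v) (X (small i 1) v) (X (small i 2) v)
  prev# X i v  = num3 (X (prev i 0) v) (X (prev i 1) v) (X (prev i 2) v)

  num3-cong : ∀ {a b c x} → x < 8 → a ≡ bit 0 x → b ≡ bit 1 x → c ≡ bit 2 x → num3 a b c ≡ x
  num3-cong x<8 refl refl refl = num3-bit _ x<8

  Small : ℕ → State n → Set
  Small m X = ∀ i → i < Δ → ∀ v →
      small# X i v < m × (∀ u → parentOf v i ≡ just u → small# X i v ≢ small# X i u)

  parent# : State n → ℕ → Fin n → ℕ
  parent# X i v = num3 (peek (parentOf v i) (X (small i 0))) (peek (parentOf v i) (X (small i 1))) (peek (parentOf v i) (X (small i 2)))

  parent#-just : ∀ X i {v u} → parentOf v i ≡ just u → parent# X i v ≡ small# X i u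
  parent#-just X i e rewrite e = refl

  0<3 : 0 < 3
  0<3 = s≤s z≤n
  1<3 : 1 < 3
  1<3 = s≤s (s≤s z≤n)
  2<3 : 2 < 3
  2<3 = ≤-refl

  module _ {m : ℕ} (3≤m : 3 ≤ m) {X Y Z : State n} (sh : Step shift X Y) (rd : Step reduce Y Z)
           (small-X : Small (suc m) X) (i : ℕ) (i<Δ : i < Δ) where

    prev-Y : ∀ v → prev# Y i v ≡ small# X i v
    prev-Y v rewrite sh (prev i 0) (i<Δ , 0<3) v | sh (prev i 1) (i<Δ , 1<3) v | sh (prev i 2) (i<Δ , 2<3) v = refl

    shifted : ℕ → Fin n → ℕ
    shifted i v = shiftColour (peek (parentOf v i) (λ _ → true)) (parent# X i v) (small# X i v)

    shifted-< : ∀ v → shifted i v < suc m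
    shifted-< v with parentOf v i in e
    ... | just u = proj₁ (small-X i i<Δ u)
    ... | nothing with small# X i v ≡ᵇ 0
    ...   | true  = s≤s (≤-trans (s≤s z≤n) 3≤m)
    ...   | false = s≤s z≤n

    shifted-<8 : ∀ v → shifted i v < 8
    shifted-<8 v with parentOf v i
    ... | just u = num3-<8 (X (small i 0) u) (X (small i 1) u) (X (small i 2) u)
    ... | nothing with small# X i v ≡ᵇ 0
    ...   | true  = s≤s (s≤s z≤n)
    ...   | false = s≤s z≤n

    small-Y : ∀ v → small# Y i v ≡ shifted i v
    small-Y v = num3-cong (shifted-<8 v)
      (sh (small i 0) (i<Δ , 0<3) v) (sh (small i 1) (i<Δ , 1<3) v) (sh (small i 2) (i<Δ , 2<3) v)

    small-Y-just : ∀ {v u} → parentOf v i ≡ just u → small# Y i v ≡ small# X i u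
    small-Y-just {v} e = trans (small-Y v) (eq e)
      where
      eq : ∀ {u} → parentOf v i ≡ just u → shifted i v ≡ small# X i u
      eq e rewrite e = refl

    -- A child takes the old colour of its parent, which differs from its own by properness, and a
    -- root is made to change. Properness survives the shift for this reason: the parent leaves the
    -- colour that its children receive.
    small-Y-≢-prev : ∀ v → small# Y i v ≢ prev# Y i v
    small-Y-≢-prev v e with parentOf v i in p
    ... | just u  = proj₂ (small-X i i<Δ v) u p (trans (sym (prev-Y v)) (trans (sym e) (small-Y-just p)))
    ... | nothing = root (trans (sym (small-Y v)) (trans e (prev-Y v)))
      where
      root : shifted i v ≢ small# X i v
      root rewrite p with small# X i v
      ... | zero  = λ ()
      ... | suc _ = λ ()

    -- The register `prev` of u therefore tells u the colour of all its children, although u cannot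
    -- tell which neighbours are its children.
    child-colour : ∀ {v u} → parentOf v i ≡ just u → small# Y i v ≡ prev# Y i u
    child-colour {v} {u} e = trans (small-Y-just e) (sym (prev-Y u))

    proper-Y : ∀ {v u} → parentOf v i ≡ just u → small# Y i v ≢ small# Y i u
    proper-Y {v} {u} e eq = small-Y-≢-prev u (trans (sym eq) (child-colour e))

    reduced : Fin n → ℕ
    reduced v = reduceColour (parent# Y i v) (small# Y i v) (prev# Y i v)

    reduced-<8 : ∀ v → reduced v < 8
    reduced-<8 v with localMax (parent# Y i v) (small# Y i v) (prev# Y i v)
    ... | true  = ≤-trans (spare-<3 (parent# Y i v) (prev# Y i v)) (s≤s (s≤s (s≤s z≤n)))
    ... | false = num3-<8 (Y (small i 0) v) (Y (small i 1) v) (Y (small i 2) v)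

    small-Z : ∀ v → small# Z i v ≡ reduced v
    small-Z v = num3-cong (reduced-<8 v)
      (rd (small i 0) (i<Δ , 0<3) v) (rd (small i 1) (i<Δ , 1<3) v) (rd (small i 2) (i<Δ , 2<3) v)

    parent-<-max : ∀ v → small# Y i v ≡ m → parent# Y i v < small# Y i v
    parent-<-max v e with parentOf v i in p
    ... | nothing = subst (0 <_) (sym e) (≤-trans (s≤s z≤n) 3≤m)
    ... | just u  = ≤∧≢⇒< (subst (small# Y i u ≤_) (sym e)
                      (≤-pred (subst (_< suc m) (sym (small-Y u)) (shifted-< u)))) (proper-Y p ∘ sym)

    prev-<-max : ∀ v → small# Y i v ≡ m → prev# Y i v < small# Y i v
    prev-<-max v e = ≤∧≢⇒< (subst₂ _≤_ (sym (prev-Y v)) (sym e) (≤-pred (proj₁ (small-X i i<Δ v))))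
                            (small-Y-≢-prev v ∘ sym)

    -- A node with the top colour m ≥ 3 exceeds the colours of its parent and of its children, so it
    -- is a local maximum and drops below 3. Each pass thus removes one colour.
    reduced-< : ∀ v → reduced v < m
    reduced-< v with localMax (parent# Y i v) (small# Y i v) (prev# Y i v) in e
    ... | true  = ≤-trans (spare-<3 (parent# Y i v) (prev# Y i v)) 3≤m
    ... | false = ≤∧≢⇒< (≤-pred (subst (_< suc m) (sym (small-Y v)) (shifted-< v))) λ eq →
          contradiction (trans (sym (localMax-intro (subst (2 <_) (sym eq) 3≤m) (parent-<-max v eq) (prev-<-max v eq))) e) λ ()

    -- Child and parent cannot both be local maxima, so at most one of them changes. A changing
    -- child avoids its parent's colour, a changing parent the common colour of its children.
    reduced-proper : ∀ {v u} → parentOf v i ≡ just u → reduced v ≢ reduced u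
    reduced-proper {v} {u} p
      with localMax (parent# Y i v) (small# Y i v) (prev# Y i v) in ev
         | localMax (parent# Y i u) (small# Y i u) (prev# Y i u) in eu
    ... | false | false = proper-Y p
    ... | true  | false = λ eq → proj₁ (spare-≢ (parent# Y i v) (prev# Y i v)) (trans eq (sym (parent#-just Y i p)))
    ... | false | true  = λ eq → proj₂ (spare-≢ (parent# Y i u) (prev# Y i u)) (trans (sym eq) (child-colour p))
    ... | true  | true  = contradiction
          (<-trans (subst (_< small# Y i u) (sym (child-colour p)) (proj₂ (proj₂ (localMax-elim (parent# Y i u) _ _ eu))))
                   (subst (_< small# Y i v) (parent#-just Y i p) (proj₁ (proj₂ (localMax-elim (parent# Y i v) _ _ ev)))))
          (<-irrefl refl)

  reduction : ∀ {m X Y Z} → 3 ≤ m → Step shift X Y → Step reduce Y Z → Small (suc m) X → Small m Z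
  reduction {X = X} {Y} {Z} 3≤m sh rd sx i i<Δ v =
      subst (_< _) (sym (small-Z 3≤m sh rd sx i i<Δ v)) (reduced-< 3≤m sh rd sx i i<Δ v)
    , λ u p eq → reduced-proper 3≤m sh rd sx i i<Δ p
        (trans (sym (small-Z 3≤m sh rd sx i i<Δ v)) (trans eq (small-Z 3≤m sh rd sx i i<Δ u)))

  reductions-correct : ∀ m {X Z} → Small (m + 3) X → Steps Step (reductions m) X Z → Small 3 Z
  reductions-correct zero    sx []              = sx
  reductions-correct (suc m) sx (sh ∷ rd ∷ ss) =
    reductions-correct m (reduction (m≤n+m 3 m) sh rd sx) ss

-- Greedy colouring, one class of the product colouring per round

true≢false : true ≢ false
true≢false ()

least : ∀ m g → allBelow m g ≡ false → ∃ λ a → a < m × g a ≡ false × allBelow a g ≡ true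
least (suc m) g e with allBelow m g in all
... | true  = m , ≤-refl , trans (sym (∧-identityʳ (g m))) e , all
... | false with least m g all
...   | a , a<m , ga , below = a , m<n⇒m<1+n a<m , ga , below

-- This is why `leastFree` adds a single colour and `final` stays one-hot.
least-unique : ∀ g a → g a ≡ false → allBelow a g ≡ true → ∀ b → not (g b) ∧ allBelow b g ≡ (b ≡ᵇ a)
least-unique g a ga below b with <-cmp b a
... | tri≈ _ refl _ rewrite ga | below = sym (≡ᵇ-refl b)
... | tri< b<a b≢a _ rewrite allBelow-elim a g below b b<a = sym (≢⇒≡ᵇ-false b≢a)
... | tri> _ b≢a a<b with allBelow b g in e
...   | false = trans (∧-zeroʳ (not (g b))) (sym (≢⇒≡ᵇ-false b≢a))
...   | true  = contradiction (trans (sym (allBelow-elim b g e a a<b)) ga) true≢false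

-- `E⇒parent` makes the Δ parents of a node include all its neighbours, so `nbrHas` misses none of
-- them.
module Greedy {n : ℕ} (Δ W B : ℕ) (parentOf : Fin n → ℕ → Maybe (Fin n))
              (E : Fin n → Fin n → Set) (E-sym : ∀ {v u} → E v u → E u v)
              (E⇒parent : ∀ {v u} → E v u → ∃ λ i → i < Δ × parentOf v i ≡ just u) where

  open Rules Δ W B
  open Dynamics Δ W B parentOf
  open SmallColours Δ W B parentOf

  isTurn : State n → Fin n → ℕ → Bool
  isTurn X v m = allBelow m (λ i → small# X i v ≡ᵇ 2)

  ⟦turnBelow⟧ : ∀ {b} X v m → ⟦ turnBelow {b} m ⟧ (env X v) ≡ isTurn X v m
  ⟦turnBelow⟧ X v m = ⟦allₑ⟧ m (digit (_≡ᵇ 2)) (env X v)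

  number : State n → Fin n → ℕ
  number X v = value 3 Δ (λ i → small# X i v)

  Digits : State n → Set
  Digits X = ∀ i → i < Δ → ∀ v → small# X i v < 3

  Ticks : State n → State n → Set
  Ticks X Y = ∀ i → i < Δ → ∀ v → small# Y i v ≡ ripple 2 (λ i → small# X i v) i

  bump-<3 : ∀ x → x < 3 → bump 2 x < 3
  bump-<3 0 _ = s≤s (s≤s z≤n)
  bump-<3 1 _ = s≤s (s≤s (s≤s z≤n))
  bump-<3 2 _ = s≤s z≤n
  bump-<3 (suc (suc (suc _))) (s≤s (s≤s (s≤s ())))

  ripple-<3 : ∀ {X} → Digits X → ∀ i → i < Δ → ∀ v → ripple 2 (λ i → small# X i v) i < 3
  ripple-<3 {X} dg i i<Δ v with isTurn X v i
  ... | true  = bump-<3 (small# X i v) (dg i i<Δ v)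
  ... | false = dg i i<Δ v

  ticks : ∀ {b X Y} → Digits X →
          (∀ i t → i < Δ × t < 3 → ∀ v → Y (small i t) v ≡ ⟦ tick {b} i t ⟧ (env X v)) → Ticks X Y
  ticks {b} {X} {Y} dg s i i<Δ v = begin
    small# Y i v                                        ≡⟨ cong₃ (s' 0 0<3) (s' 1 1<3) (s' 2 2<3) ⟩
    num3 (new 0) (new 1) (new 2)                        ≡⟨ merge ⟩
    ripple 2 (λ i → small# X i v) i                     ∎
    where
    open ≡-Reasoning
    x = small# X i v
    new : ℕ → Bool
    new t = if isTurn X v i then bit t (bump 2 x) else X (small i t) v
    s' : ∀ t → t < 3 → Y (small i t) v ≡ new t
    s' t t<3 = trans (s i t (i<Δ , t<3) v)
      (trans (⟦muxₑ⟧ (turnBelow i) (digit (λ x → bit t (bump 2 x)) i) (ref (small i t)) (env {b} X v))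
             (cong (λ c → if c then bit t (bump 2 x) else X (small i t) v) (⟦turnBelow⟧ {b} X v i)))
    cong₃ : ∀ {a b c a' b' c'} → a ≡ a' → b ≡ b' → c ≡ c' → num3 a b c ≡ num3 a' b' c'
    cong₃ refl refl refl = refl
    merge : num3 (new 0) (new 1) (new 2) ≡ ripple 2 (λ i → small# X i v) i
    merge with isTurn X v i
    ... | true  = num3-bit (bump 2 x) (≤-trans (bump-<3 x (dg i i<Δ v)) (s≤s (s≤s (s≤s z≤n))))
    ... | false = refl

  ticks-digits : ∀ {X Y} → Digits X → Ticks X Y → Digits Y
  ticks-digits {X} dg tk i i<Δ v = subst (_< 3) (sym (tk i i<Δ v)) (ripple-<3 {X} dg i i<Δ v)

  module Ranked (X₀ : State n) (small-X₀ : Small 3 X₀) where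

    -- All digits of v are 2, i.e. it is the turn of v, in round rank v.
    rank : Fin n → ℕ
    rank v = 3 ^ Δ ∸ suc (number X₀ v)

    number-<3^ : ∀ X → Digits X → ∀ v → number X v < 3 ^ Δ
    number-<3^ X dg v = value-< 3 Δ λ i i<Δ → dg i i<Δ v

    digits-X₀ : Digits X₀
    digits-X₀ i i<Δ v = proj₁ (small-X₀ i i<Δ v)

    number+rank : ∀ v → number X₀ v + suc (rank v) ≡ 3 ^ Δ
    number+rank v = trans (+-suc (number X₀ v) (rank v)) (m+[n∸m]≡n (number-<3^ X₀ digits-X₀ v))

    rank-< : ∀ v → rank v < 3 ^ Δ
    rank-< v = ≤-trans (m≤n+m (suc (rank v)) (number X₀ v)) (≤-reflexive (number+rank v))

    -- Equal ranks mean equal class numbers, hence equal digits in all forests, while the forest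
    -- that contains the edge assigns two different digits.
    rank-≢ : ∀ {v u} → E v u → rank v ≢ rank u
    rank-≢ {v} {u} e eq with E⇒parent e
    ... | i , i<Δ , p = proj₂ (small-X₀ i i<Δ v) u p
      (value-injective 3 Δ (λ j j<Δ → digits-X₀ j j<Δ v) (λ j j<Δ → digits-X₀ j j<Δ u)
        (+-cancelʳ-≡ (suc (rank u)) _ _
          (trans (cong (λ r → number X₀ v + suc r) (sym eq)) (trans (number+rank v) (sym (number+rank u)))))
        i i<Δ)

    -- Up to its turn a node counts towards 3^Δ. Afterwards its number has wrapped round to 0, and
    -- the rounds left below 3^Δ are too few to bring a second turn.
    Timed : ℕ → State n → Fin n → Set
    Timed τ X v = (∃ λ e → τ + e ≡ rank v × number X v + suc e ≡ 3 ^ Δ)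
                ⊎ (∃ λ e → suc (rank v) + e ≡ τ × number X v ≡ e)

    timed : ∀ {τ X Y} → τ < 3 ^ Δ → Digits X → Ticks X Y → ∀ v → Timed τ X v →
            Timed (suc τ) Y v × isTurn X v Δ ≡ (τ ≡ᵇ rank v)
    timed {τ} {X} {Y} τ< dg tk v t with value-ripple 2 Δ {λ i → small# X i v} {λ i → small# Y i v} (λ i i<Δ → tk i i<Δ v) | t
    ... | inj₁ (_ , v') | inj₁ (zero , _ , b) = contradiction
          (trans v' (trans (sym (+-comm (number X v) 1)) b))
          (<⇒≢ (number-<3^ Y (ticks-digits {X} {Y} dg tk) v))
    ... | inj₂ (c , v' , _) | inj₁ (zero , a , b) =
          inj₂ (0 , trans (+-identityʳ _) (cong suc (sym τ≡)) , v')
        , trans c (sym (trans (cong (τ ≡ᵇ_) (sym τ≡)) (≡ᵇ-refl τ)))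
      where
      τ≡ : τ ≡ rank v
      τ≡ = trans (sym (+-identityʳ τ)) a
    ... | inj₁ (c , v') | inj₁ (suc e , a , b) =
          inj₁ (e , trans (sym (+-suc τ e)) a , trans (cong (_+ suc e) v') (trans (sym (+-suc (number X v) (suc e))) b))
        , trans c (sym (≢⇒≡ᵇ-false (<⇒≢ (subst (τ <_) a (m<m+n τ (s≤s z≤n))))))
    ... | inj₂ (_ , _ , w) | inj₁ (suc e , a , b) = contradiction
          (+-cancelˡ-≡ (number X v) 1 (suc (suc e)) (trans (+-comm (number X v) 1) (trans w (sym b)))) λ ()
    ... | inj₁ (c , v') | inj₂ (e , a , b) =
          inj₂ (suc e , trans (+-suc (suc (rank v)) e) (cong suc a) , trans v' (cong suc b))
        , trans c (sym (≢⇒≡ᵇ-false (>⇒≢ (≤-trans (m≤m+n (suc (rank v)) e) (≤-reflexive a)))))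
    ... | inj₂ (_ , _ , w) | inj₂ (e , a , b) = contradiction
          (trans (cong suc (sym b)) w)
          (<⇒≢ (≤-<-trans (≤-trans (s≤s (m≤n+m e (rank v))) (≤-reflexive a)) τ<))

    timed-0 : ∀ v → Timed 0 X₀ v
    timed-0 v = inj₁ (rank v , refl , number+rank v)

    Clocked : ℕ → State n → Set
    Clocked τ X = Digits X × (∀ v → Timed τ X v)

    clocked : ∀ {τ X Y} → τ < 3 ^ Δ → Ticks X Y → Clocked τ X →
              Clocked (suc τ) Y × (∀ v → isTurn X v Δ ≡ (τ ≡ᵇ rank v))
    clocked {τ} {X} {Y} τ< tk (dg , tm) =
        (ticks-digits {X} {Y} dg tk , λ v → proj₁ (timed {τ} {X} {Y} τ< dg tk v (tm v)))
      , λ v → proj₂ (timed {τ} {X} {Y} τ< dg tk v (tm v))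

    Started : ℕ → State n → Set
    Started τ X = Clocked τ X
      × (∀ a → a ≤ Δ → ∀ v → X (ptr a) v ≡ (a ≡ᵇ τ))
      × (∀ a → a ≤ Δ → ∀ v → X (final a) v ≡ (a ≡ᵇ rank v) ∧ (rank v <ᵇ τ))

    started : ∀ {τ X Y} → τ < 3 ^ Δ → Step init X Y → Started τ X → Started (suc τ) Y
    started {τ} {X} {Y} τ< s (ck , pt , fi) = proj₁ ck' , pointer , finals
      where
      ck' = clocked {τ} {X} {Y} τ< (ticks {false} {X} {Y} (proj₁ ck) (λ i t b → s (small i t) b)) ck
      pointer : ∀ a → a ≤ Δ → ∀ v → Y (ptr a) v ≡ (a ≡ᵇ suc τ)
      pointer zero    h v = s (ptr 0) h v
      pointer (suc a) h v = trans (s (ptr (suc a)) h v) (pt a (≤-trans (n≤1+n a) h) v)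
      choose : ∀ a r → ((a ≡ᵇ τ) ∧ (τ ≡ᵇ r)) ∨ ((a ≡ᵇ r) ∧ (r <ᵇ τ)) ≡ (a ≡ᵇ r) ∧ (r <ᵇ suc τ)
      choose a r with <-cmp τ r
      ... | tri< τ<r τ≢r _ rewrite ≢⇒≡ᵇ-false τ≢r | ≥⇒<ᵇ-false (<⇒≤ τ<r) | ≥⇒<ᵇ-false τ<r | ∧-zeroʳ (a ≡ᵇ τ) = refl
      ... | tri≈ _ refl _ rewrite ≡ᵇ-refl τ | <⇒<ᵇ-true (n<1+n τ) | ≥⇒<ᵇ-false (≤-refl {τ})
                                | ∧-zeroʳ (a ≡ᵇ τ) = ∨-identityʳ _
      ... | tri> _ τ≢r r<τ rewrite ≢⇒≡ᵇ-false τ≢r | <⇒<ᵇ-true r<τ | <⇒<ᵇ-true (m<n⇒m<1+n r<τ) | ∧-zeroʳ (a ≡ᵇ τ) = refl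
      finals : ∀ a → a ≤ Δ → ∀ v → Y (final a) v ≡ (a ≡ᵇ rank v) ∧ (rank v <ᵇ suc τ)
      finals a h v = begin
        Y (final a) v                                                 ≡⟨ s (final a) h v ⟩
        ⟦ rule init (final a) ⟧ ρ                                     ≡⟨ ⟦∨ₑ⟧ (ref (ptr a) ∧ₑ turnBelow Δ) (ref (final a)) ρ ⟩
        (X (ptr a) v ∧ ⟦ turnBelow {false} Δ ⟧ ρ) ∨ X (final a) v
          ≡⟨ cong₂ _∨_ (cong₂ _∧_ (pt a h v) (trans (⟦turnBelow⟧ {false} X v Δ) (proj₂ ck' v))) (fi a h v) ⟩
        ((a ≡ᵇ τ) ∧ (τ ≡ᵇ rank v)) ∨ ((a ≡ᵇ rank v) ∧ (rank v <ᵇ τ)) ≡⟨ choose a (rank v) ⟩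
        (a ≡ᵇ rank v) ∧ (rank v <ᵇ suc τ)                             ∎
        where
        open ≡-Reasoning
        ρ : Atom false → Bool
        ρ = env X v

    Chosen : State n → Fin n → Set
    Chosen X v = ∃ λ a → a ≤ Δ × (∀ b → b ≤ Δ → X (final b) v ≡ (b ≡ᵇ a))

    -- That waiting nodes hold no colour makes the colour taken at the turn the only one.
    Proper : ℕ → State n → Set
    Proper τ X = Clocked τ X
      × (∀ v → τ ≤ rank v → ∀ a → a ≤ Δ → X (final a) v ≡ false)
      × (∀ v → rank v < τ → Chosen X v)
      × (∀ {v u} → E v u → rank v < τ → rank u < τ → ∀ a → a ≤ Δ → X (final a) v ≡ true → X (final a) u ≡ true → ⊥)

    started⇒proper : ∀ {X} → Started (suc Δ) X → Proper (suc Δ) X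
    started⇒proper {X} (ck , _ , fi) = ck , waiting , chosen , proper
      where
      waiting : ∀ v → suc Δ ≤ rank v → ∀ a → a ≤ Δ → X (final a) v ≡ false
      waiting v h a a≤Δ = trans (fi a a≤Δ v) (trans (cong ((a ≡ᵇ rank v) ∧_) (≥⇒<ᵇ-false h)) (∧-zeroʳ (a ≡ᵇ rank v)))
      one : ∀ v → rank v < suc Δ → ∀ b → b ≤ Δ → X (final b) v ≡ (b ≡ᵇ rank v)
      one v h b b≤Δ = trans (fi b b≤Δ v) (trans (cong ((b ≡ᵇ rank v) ∧_) (<⇒<ᵇ-true h)) (∧-identityʳ (b ≡ᵇ rank v)))
      chosen : ∀ v → rank v < suc Δ → Chosen X v
      chosen v h = rank v , ≤-pred h , one v h
      proper : ∀ {v u} → E v u → rank v < suc Δ → rank u < suc Δ → ∀ a → a ≤ Δ → X (final a) v ≡ true → X (final a) u ≡ true → ⊥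
      proper {v} {u} e hv hu a h av au = rank-≢ e
        (trans (sym (≡ᵇ-true {a} (trans (sym (one v hv a h)) av))) (≡ᵇ-true {a} (trans (sym (one u hu a h)) au)))

    module _ {τ X Y} (τ< : τ < 3 ^ Δ) (s : Step greedy X Y) (inv : Proper τ X) where

      nbr? : Fin n → ℕ → Bool
      nbr? v a = anyBelow Δ (λ i → peek (parentOf v i) (X (final a)))

      at-most-one : ∀ u {a b} → a ≤ Δ → b ≤ Δ → X (final a) u ≡ true → X (final b) u ≡ true → a ≡ b
      at-most-one u {a} {b} a≤Δ b≤Δ ha hb with <-≤-connex (rank u) τ
      ... | inj₂ τ≤r = contradiction (trans (sym ha) (proj₁ (proj₂ inv) u τ≤r a a≤Δ)) true≢false
      ... | inj₁ r<τ with proj₁ (proj₂ (proj₂ inv)) u r<τ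
      ...   | c , _ , one = trans (≡ᵇ-true (trans (sym (one a a≤Δ)) ha)) (sym (≡ᵇ-true (trans (sym (one b b≤Δ)) hb)))

      -- If all Δ + 1 colours were seen, two of them would come through the same one of Δ indices,
      -- yet a neighbour holds at most one colour.
      some-free : ∀ v → allBelow (suc Δ) (nbr? v) ≡ false
      some-free v with allBelow (suc Δ) (nbr? v) in all
      ... | false = refl
      ... | true  = ⊥-elim (clash (pigeonhole (n<1+n Δ) (λ a → fromℕ< (proj₁ (proj₂ (witness a))))))
        where
        witness : (a : Fin (suc Δ)) → ∃ λ i → i < Δ × peek (parentOf v i) (X (final (toℕ a))) ≡ true
        witness a = anyBelow-elim Δ _ (allBelow-elim (suc Δ) (nbr? v) all (toℕ a) (toℕ<n a))
        same-nbr : ∀ {i j a b} → i ≡ j → a ≤ Δ → b ≤ Δ → peek (parentOf v i) (X (final a)) ≡ true →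
                   peek (parentOf v j) (X (final b)) ≡ true → a ≡ b
        same-nbr {i} refl a≤Δ b≤Δ ha hb with parentOf v i
        ... | just u = at-most-one u a≤Δ b≤Δ ha hb
        clash : (∃ λ a → ∃ λ b → a Fin.< b × fromℕ< (proj₁ (proj₂ (witness a))) ≡ fromℕ< (proj₁ (proj₂ (witness b)))) → ⊥
        clash (a , b , a<b , same) = <⇒≢ a<b (same-nbr
          (trans (sym (toℕ-fromℕ< (proj₁ (proj₂ (witness a))))) (trans (cong toℕ same) (toℕ-fromℕ< (proj₁ (proj₂ (witness b))))))
          (≤-pred (toℕ<n a)) (≤-pred (toℕ<n b)) (proj₂ (proj₂ (witness a))) (proj₂ (proj₂ (witness b))))

      ck' = clocked {τ} {X} {Y} τ< (ticks {true} {X} {Y} (proj₁ (proj₁ inv)) (λ i t b → s (small i t) b)) (proj₁ inv)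

      final' : ∀ a → a ≤ Δ → ∀ v →
        Y (final a) v ≡ ((not (nbr? v a) ∧ allBelow a (nbr? v)) ∧ (τ ≡ᵇ rank v)) ∨ X (final a) v
      final' a h v = trans (s (final a) h v) (trans (⟦∨ₑ⟧ (leastFree a ∧ₑ turnBelow Δ) (ref (final a)) ρ)
        (cong (_∨ X (final a) v) (cong₂ _∧_
          (cong₂ _∧_ (cong not (has? a))
                     (trans (⟦allₑ⟧ a nbrHas ρ) (allBelow-cong a λ b _ → has? b)))
          (trans (⟦turnBelow⟧ {true} X v Δ) (proj₂ ck' v)))))
        where
        ρ : Atom true → Bool
        ρ = env X v
        has? : ∀ a → ⟦ nbrHas a ⟧ ρ ≡ nbr? v a
        has? a = ⟦anyₑ⟧ Δ (λ i → table (nbr i (final a) Vec.∷ Vec.[]) Vec.head) ρ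

      stays : ∀ v → τ ≢ rank v → ∀ a → a ≤ Δ → Y (final a) v ≡ X (final a) v
      stays v ne a h = trans (final' a h v)
        (cong (_∨ X (final a) v) (trans (cong (picked ∧_) (≢⇒≡ᵇ-false ne)) (∧-zeroʳ picked)))
        where
        picked : Bool
        picked = not (nbr? v a) ∧ allBelow a (nbr? v)

      chooses : ∀ v → τ ≡ rank v → ∃ λ a → a ≤ Δ × nbr? v a ≡ false × (∀ b → b ≤ Δ → Y (final b) v ≡ (b ≡ᵇ a))
      chooses v eq with least (suc Δ) (nbr? v) (some-free v)
      ... | a , a< , free , below = a , ≤-pred a< , free , λ b b≤Δ → trans (final' b b≤Δ v) (begin
            ((not (nbr? v b) ∧ allBelow b (nbr? v)) ∧ (τ ≡ᵇ rank v)) ∨ X (final b) v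
              ≡⟨ cong₂ _∨_ (cong₂ _∧_ (least-unique (nbr? v) a free below b) (trans (cong (τ ≡ᵇ_) (sym eq)) (≡ᵇ-refl τ)))
                           (proj₁ (proj₂ inv) v (≤-reflexive eq) b b≤Δ) ⟩
            ((b ≡ᵇ a) ∧ true) ∨ false  ≡⟨ ∨-identityʳ _ ⟩
            (b ≡ᵇ a) ∧ true            ≡⟨ ∧-identityʳ _ ⟩
            (b ≡ᵇ a)                   ∎)
        where open ≡-Reasoning

      -- The neighbour u does not act in this round, so the colour it holds afterwards is the one v
      -- has read.
      avoids : ∀ {v u} → E v u → τ ≡ rank v → τ ≢ rank u → ∀ a → a ≤ Δ → Y (final a) v ≡ true → Y (final a) u ≡ true → ⊥
      avoids {v} {u} e eq ne a h av au with chooses v eq | E⇒parent e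
      ... | c , _ , free , one | i , i<Δ , p with ≡ᵇ-true {a} {c} (trans (sym (one a h)) av)
      ...   | refl = true≢false (trans (sym (anyBelow-intro Δ _ i i<Δ
                       (trans (cong (λ m → peek m (X (final a))) p) (trans (sym (stays u ne a h)) au)))) free)

      proper : Proper (suc τ) Y
      proper = proj₁ ck' , waiting , chosen , disjoint
        where
        waiting : ∀ v → suc τ ≤ rank v → ∀ a → a ≤ Δ → Y (final a) v ≡ false
        waiting v h a a≤Δ = trans (stays v (<⇒≢ h) a a≤Δ) (proj₁ (proj₂ inv) v (<⇒≤ h) a a≤Δ)
        chosen : ∀ v → rank v < suc τ → Chosen Y v
        chosen v h with m<1+n⇒m<n∨m≡n h
        ... | inj₂ eq with chooses v (sym eq)
        ...   | a , a≤Δ , _ , one = a , a≤Δ , one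
        chosen v h | inj₁ r<τ with proj₁ (proj₂ (proj₂ inv)) v r<τ
        ...   | a , a≤Δ , one = a , a≤Δ , λ b b≤Δ → trans (stays v (>⇒≢ r<τ) b b≤Δ) (one b b≤Δ)
        disjoint : ∀ {v u} → E v u → rank v < suc τ → rank u < suc τ → ∀ a → a ≤ Δ →
                   Y (final a) v ≡ true → Y (final a) u ≡ true → ⊥
        disjoint {v} {u} e hv hu a h av au with m<1+n⇒m<n∨m≡n hv | m<1+n⇒m<n∨m≡n hu
        ... | inj₂ ev | inj₂ eu = rank-≢ e (trans ev (sym eu))
        ... | inj₂ ev | inj₁ lu = avoids e (sym ev) (>⇒≢ lu) a h av au
        ... | inj₁ lv | inj₂ eu = avoids (E-sym e) (sym eu) (>⇒≢ lv) a h au av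
        ... | inj₁ lv | inj₁ lu = proj₂ (proj₂ (proj₂ inv)) e lv lu a h
                (trans (sym (stays v (>⇒≢ lv) a h)) av) (trans (sym (stays u (>⇒≢ lu) a h)) au)

    greedy-correct : suc Δ ≤ 3 ^ Δ → ∀ {Z} →
      (∀ a → a ≤ Δ → ∀ v → X₀ (ptr a) v ≡ (a ≡ᵇ 0)) →
      (∀ a → a ≤ Δ → ∀ v → X₀ (final a) v ≡ false) →
      Steps Step (replicate (suc Δ) init ++ replicate (3 ^ Δ ∸ suc Δ) greedy) X₀ Z →
      (∀ v → Chosen Z v) × (∀ {v u} → E v u → ∀ a → a ≤ Δ → Z (final a) v ≡ true → Z (final a) u ≡ true → ⊥)
    greedy-correct Δ<3^Δ {Z} pt fi ss with steps-++ (replicate (suc Δ) init) ss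
    ... | Y , ss₁ , ss₂ = (λ v → proj₁ (proj₂ (proj₂ end)) v (rank-< v))
                        , λ {v} {u} e → proj₂ (proj₂ (proj₂ end)) e (rank-< v) (rank-< u)
      where
      start : Started (suc Δ) Y
      start = steps-replicate init (suc Δ) Started (λ j {X} {Y} j< → started {j} {X} {Y} (≤-trans j< Δ<3^Δ)) ss₁
        ((digits-X₀ , timed-0) , pt , λ a h v → trans (fi a h v) (sym (∧-zeroʳ (a ≡ᵇ rank v))))
      -- The first Δ + 1 turns fall into the `init` rounds, so greedy round j is turn j + Δ + 1.
      end : Proper (3 ^ Δ) Z
      end = subst (λ τ → Proper τ Z) (m∸n+n≡m Δ<3^Δ)
        (steps-replicate greedy (3 ^ Δ ∸ suc Δ) (λ j → Proper (j + suc Δ))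
          (λ j {X} {Y} j< → proper {j + suc Δ} {X} {Y} (subst (j + suc Δ <_) (m∸n+n≡m Δ<3^Δ) (+-monoˡ-< (suc Δ) j<)))
          ss₂ (started⇒proper {Y} start))

-- Neighbour lists, identifiers and output strings

bfilter-sound : {A : Set} (p : A → Bool) (xs : List A) → ∀ {x} → x ∈ bfilter p xs → p x ≡ true
bfilter-sound p (y ∷ xs) x∈ with p y in e
bfilter-sound p (y ∷ xs) (here refl) | true  = e
bfilter-sound p (y ∷ xs) (there x∈)  | true  = bfilter-sound p xs x∈
bfilter-sound p (y ∷ xs) x∈          | false = bfilter-sound p xs x∈

bfilter-complete : {A : Set} (p : A → Bool) {xs : List A} → ∀ {x} → x ∈ xs → p x ≡ true → x ∈ bfilter p xs
bfilter-complete p (here refl) h rewrite h = here refl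
bfilter-complete p {y ∷ _} (there x∈) h with p y
... | true  = there (bfilter-complete p x∈ h)
... | false = bfilter-complete p x∈ h

nthMaybe-∈ : {A : Set} (xs : List A) → ∀ r {x} → nthMaybe xs r ≡ just x → x ∈ xs
nthMaybe-∈ (y ∷ xs) zero    refl = here refl
nthMaybe-∈ (y ∷ xs) (suc r) e    = there (nthMaybe-∈ xs r e)

∈-nthMaybe : {A : Set} {xs : List A} → ∀ {x} → x ∈ xs → ∃ λ r → r < length xs × nthMaybe xs r ≡ just x
∈-nthMaybe (here refl) = 0 , s≤s z≤n , refl
∈-nthMaybe (there x∈) with ∈-nthMaybe x∈
... | r , r< , e = suc r , s≤s r< , e

bitsLE-injective : ∀ L {x y} → x < 2 ^ L → y < 2 ^ L → bitsLE L x ≡ bitsLE L y → x ≡ y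
bitsLE-injective zero    (s≤s z≤n) (s≤s z≤n) e = refl
bitsLE-injective (suc L) {x} {y} hx hy e = begin
  x                   ≡⟨ m≡m%n+[m/n]*n x 2 ⟩
  x % 2 + x / 2 * 2   ≡⟨ cong₂ (λ a b → a + b * 2) (lowest (m%n<n x 2) (m%n<n y 2) (Vec.∷-injectiveˡ e))
                           (bitsLE-injective L (half hx) (half hy) (Vec.∷-injectiveʳ e)) ⟩
  y % 2 + y / 2 * 2   ≡⟨ m≡m%n+[m/n]*n y 2 ⟨
  y                   ∎
  where
  open ≡-Reasoning
  half : ∀ {x} → x < 2 ^ suc L → x / 2 < 2 ^ L
  half {x} h = m<n*o⇒m/o<n (subst (x <_) (*-comm 2 (2 ^ L)) h)
  lowest : ∀ {a b} → a < 2 → b < 2 → (a ≡ᵇ 1) ≡ (b ≡ᵇ 1) → a ≡ b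
  lowest {0} {0} _ _ _ = refl
  lowest {1} {1} _ _ _ = refl
  lowest {suc (suc _)} (s≤s (s≤s ()))
  lowest {_} {suc (suc _)} _ (s≤s (s≤s ()))

-- Identifiers are at most n < 2^`lg n`, so their `lg n` bits determine them.
val-separates : ∀ {n} {v u : Fin n} → v ≢ u → ∃ λ (j : Fin (lg n)) → val j v ≢ val j u
val-separates {n} {v} {u} v≢u with any? (λ j → ¬? (val {n} j v Bool.≟ val j u))
... | yes w   = w
... | no none = contradiction (toℕ-injective (suc-injective (bitsLE-injective (lg n) (bounded v) (bounded u)
                  (Vec.reverse-injective (extensional λ j → decidable-stable (val j v Bool.≟ val j u) λ ne → none (j , ne)))))) v≢u
  where
  bounded : (x : Fin n) → ident x < 2 ^ lg n
  bounded x = ≤-<-trans (toℕ<n x) (<2^lg n)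
  extensional : ∀ {m} {xs ys : Vec Bool m} → (∀ j → Vec.lookup xs j ≡ Vec.lookup ys j) → xs ≡ ys
  extensional {xs = xs} {ys} h = trans (sym (Vec.tabulate∘lookup xs)) (trans (Vec.tabulate-cong h) (Vec.tabulate∘lookup ys))

oneHot : ∀ m a (f : ℕ → Bool) → a ≤ m → (∀ b → b ≤ m → f b ≡ (b ≡ᵇ a)) →
         applyUpTo f (suc m) ≡ replicate a false ++ true ∷ replicate (m ∸ a) false
oneHot m zero f a≤m h = cong₂ _∷_ (h 0 z≤n) (zeros m (f ∘ suc) λ b b<m → h (suc b) b<m)
  where
  zeros : ∀ m g → (∀ b → b < m → g b ≡ false) → applyUpTo g m ≡ replicate m false
  zeros zero    g h = refl
  zeros (suc m) g h = cong₂ _∷_ (h 0 (s≤s z≤n)) (zeros m (g ∘ suc) λ b b<m → h (suc b) (s≤s b<m))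
oneHot (suc m) (suc a) f (s≤s a≤m) h =
  cong₂ _∷_ (h 0 z≤n) (oneHot m a (f ∘ suc) a≤m λ b b≤m → h (suc b) (s≤s b≤m))

applyUpTo-injective : {A : Set} (f g : ℕ → A) → ∀ m → applyUpTo f m ≡ applyUpTo g m → ∀ a → a < m → f a ≡ g a
applyUpTo-injective f g (suc m) e zero    _         = ∷-injectiveˡ e
applyUpTo-injective f g (suc m) e (suc a) (s≤s a<m) = applyUpTo-injective (f ∘ suc) (g ∘ suc) m (∷-injectiveʳ e) a a<m

1+n≤3^n : ∀ n → suc n ≤ 3 ^ n
1+n≤3^n n = ≤-trans (1+n≤2^n n) (^-monoˡ-≤ n (n≤1+n 2))

-- The colouring program

module Colouring (n Δ' : ℕ) (1≤n : 1 ≤ n) where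

  -- The two extra bits give `W` ≥ 3 even for n = 1, so the three places read by `copy` exist and
  -- `B` < `W`.
  Δ L W B : ℕ
  Δ = suc Δ'
  L = lg n
  W = L + 2
  B = lg (W ∸ 1)

  prepare choose instrs : List Kind
  prepare = coleVishkin (logStar n + 2) W ++ copy ∷ reductions 5
  choose  = replicate (suc Δ) init ++ replicate (3 ^ Δ ∸ suc Δ) greedy
  instrs  = prepare ++ choose

  P : Program (lg n) Δ
  P = Machine.program (lg n) Δ' W B instrs

  3≤W : 3 ≤ W
  3≤W = +-monoˡ-≤ 2 (s≤s z≤n)

  2≤W : 2 ≤ W
  2≤W = ≤-trans (n≤1+n 2) 3≤W

  W≤2^B : W ≤ 2 ^ B
  W≤2^B = w≤2^lg W

  B<W : B < W
  B<W = nextWidth-≤ 2≤W ≤-refl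

  -- A Cole-Vishkin step contributes its one `load`. The 2 + 10 fixed rounds appear as 11 because
  -- 3^Δ - (Δ + 1) is one less than 3^Δ - Δ.
  commCount-instrs : commCount instrs ≡ logStar n + (3 ^ Δ ∸ Δ) + 11
  commCount-instrs = begin
    commCount instrs
      ≡⟨ commCount-++ prepare choose ⟩
    commCount prepare + commCount choose
      ≡⟨ cong₂ _+_ (commCount-++ (coleVishkin N W) (copy ∷ reductions 5))
                   (trans (commCount-++ (replicate (suc Δ) init) (replicate (3 ^ Δ ∸ suc Δ) greedy))
                          (cong₂ _+_ (commCount-replicate (suc Δ) init) (commCount-replicate (3 ^ Δ ∸ suc Δ) greedy))) ⟩
    (commCount (coleVishkin N W) + 10) + (suc Δ * 0 + (3 ^ Δ ∸ suc Δ) * 1)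
      ≡⟨ cong₂ (λ a b → (a + 10) + (b + (3 ^ Δ ∸ suc Δ) * 1)) (cv N W) (*-zeroʳ (suc Δ)) ⟩
    (logStar n + 2 + 10) + (3 ^ Δ ∸ suc Δ) * 1
      ≡⟨ regroup (logStar n) (3 ^ Δ ∸ suc Δ) ⟩
    logStar n + suc (3 ^ Δ ∸ suc Δ) + 11
      ≡⟨ cong (λ x → logStar n + x + 11) (+-∸-assoc 1 (1+n≤3^n Δ)) ⟨
    logStar n + (3 ^ Δ ∸ Δ) + 11 ∎
    where
    open ≡-Reasoning
    N = logStar n + 2
    regroup : ∀ s x → (s + 2 + 10) + x * 1 ≡ s + suc x + 11
    regroup = solve-∀
    cv : ∀ m w → commCount (coleVishkin m w) ≡ m
    cv zero    w = refl
    cv (suc m) w = cong suc (trans (commCount-++ (replicate w scan) _)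
      (cong₂ _+_ (trans (commCount-replicate w scan) (*-zeroʳ w)) (cv m (nextWidth w))))

  module OnGraph (G : Graph n Δ) where

    open Machine (lg n) Δ' W B instrs using (M; program; diaIx; toℕ-diaIx; propOr⊥)
    open Run G program
    open Exec {W = W} {B} instrs G
    open Rules Δ W B
    open Dynamics Δ W B parentOf
    open ColeVishkin Δ W B parentOf W≤2^B B<W
    open SmallColours Δ W B parentOf

    parent⇒adj : ∀ {v u} i → parentOf v i ≡ just u → adj G v u ≡ true
    parent⇒adj {v} i e = bfilter-sound (adj G v) (allFin n) (nthMaybe-∈ (nbrs G v) (toℕ (diaIx i)) e)

    adj⇒parent : ∀ {v u} → adj G v u ≡ true → ∃ λ i → i < Δ × parentOf v i ≡ just u
    adj⇒parent {v} {u} h with ∈-nthMaybe (bfilter-complete (adj G v) (∈-allFin u) h)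
    ... | i , i< , e = i , i<Δ , trans (cong (nthMaybe (nbrs G v)) (toℕ-diaIx i<Δ)) e
      where
      i<Δ : i < Δ
      i<Δ = ≤-trans i< (maxDeg G v)

    adj⇒≢ : ∀ {v u} → adj G v u ≡ true → v ≢ u
    adj⇒≢ {v} h refl = true≢false (trans (sym h) (irrefl G v))

    open Greedy Δ W B parentOf (λ v u → adj G v u ≡ true) (λ {v} {u} h → trans (Graph.sym G u v) h) adj⇒parent

    initial-colour : ∀ i → i < Δ → (j : Fin (lg n)) → ∀ v → state 0 (colour i (toℕ j)) v ≡ val j v
    initial-colour i i<Δ j v = trans (headVal-zero (reg (colour i (toℕ j))) v (i<Δ , ≤-trans (toℕ<n j) (m≤m+n L 2))) at
      where
      at : Sem.eval G (λ _ _ → false) (propOr⊥ (toℕ j)) v ≡ val j v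
      at with toℕ j <? lg n
      ... | yes j<L = cong (λ k → val k v) (fromℕ<-toℕ j j<L)
      ... | no j≮L  = contradiction (toℕ<n j) j≮L

    coloured-0 : Coloured W (state 0)
    coloured-0 i i<Δ v = (λ j W≤j j<W → contradiction W≤j (<⇒≱ j<W)) , λ u p → apart u (val-separates (adj⇒≢ (parent⇒adj i p)))
      where
      apart : ∀ u → (∃ λ (j : Fin (lg n)) → val j v ≢ val j u) →
              ∃ λ j → j < W × state 0 (colour i j) v ≢ state 0 (colour i j) u
      apart u (j , ne) = toℕ j , ≤-trans (toℕ<n j) (m≤m+n L 2) , λ eq →
        ne (trans (sym (initial-colour i i<Δ j v)) (trans eq (initial-colour i i<Δ j u)))

    Fresh : State n → Set
    Fresh X = (∀ a → a ≤ Δ → ∀ v → X (ptr a) v ≡ (a ≡ᵇ 0)) × (∀ a → a ≤ Δ → ∀ v → X (final a) v ≡ false)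

    fresh-0 : Fresh (state 0)
    fresh-0 = (λ { zero h v → headVal-zero (reg (ptr 0)) v h ; (suc a) h v → headVal-zero (reg (ptr (suc a))) v h })
            , λ a h v → headVal-zero (reg (final a)) v h

    -- The invariant of the last phase starts from the initial `ptr` and `final` registers, so the
    -- earlier instructions must leave these alone.
    Preparing : Kind → Set
    Preparing κ = (∀ a → rule κ (ptr a) ≡ ref (ptr a)) × (∀ a → rule κ (final a) ≡ ref (final a))

    preparing : All Preparing prepare
    preparing = All.++⁺ (cv (logStar n + 2) W) (((λ _ → refl) , (λ _ → refl)) ∷ rd 5)
      where
      rd : ∀ m → All Preparing (reductions m)
      rd zero    = []
      rd (suc m) = ((λ _ → refl) , (λ _ → refl)) ∷ ((λ _ → refl) , (λ _ → refl)) ∷ rd m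
      cv : ∀ m w → All Preparing (coleVishkin m w)
      cv zero    w = []
      cv (suc m) w = ((λ _ → refl) , (λ _ → refl)) ∷ All.++⁺ (All.replicate⁺ w ((λ _ → refl) , (λ _ → refl))) (cv m (nextWidth w))

    fresh : ∀ {κs X Z} → All Preparing κs → Steps Step κs X Z → Fresh X → Fresh Z
    fresh [] [] f = f
    fresh ((p , q) ∷ ps) (s ∷ ss) (fp , ff) = fresh ps ss
      ( (λ a h v → trans (s (ptr a) h v) (trans (cong (λ e → ⟦ e ⟧ (env _ v)) (p a)) (fp a h v)))
      , (λ a h v → trans (s (final a) h v) (trans (cong (λ e → ⟦ e ⟧ (env _ v)) (q a)) (ff a h v))) )

    -- All places from 3 on vanish, so a difference has to show in the three copied bits.
    copied : ∀ {X Y w} → w ≤ 3 → Coloured w X → Step copy X Y → Small 8 Y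
    copied {X} {Y} w≤3 cl s i i<Δ v = num3-<8 (Y (small i 0) v) (Y (small i 1) v) (Y (small i 2) v) , λ u p eq → differ u (proj₂ (cl i i<Δ v) u p) (num3-injective eq)
      where
      c : ∀ t → t < 3 → ∀ x → X (colour i t) x ≡ Y (small i t) x
      c t h x = sym (s (small i t) (i<Δ , h) x)
      same : ∀ u {t} → t < 3 → Y (small i t) v ≡ Y (small i t) u → X (colour i t) v ≡ X (colour i t) u
      same u {t} h eq = trans (c t h v) (trans eq (sym (c t h u)))
      differ : ∀ u → (∃ λ j → j < W × X (colour i j) v ≢ X (colour i j) u) →
        (Y (small i 0) v ≡ Y (small i 0) u × Y (small i 1) v ≡ Y (small i 1) u × Y (small i 2) v ≡ Y (small i 2) u) → ⊥
      differ u (0 , _ , ne) (e , _ , _) = ne (same u 0<3 e)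
      differ u (1 , _ , ne) (_ , e , _) = ne (same u 1<3 e)
      differ u (2 , _ , ne) (_ , _ , e) = ne (same u 2<3 e)
      differ u (suc (suc (suc j)) , j<W , ne) _ = ne (trans (vanishes v) (sym (vanishes u)))
        where
        vanishes : ∀ x → X (colour i (3 + j)) x ≡ false
        vanishes x = proj₁ (cl i i<Δ x) (3 + j) (≤-trans w≤3 (m≤m+n 3 j)) j<W

    Chosen-M : Fin n → Set
    Chosen-M v = ∃ λ a → a ≤ Δ × (∀ b → b ≤ Δ → state M (final b) v ≡ (b ≡ᵇ a))

    Disjoint-M : Set
    Disjoint-M = ∀ {v u} → adj G v u ≡ true → ∀ a → a ≤ Δ → state M (final a) v ≡ true → state M (final a) u ≡ true → ⊥

    small-prepared : ∀ {X Z} → Coloured W X → Steps Step prepare X Z → Small 3 Z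
    small-prepared c ss with steps-++ (coleVishkin (logStar n + 2) W) ss
    ... | _ , ss₀ , (cp ∷ ss₁) = reductions-correct 5 (copied (width-logStar n 1≤n)
            (coleVishkin-correct (logStar n + 2) ≤-refl 2≤W c ss₀) cp) ss₁

    final-colouring : (∀ v → Chosen-M v) × Disjoint-M
    final-colouring = from (steps-++ prepare steps)
      where
      from : (∃ λ X → Steps Step prepare (state 0) X × Steps Step choose X (state M)) → (∀ v → Chosen-M v) × Disjoint-M
      from (X , ss₁ , ss₂) = Ranked.greedy-correct X (small-prepared coloured-0 ss₁) (1+n≤3^n Δ)
        (proj₁ (fresh preparing ss₁ fresh-0)) (proj₂ (fresh preparing ss₁ fresh-0)) ss₂

    output-at-M : ∀ v → output M v ≡ applyUpTo (λ a → state M (final a) v) (suc Δ)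
    output-at-M v = trans (output-final M v) (map-upTo (λ a → state M (final a) v) (suc Δ))

    coloured-output : ∀ v → IsColorString (suc Δ) (output M v)
    coloured-output v = from (proj₁ final-colouring v)
      where
      from : Chosen-M v → IsColorString (suc Δ) (output M v)
      from (a , a≤Δ , one) = a , Δ ∸ a , s≤s a≤Δ , trans (output-at-M v) (oneHot Δ a (λ a → state M (final a) v) a≤Δ one)

    proper-output : ∀ u v → adj G u v ≡ true → output M u ≡ output M v → ⊥
    proper-output u v e eq = from (proj₁ final-colouring u)
      where
      same : ∀ a → a < suc Δ → state M (final a) u ≡ state M (final a) v
      same = applyUpTo-injective (λ a → state M (final a) u) (λ a → state M (final a) v) (suc Δ)
               (trans (sym (output-at-M u)) (trans eq (output-at-M v)))
      from : Chosen-M u → ⊥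
      from (a , a≤Δ , one) = proj₂ final-colouring e a a≤Δ lit (trans (sym (same a (s≤s a≤Δ))) lit)
        where
        lit : state M (final a) u ≡ true
        lit = trans (one a a≤Δ) (≡ᵇ-refl a)

    proper-outputs : ∀ u v r r' → adj G u v ≡ true → OutputsAt r u → OutputsAt r' v → output r u ≡ output r' v → ⊥
    proper-outputs u v r r' e (hu , _) (hv , _) eq = proper-output u v e
      (subst₂ (λ r r' → output r u ≡ output r' v) (attentive⇒last r u hu) (attentive⇒last r' v hv) eq)

  colours : ∀ {R} → length instrs ≤ R → ColorsProperlyWithin n Δ P R
  colours M≤R G = (λ w → length instrs , outputsAt-last w , coloured-output w , M≤R) , proper-outputs
    where
    open OnGraph G
    open Exec {W = W} {B} instrs G

  communication : ExactlyGCR n Δ P (logStar n + (3 ^ Δ ∸ Δ) + 11)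
  communication G = length instrs , gcr-after , trans (gcrCount-instrs (fromℕ< 1≤n) (≤-trans (s≤s z≤n) 2≤W)) commCount-instrs
    where open Exec {W = W} {B} instrs G

-- Sizes

≤-lit : ∀ {m n} {_ : T (m ≤ᵇ n)} → m ≤ n
≤-lit {m} {n} {h} = ≤ᵇ⇒≤ m n h

-- Atoms compile to schemata of size at most 2.
tableSize : ℕ → ℕ
tableSize zero    = 2
tableSize (suc m) = 11 + 2 * tableSize m

exprSize : {A : Set} → Expr A → ℕ
exprSize (table {m} as f) = tableSize m
exprSize (¬ₑ e)           = suc (exprSize e)
exprSize (e ∧ₑ e')        = suc (exprSize e + exprSize e')

exprSize-allₑ : {A : Set} {s : ℕ} (m : ℕ) (f : ℕ → Expr A) → (∀ i → exprSize (f i) ≡ s) →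
                exprSize (allₑ m f) ≡ m * suc s + 2
exprSize-allₑ zero    f h = refl
exprSize-allₑ {s = s} (suc m) f h = trans (cong₂ (λ a b → suc (a + b)) (h m) (exprSize-allₑ m f h)) (sym (+-assoc (suc s) (m * suc s) 2))

exprSize-anyₑ : {A : Set} {s : ℕ} (m : ℕ) (f : ℕ → Expr A) → (∀ i → exprSize (f i) ≡ s) →
                exprSize (anyₑ m f) ≡ suc (m * suc (suc s) + 2)
exprSize-anyₑ m f h = cong suc (exprSize-allₑ m (λ i → ¬ₑ f i) (λ i → cong suc (h i)))

module _ {L k Δ : ℕ} {A : Set} (atm : A → Sch L k Δ) (atm≤2 : ∀ a → sizeSch (atm a) ≤ 2) where

  sizeSch-iteS : (a s s' : Sch L k Δ) → sizeSch (iteS a s s') ≡ 7 + 2 * sizeSch a + (sizeSch s + sizeSch s')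
  sizeSch-iteS a s s' = eq (sizeSch a) (sizeSch s) (sizeSch s')
    where
    eq : ∀ a s s' → suc (suc (suc (suc (a + s)) + suc (suc (suc a + s')))) ≡ 7 + 2 * a + (s + s')
    eq = solve-∀

  size-compile : ∀ e → sizeSch (compile atm e) ≤ exprSize e
  size-compile (table as f) = go as f
    where
    go : ∀ {m} (as : Vec A m) f → sizeSch (tableS atm as f) ≤ tableSize m
    go []       f with f []
    ... | true  = s≤s z≤n
    ... | false = ≤-refl
    go {suc m} (a ∷ as) f = begin
      sizeSch (tableS atm (a ∷ as) f)                ≡⟨ sizeSch-iteS (atm a) (tableS atm as (f ∘ (true ∷_))) (tableS atm as (f ∘ (false ∷_))) ⟩
      7 + 2 * sizeSch (atm a) + (sizeSch (tableS atm as (f ∘ (true ∷_))) + sizeSch (tableS atm as (f ∘ (false ∷_))))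
                 ≤⟨ +-mono-≤ (+-monoʳ-≤ 7 (*-monoʳ-≤ 2 (atm≤2 a))) (+-mono-≤ (go as (f ∘ (true ∷_))) (go as (f ∘ (false ∷_)))) ⟩
      11 + (tableSize m + tableSize m)               ≡⟨ cong (λ x → 11 + (tableSize m + x)) (+-identityʳ (tableSize m)) ⟨
      tableSize (suc m)                              ∎
      where open ≤-Reasoning
  size-compile (¬ₑ e)    = s≤s (size-compile e)
  size-compile (e ∧ₑ e') = s≤s (+-mono-≤ (size-compile e) (size-compile e'))

-- The largest table has nine inputs.
module RuleSizes (Δ W B c : ℕ) (tableSize9≤c : tableSize 9 ≤ c) where
  open Rules Δ W B

  -- The order of magnitude of the clause: a carry into digit i inspects all lower digits, and
  -- `leastFree a` asks for a + 1 colours at Δ neighbours. The remaining rules have bounded size.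
  weight : Reg → ℕ
  weight (count b)   = suc b
  weight (small i t) = suc i
  weight (final a)   = suc a * suc Δ
  weight _           = 1

  weight-pos : ∀ d → 1 ≤ weight d
  weight-pos (count b)    = s≤s z≤n
  weight-pos (found i)    = s≤s z≤n
  weight-pos (final a)    = s≤s z≤n
  weight-pos (ptr a)      = s≤s z≤n
  weight-pos (mine i j)   = s≤s z≤n
  weight-pos (parent i j) = s≤s z≤n
  weight-pos (colour i j) = s≤s z≤n
  weight-pos (small i t)  = s≤s z≤n
  weight-pos (prev i t)   = s≤s z≤n

  Light : {A : Set} → Expr A → Reg → Set
  Light e d = exprSize e ≤ c * weight d

  const : ∀ {x} d → x ≤ tableSize 9 → x ≤ c * weight d
  const d h = ≤-trans h (≤-trans tableSize9≤c (m≤m*n c (weight d) {{>-nonZero (weight-pos d)}}))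

  private
    -- The summand y is the difference of the two sides, which turns an inequality of polynomials
    -- into an identity.
    slack : ∀ {x y w} a → a ≤ tableSize 9 → x + y ≡ a * w → x ≤ c * w
    slack {x} {y} {w} a a≤ e = ≤-trans (m≤m+n x y) (≤-trans (≤-reflexive e) (*-monoˡ-≤ w (≤-trans a≤ tableSize9≤c)))

  counter : ∀ b → Light (rule scan (count b)) (count b)
  -- Here and below, 15 = `tableSize 1` is the cost of one register and 93 = `tableSize 3` that of a
  -- digit.
  counter b rewrite exprSize-allₑ {s = 15} b (λ a → ref {false} (count a)) (λ _ → refl) = slack 42 ≤-lit (eq b)
    where
    eq : ∀ b → suc (suc (suc (suc (b * 16 + 2 + 16)) + suc (suc (suc (b * 16 + 2) + 15)))) + 10 * b ≡ 42 * suc b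
    eq = solve-∀

  ticking : ∀ {b} i t → Light (tick {b} i t) (small i t)
  ticking {b} i t rewrite exprSize-allₑ {s = 93} i (digit {b} (_≡ᵇ 2)) (λ _ → refl) = slack 188 ≤-lit (eq i)
    where
    eq : ∀ i → suc (suc (suc (suc (i * 94 + 2 + 93)) + suc (suc (suc (i * 94 + 2) + 15)))) + 69 ≡ 188 * suc i
    eq = solve-∀

  starting : ∀ a → Light (rule init (final a)) (final a)
  starting a rewrite exprSize-allₑ {s = 93} Δ (digit {false} (_≡ᵇ 2)) (λ _ → refl) = slack 94 ≤-lit (eq a Δ)
    where
    eq : ∀ a Δ → suc (suc (suc (suc (15 + (Δ * 94 + 2))) + 16)) + (94 * a * suc Δ + 57) ≡ 94 * (suc a * suc Δ)
    eq = solve-∀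

  choosing : ∀ a → Light (rule greedy (final a)) (final a)
  choosing a
    rewrite exprSize-allₑ {s = 93} Δ (digit {true} (_≡ᵇ 2)) (λ _ → refl)
          | exprSize-allₑ {s = suc (Δ * 17 + 2)} a nbrHas (λ _ → exprSize-anyₑ Δ _ (λ _ → refl))
          | exprSize-allₑ {s = 16} Δ (λ i → ¬ₑ table (nbr i (final a) ∷ []) Data.Vec.head) (λ _ → refl) = slack 120 ≤-lit (eq a Δ)
    where
    eq : ∀ a Δ → suc (suc (suc (suc (suc (suc (suc (Δ * 17 + 2)) + (a * suc (suc (Δ * 17 + 2)) + 2)) + (Δ * 94 + 2))) + 16))
                 + (9 * Δ + 91 + 116 * a + 103 * a * Δ) ≡ 120 * (suc a * suc Δ)
    eq = solve-∀

  recording : ∀ i j → Light (rule scan (colour i (suc j))) (colour i (suc j))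
  recording i j with j <ᵇ B
  ... | true  = const (colour i (suc j)) ≤-lit
  ... | false = const (colour i (suc j)) ≤-lit

  rule-size : ∀ κ d → Light (rule κ d) d
  rule-size load (count b) = const (count b) ≤-lit
  rule-size load (found i) = const (found i) ≤-lit
  rule-size load (final a) = const (final a) ≤-lit
  rule-size load (ptr a) = const (ptr a) ≤-lit
  rule-size load (mine i j) = const (mine i j) ≤-lit
  rule-size load (parent i j) = const (parent i j) ≤-lit
  rule-size load (colour i j) = const (colour i j) ≤-lit
  rule-size load (small i t) = const (small i t) ≤-lit
  rule-size load (prev i t) = const (prev i t) ≤-lit
  rule-size scan (count b) = counter b
  rule-size scan (found i) = const (found i) ≤-lit
  rule-size scan (final a) = const (final a) ≤-lit
  rule-size scan (ptr a) = const (ptr a) ≤-lit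
  rule-size scan (mine i j) = const (mine i j) ≤-lit
  rule-size scan (parent i j) = const (parent i j) ≤-lit
  rule-size scan (colour i zero) = const (colour i zero) ≤-lit
  rule-size scan (colour i (suc j)) = recording i j
  rule-size scan (small i t) = const (small i t) ≤-lit
  rule-size scan (prev i t) = const (prev i t) ≤-lit
  rule-size copy (count b) = const (count b) ≤-lit
  rule-size copy (found i) = const (found i) ≤-lit
  rule-size copy (final a) = const (final a) ≤-lit
  rule-size copy (ptr a) = const (ptr a) ≤-lit
  rule-size copy (mine i j) = const (mine i j) ≤-lit
  rule-size copy (parent i j) = const (parent i j) ≤-lit
  rule-size copy (colour i j) = const (colour i j) ≤-lit
  rule-size copy (small i t) = const (small i t) ≤-lit
  rule-size copy (prev i t) = const (prev i t) ≤-lit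
  rule-size shift (count b) = const (count b) ≤-lit
  rule-size shift (found i) = const (found i) ≤-lit
  rule-size shift (final a) = const (final a) ≤-lit
  rule-size shift (ptr a) = const (ptr a) ≤-lit
  rule-size shift (mine i j) = const (mine i j) ≤-lit
  rule-size shift (parent i j) = const (parent i j) ≤-lit
  rule-size shift (colour i j) = const (colour i j) ≤-lit
  rule-size shift (small i t) = const (small i t) ≤-lit
  rule-size shift (prev i t) = const (prev i t) ≤-lit
  rule-size reduce (count b) = const (count b) ≤-lit
  rule-size reduce (found i) = const (found i) ≤-lit
  rule-size reduce (final a) = const (final a) ≤-lit
  rule-size reduce (ptr a) = const (ptr a) ≤-lit
  rule-size reduce (mine i j) = const (mine i j) ≤-lit
  rule-size reduce (parent i j) = const (parent i j) ≤-lit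
  rule-size reduce (colour i j) = const (colour i j) ≤-lit
  rule-size reduce (small i t) = const (small i t) ≤-lit
  rule-size reduce (prev i t) = const (prev i t) ≤-lit
  rule-size init (count b) = const (count b) ≤-lit
  rule-size init (found i) = const (found i) ≤-lit
  rule-size init (final a) = starting a
  rule-size init (ptr zero) = const (ptr zero) ≤-lit
  rule-size init (ptr (suc a)) = const (ptr (suc a)) ≤-lit
  rule-size init (mine i j) = const (mine i j) ≤-lit
  rule-size init (parent i j) = const (parent i j) ≤-lit
  rule-size init (colour i j) = const (colour i j) ≤-lit
  rule-size init (small i t) = ticking i t
  rule-size init (prev i t) = const (prev i t) ≤-lit
  rule-size greedy (count b) = const (count b) ≤-lit
  rule-size greedy (found i) = const (found i) ≤-lit
  rule-size greedy (final a) = choosing a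
  rule-size greedy (ptr a) = const (ptr a) ≤-lit
  rule-size greedy (mine i j) = const (mine i j) ≤-lit
  rule-size greedy (parent i j) = const (parent i j) ≤-lit
  rule-size greedy (colour i j) = const (colour i j) ≤-lit
  rule-size greedy (small i t) = ticking i t
  rule-size greedy (prev i t) = const (prev i t) ≤-lit

sum-≤ : {A : Set} (f : A → ℕ) {b : ℕ} {xs : List A} → (∀ {x} → x ∈ xs → f x ≤ b) → sum (map f xs) ≤ length xs * b
sum-≤ f {xs = []}     h = z≤n
sum-≤ f {xs = x ∷ xs} h = +-mono-≤ (h (here refl)) (sum-≤ f (h ∘ there))

data SumBound {A : Set} (f : A → ℕ) : List (List A) → ℕ → Set where
  []  : SumBound f [] 0
  _∷_ : ∀ {xs xss a b} → sum (map f xs) ≤ a → SumBound f xss b → SumBound f (xs ∷ xss) (a + b)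

sumBound-sound : {A : Set} (f : A → ℕ) (xss : List (List A)) → ∀ {b} → SumBound f xss b → sum (map f (concat xss)) ≤ b
sumBound-sound f []         []       = z≤n
sumBound-sound f (xs ∷ xss) (h ∷ hs) = ≤-trans
  (≤-reflexive (trans (cong sum (map-++ f xs (concat xss))) (sum-++ (map f xs) (map f (concat xss)))))
  (+-mono-≤ h (sumBound-sound f xss hs))

-- Sums over all heads

module Totals {L Δ' W B : ℕ} (instrs : List Kind) where

  open Machine L Δ' W B instrs

  sumFin-heads : ∀ f → sumFin K (f ∘ lookup heads) ≡ sum (map f heads)
  sumFin-heads f = cong sum (trans (map-∘ (allFin K)) (cong (map f) (map-lookup-allFin heads)))

  heads-sum : ∀ f {bᶠ bᶜ bᵏ bᵇ b bˢ} →
    (∀ a → a ≤ Δ → f (reg (final a)) ≤ bᶠ) → (∀ t → f (clk t) ≤ bᶜ) → (∀ κ → f (kin κ) ≤ bᵏ) →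
    (∀ a → a < B → f (reg (count a)) ≤ bᵇ) →
    (∀ i → f (reg (found i)) ≤ b) → (∀ a → f (reg (ptr a)) ≤ b) →
    (∀ i j → f (reg (mine i j)) ≤ b) → (∀ i j → f (reg (parent i j)) ≤ b) → (∀ i j → f (reg (colour i j)) ≤ b) →
    (∀ i t → i < Δ → f (reg (small i t)) ≤ bˢ) → (∀ i t → f (reg (prev i t)) ≤ b) →
    sum (map f heads) ≤ suc Δ * bᶠ + (suc M * bᶜ + (7 * bᵏ + (B * bᵇ + (Δ * b + (suc Δ * b +
      (Δ * (W * b) + (Δ * (W * b) + (Δ * (W * b) + (Δ * (3 * bˢ) + (Δ * (3 * b) + 0))))))))))
  heads-sum f hᶠ hᶜ hᵏ hᵇ hf hp hm hq hc hˢ ho = sumBound-sound f groups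
    ( row (suc Δ) (reg ∘ final) (λ a a< → hᶠ a (≤-pred a<))
    ∷ row (suc M) clk (λ t _ → hᶜ t)
    ∷ list kinds kin hᵏ
    ∷ row B (reg ∘ count) hᵇ
    ∷ row Δ (reg ∘ found) (λ i _ → hf i)
    ∷ row (suc Δ) (reg ∘ ptr) (λ a _ → hp a)
    ∷ grid W (λ i j → reg (mine i j)) (λ i j _ → hm i j)
    ∷ grid W (λ i j → reg (parent i j)) (λ i j _ → hq i j)
    ∷ grid W (λ i j → reg (colour i j)) (λ i j _ → hc i j)
    ∷ grid 3 (λ i j → reg (small i j)) hˢ
    ∷ grid 3 (λ i j → reg (prev i j)) (λ i j _ → ho i j)
    ∷ [])
    where
    list : ∀ {A : Set} (xs : List A) (h : A → Head) {b} → (∀ x → f (h x) ≤ b) → sum (map f (map h xs)) ≤ length xs * b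
    list xs h hb = subst (λ l → sum l ≤ _) (map-∘ xs) (sum-≤ (f ∘ h) {xs = xs} (λ {x} _ → hb x))
    row : ∀ m (h : ℕ → Head) {b} → (∀ i → i < m → f (h i) ≤ b) → sum (map f (map h (upTo m))) ≤ m * b
    row m h {b} hb = subst₂ (λ l k → sum l ≤ k * b) (map-∘ (upTo m)) (length-upTo m)
      (sum-≤ (f ∘ h) (λ {i} i∈ → hb i (∈-upTo⁻ i∈)))
    rows : ∀ is w (h : ℕ → ℕ → Head) {b} → (∀ i j → i ∈ is → f (h i j) ≤ b) →
           sum (map f (cartesianProductWith h is (upTo w))) ≤ length is * (w * b)
    rows []       w h hb = z≤n
    rows (i ∷ is) w h hb = ≤-trans
      (≤-reflexive (trans (cong sum (map-++ f (map (h i) (upTo w)) _)) (sum-++ (map f (map (h i) (upTo w))) _)))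
      (+-mono-≤ (row w (h i) (λ j _ → hb i j (here refl))) (rows is w h (λ i j i∈ → hb i j (there i∈))))
    grid : ∀ w (h : ℕ → ℕ → Head) {b} → (∀ i j → i < Δ → f (h i j) ≤ b) →
           sum (map f (cartesianProductWith h (upTo Δ) (upTo w))) ≤ Δ * (w * b)
    grid w h {b} hb = subst (λ k → sum (map f (cartesianProductWith h (upTo Δ) (upTo w))) ≤ k * (w * b)) (length-upTo Δ) (rows (upTo Δ) w h (λ i j i∈ → hb i j (∈-upTo⁻ i∈)))

  length-as-sum : {A : Set} (xs : List A) → length xs ≡ sum (map (λ _ → 1) xs)
  length-as-sum []       = refl
  length-as-sum (x ∷ xs) = cong suc (length-as-sum xs)

  K-≤ : K ≤ suc Δ * 1 + (suc M * 1 + (7 * 1 + (B * 1 + (Δ * 1 + (suc Δ * 1 +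
      (Δ * (W * 1) + (Δ * (W * 1) + (Δ * (W * 1) + (Δ * (3 * 1) + (Δ * (3 * 1) + 0))))))))))
  K-≤ = ≤-trans (≤-reflexive (length-as-sum heads)) (heads-sum (λ _ → 1)
    (λ _ _ → ≤-refl) (λ _ → ≤-refl) (λ _ → ≤-refl) (λ _ _ → ≤-refl) (λ _ → ≤-refl) (λ _ → ≤-refl)
    (λ _ _ → ≤-refl) (λ _ _ → ≤-refl) (λ _ _ → ≤-refl) (λ _ _ _ → ≤-refl) (λ _ _ → ≤-refl))

  termSize clauseSize : Head → ℕ
  termSize h   = suc (sizeSch (termOf h))
  clauseSize h = suc (sizeClause (clauseOf h))

  termSize-≤ : ∀ h → termSize h ≤ 3
  termSize-≤ (clk zero)    = ≤-lit
  termSize-≤ (clk (suc t)) = ≤-lit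
  termSize-≤ (kin κ) with nthMaybe instrs 0 == κ
  ... | true  = ≤-lit
  ... | false = ≤-lit
  termSize-≤ (reg (count b))     = ≤-lit
  termSize-≤ (reg (found i))     = ≤-lit
  termSize-≤ (reg (final a))     = ≤-lit
  termSize-≤ (reg (ptr zero))    = ≤-lit
  termSize-≤ (reg (ptr (suc a))) = ≤-lit
  termSize-≤ (reg (mine i j))    = ≤-lit
  termSize-≤ (reg (parent i j))  = ≤-lit
  termSize-≤ (reg (colour i j)) with j <? L
  ... | yes _ = ≤-lit
  ... | no _  = ≤-lit
  termSize-≤ (reg (small i t))   = ≤-lit
  termSize-≤ (reg (prev i t))    = ≤-lit

  module _ {c q : ℕ} (tableSize9≤c : tableSize 9 ≤ c) (9+7c≤q : 9 + 7 * c ≤ q) where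

    open RuleSizes Δ W B c tableSize9≤c

    clkSize-≤ : ∀ t → clauseSize (clk t) ≤ 3
    clkSize-≤ zero    = ≤-lit
    clkSize-≤ (suc t) = ≤-lit

    -- Decoding runs over the whole clock. There are only seven such clauses, and the clock heads
    -- have clauses of constant size, so the total stays linear in `M`.
    kinSize-≤ : ∀ κ → clauseSize (kin κ) ≤ 17 * suc M
    kinSize-≤ κ = begin
      suc (sizeSch (compile v (decodeKind κ)))  ≤⟨ s≤s (size-compile v (λ _ → s≤s z≤n) (decodeKind κ)) ⟩
      suc (exprSize (decodeKind κ))             ≡⟨ cong suc (exprSize-anyₑ M (kindAt κ) (λ _ → refl)) ⟩
      suc (suc (M * 17 + 2))                    ≤⟨ m≤m+n _ 13 ⟩
      suc (suc (M * 17 + 2)) + 13               ≡⟨ eq M ⟩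
      17 * suc M                                ∎
      where
      open ≤-Reasoning
      eq : ∀ m → suc (suc (m * 17 + 2)) + 13 ≡ 17 * suc m
      eq = solve-∀

    -- Seven branches of size at most `c` per unit of weight, plus 9 symbols: seven conditions, the
    -- backup and the head itself.
    regSize-≤ : ∀ d → clauseSize (reg d) ≤ q * weight d
    regSize-≤ d = begin
      clauseSize (reg d)
        ≤⟨ s≤s (+-monoˡ-≤ 1 (r load (r scan (r copy (r shift (r reduce (r init (r greedy z≤n)))))))) ⟩
      suc (suc x + (suc x + (suc x + (suc x + (suc x + (suc x + (suc x + 0)))))) + 1)  ≡⟨ eq x ⟩
      9 * 1 + 7 * x                                  ≤⟨ +-monoˡ-≤ (7 * x) (*-monoʳ-≤ 9 (weight-pos d)) ⟩
      9 * weight d + 7 * x                           ≡⟨ cong (9 * weight d +_) (*-assoc 7 c (weight d)) ⟨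
      9 * weight d + 7 * c * weight d                ≡⟨ *-distribʳ-+ (weight d) 9 (7 * c) ⟨
      (9 + 7 * c) * weight d                         ≤⟨ *-monoˡ-≤ (weight d) 9+7c≤q ⟩
      q * weight d                                   ∎
      where
      open ≤-Reasoning
      x = c * weight d
      atom-≤ : ∀ {b} (a : Atom b) → sizeSch (atom a) ≤ 2
      atom-≤ (own _)   = s≤s z≤n
      atom-≤ (nbr _ _) = ≤-refl
      atom-≤ (has _)   = ≤-refl
      r : ∀ κ {s t} → s ≤ t → suc (sizeSch (ruleS κ d)) + s ≤ suc x + t
      r κ = +-mono-≤ (s≤s (≤-trans (size-compile atom atom-≤ (rule κ d)) (rule-size κ d)))
      eq : ∀ x → suc (suc x + (suc x + (suc x + (suc x + (suc x + (suc x + (suc x + 0)))))) + 1) ≡ 9 * 1 + 7 * x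
      eq = solve-∀

    unitSize-≤ : ∀ d → weight d ≡ 1 → clauseSize (reg d) ≤ q
    unitSize-≤ d e = ≤-trans (regSize-≤ d) (≤-reflexive (trans (cong (q *_) e) (*-identityʳ q)))

    progSize-≤ : progSize program ≤ K * 3 +
      (suc Δ * (q * (suc Δ * suc Δ)) + (suc M * 3 + (7 * (17 * suc M) + (B * (q * B) + (Δ * q + (suc Δ * q +
      (Δ * (W * q) + (Δ * (W * q) + (Δ * (W * q) + (Δ * (3 * (q * Δ)) + (Δ * (3 * q) + 0)))))))))))
    progSize-≤ = ≤-trans (≤-reflexive (cong₂ _+_ (sumFin-heads termSize) (sumFin-heads clauseSize)))
      (+-mono-≤ (sum-≤ termSize {xs = heads} (λ {h} _ → termSize-≤ h))
        (heads-sum clauseSize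
          (λ a a≤Δ → ≤-trans (regSize-≤ (final a)) (*-monoʳ-≤ q (*-monoˡ-≤ (suc Δ) (s≤s a≤Δ))))
          clkSize-≤ kinSize-≤
          (λ b b<B → ≤-trans (regSize-≤ (count b)) (*-monoʳ-≤ q b<B))
          (λ i → unitSize-≤ (found i) refl) (λ a → unitSize-≤ (ptr a) refl)
          (λ i j → unitSize-≤ (mine i j) refl) (λ i j → unitSize-≤ (parent i j) refl) (λ i j → unitSize-≤ (colour i j) refl)
          (λ i t i<Δ → ≤-trans (regSize-≤ (small i t)) (*-monoʳ-≤ q i<Δ))
          (λ i t → unitSize-≤ (prev i t) refl)))

-- Asymptotic bounds

-- The bound reproduces itself: twice the next width is at most w + 5, and this 5 with the `load`
-- makes up the 6 per phase.
length-coleVishkin : ∀ m w → length (coleVishkin m w) ≤ 2 * w + 6 * m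
length-coleVishkin zero    w = z≤n
length-coleVishkin (suc m) w = begin
  suc (length (replicate w scan ++ coleVishkin m w'))  ≡⟨ cong suc (trans (length-++ (replicate w scan)) (cong (_+ length (coleVishkin m w')) (length-replicate w))) ⟩
  suc (w + length (coleVishkin m w'))                  ≤⟨ s≤s (+-monoʳ-≤ w (length-coleVishkin m w')) ⟩
  suc (w + (2 * w' + 6 * m))                           ≤⟨ s≤s (+-monoʳ-≤ w (+-monoˡ-≤ (6 * m) (nextWidth-half w))) ⟩
  suc (w + (w + 5 + 6 * m))                            ≡⟨ eq w m ⟩
  2 * w + 6 * suc m                                    ∎
  where
  open ≤-Reasoning
  w' = nextWidth w
  eq : ∀ w m → suc (w + (w + 5 + 6 * m)) ≡ 2 * w + 6 * suc m
  eq = solve-∀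

square-≤2^ : ∀ b → suc b * suc b ≤ 4 * 2 ^ b
square-≤2^ zero    = s≤s z≤n
square-≤2^ (suc b) = begin
  suc (suc b) * suc (suc b)          ≤⟨ m≤m+n _ (2 * b + 1) ⟩
  suc (suc b) * suc (suc b) + (2 * b + 1) ≡⟨ eq b ⟩
  suc b * suc b + 4 * suc b          ≤⟨ +-mono-≤ (square-≤2^ b) (*-monoʳ-≤ 4 (1+n≤2^n b)) ⟩
  4 * 2 ^ b + 4 * 2 ^ b              ≡⟨ eq' (2 ^ b) ⟩
  4 * 2 ^ suc b                      ∎
  where
  open ≤-Reasoning
  eq : ∀ b → suc (suc b) * suc (suc b) + (2 * b + 1) ≡ suc b * suc b + 4 * suc b
  eq = solve-∀
  eq' : ∀ x → 4 * x + 4 * x ≡ 4 * (2 * x)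
  eq' = solve-∀

square-≤3^ : ∀ x → suc x * suc x ≤ 2 * 3 ^ x
square-≤3^ zero    = s≤s z≤n
square-≤3^ (suc x) = begin
  suc (suc x) * suc (suc x)             ≡⟨ eq x ⟩
  suc x * suc x + 2 * suc x + 1         ≤⟨ +-mono-≤ (+-mono-≤ (square-≤3^ x) (*-monoʳ-≤ 2 (1+n≤3^n x))) (m^n>0 3 x) ⟩
  2 * 3 ^ x + 2 * 3 ^ x + 3 ^ x         ≤⟨ m≤m+n _ (3 ^ x) ⟩
  2 * 3 ^ x + 2 * 3 ^ x + 3 ^ x + 3 ^ x ≡⟨ eq' (3 ^ x) ⟩
  2 * 3 ^ suc x                         ∎
  where
  open ≤-Reasoning
  eq : ∀ x → suc (suc x) * suc (suc x) ≡ suc x * suc x + 2 * suc x + 1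
  eq = solve-∀
  eq' : ∀ t → 2 * t + 2 * t + t + t ≡ 2 * (3 * t)
  eq' = solve-∀

-- The `final` clauses together have size of order (Δ + 1)³, which this puts under the term 3^Δ.
cube-≤3^ : ∀ x → suc x * (suc x * suc x) ≤ 5 * 3 ^ x
cube-≤3^ zero    = s≤s z≤n
cube-≤3^ (suc x) = begin
  suc (suc x) * (suc (suc x) * suc (suc x))                         ≡⟨ eq x ⟩
  suc x * (suc x * suc x) + 3 * (suc x * suc x) + 3 * suc x + 1     ≤⟨ +-mono-≤ (+-mono-≤ (+-mono-≤ (cube-≤3^ x) (*-monoʳ-≤ 3 (square-≤3^ x))) (*-monoʳ-≤ 3 (1+n≤3^n x))) (m^n>0 3 x) ⟩
  5 * 3 ^ x + 3 * (2 * 3 ^ x) + 3 * 3 ^ x + 3 ^ x                   ≡⟨ eq' (3 ^ x) ⟩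
  5 * 3 ^ suc x                                                     ∎
  where
  open ≤-Reasoning
  eq : ∀ x → suc (suc x) * (suc (suc x) * suc (suc x)) ≡ suc x * (suc x * suc x) + 3 * (suc x * suc x) + 3 * suc x + 1
  eq = solve-∀
  eq' : ∀ t → 5 * t + 3 * (2 * t) + 3 * t + t ≡ 5 * (3 * t)
  eq' = solve-∀

headSum : (Δ W B M : ℕ) → ℕ
headSum Δ W B M = suc Δ * 1 + (suc M * 1 + (7 * 1 + (B * 1 + (Δ * 1 + (suc Δ * 1 +
  (Δ * (W * 1) + (Δ * (W * 1) + (Δ * (W * 1) + (Δ * (3 * 1) + (Δ * (3 * 1) + 0))))))))))

sizeSum : (Δ W B M q : ℕ) → ℕ
sizeSum Δ W B M q = suc Δ * (q * (suc Δ * suc Δ)) + (suc M * 3 + (7 * (17 * suc M) + (B * (q * B) + (Δ * q + (suc Δ * q +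
  (Δ * (W * q) + (Δ * (W * q) + (Δ * (W * q) + (Δ * (3 * (q * Δ)) + (Δ * (3 * q) + 0))))))))))

sizeFactor : ℕ → ℕ
sizeFactor q = 3 * 65 + (q * 5 + (3 * 37 + (7 * (17 * 37) + (q * 8 + (q * 1 + (q * 1 +
  (q * 3 + (q * 3 + (q * 3 + (3 * (q * 2) + (3 * (q * 1) + 0)))))))))))

-- Any V that dominates both Δ·L and 3^Δ can serve as the unit. It is Δ·L + 3^Δ for the number of
-- heads and Δ²·L + 3^Δ for the size.
module Totalling {V Δ L W B M : ℕ} (1≤Δ : 1 ≤ Δ) (1≤L : 1 ≤ L) (ΔL≤V : Δ * L ≤ V) (3^Δ≤V : 3 ^ Δ ≤ V)
               (W≤3L : W ≤ 3 * L) (B≤W : B ≤ W) (B²≤8L : B * B ≤ 8 * L) (M-≤ : M ≤ 35 * L + 3 ^ Δ) where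

  infixr 5 _⊕_
  infixr 6 _⊗_

  -- A record, so that x and a can be inferred from the type.
  record _≤V*_ (x a : ℕ) : Set where
    constructor within
    field bound : x ≤ a * V
  open _≤V*_

  _⊕_ : ∀ {x y a b} → x ≤V* a → y ≤V* b → (x + y) ≤V* (a + b)
  _⊕_ {a = a} {b} (within h) (within h') = within (≤-trans (+-mono-≤ h h') (≤-reflexive (sym (*-distribʳ-+ V a b))))

  _⊗_ : ∀ {x a} y → x ≤V* a → (y * x) ≤V* (y * a)
  _⊗_ {a = a} y (within h) = within (≤-trans (*-monoʳ-≤ y h) (≤-reflexive (sym (*-assoc y a V))))

  ≤-within : ∀ {x y a} → x ≤ y → y ≤V* a → x ≤V* a
  ≤-within h (within h') = within (≤-trans h h')

  once : ∀ {x} → x ≤ V → x ≤V* 1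
  once h = within (≤-trans h (≤-reflexive (sym (*-identityˡ V))))

  times : ∀ a {x} → x ≤ V → (a * x) ≤V* a
  times a h = within (*-monoʳ-≤ a h)

  L≤V : L ≤ V
  L≤V = ≤-trans (m≤n*m L Δ {{>-nonZero 1≤Δ}}) ΔL≤V

  1≤V : 1 ≤ V
  1≤V = ≤-trans 1≤L L≤V

  1+Δ≤ : suc Δ ≤V* 1
  1+Δ≤ = once (≤-trans (1+n≤3^n Δ) 3^Δ≤V)

  Δ≤ : Δ ≤V* 1
  Δ≤ = ≤-within (n≤1+n Δ) 1+Δ≤

  1+M≤ : suc M ≤V* 37
  -- 37 = 1 + 35 + 1, for the successor, 35·L and 3^Δ.
  1+M≤ = ≤-within (s≤s M-≤) (once 1≤V ⊕ times 35 L≤V ⊕ once 3^Δ≤V)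

  ΔW≤ : (Δ * W) ≤V* 3
  ΔW≤ = ≤-within (≤-trans (*-monoʳ-≤ Δ W≤3L) (≤-reflexive (eq Δ L))) (times 3 ΔL≤V)
    where
    eq : ∀ d l → d * (3 * l) ≡ 3 * (d * l)
    eq = solve-∀

  B≤ : B ≤V* 3
  B≤ = ≤-within (≤-trans B≤W W≤3L) (times 3 L≤V)

  BB≤ : (B * B) ≤V* 8
  BB≤ = ≤-within B²≤8L (times 8 L≤V)

  ΔΔ≤ : (Δ * Δ) ≤V* 2
  ΔΔ≤ = ≤-within (≤-trans (*-mono-≤ (n≤1+n Δ) (n≤1+n Δ)) (square-≤3^ Δ)) (times 2 3^Δ≤V)

  cubed : (suc Δ * (suc Δ * suc Δ)) ≤V* 5
  cubed = ≤-within (cube-≤3^ Δ) (times 5 3^Δ≤V)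

  scaleʳ : ∀ y {x a} → x ≤V* a → (x * y) ≤V* (y * a)
  scaleʳ y {x} h = ≤-within (≤-reflexive (*-comm x y)) (y ⊗ h)

  scaleᵐ : ∀ y x z {a} → (x * z) ≤V* a → (x * (y * z)) ≤V* (y * a)
  scaleᵐ y x z h = ≤-within (≤-reflexive (eq x y z)) (y ⊗ h)
    where
    eq : ∀ x y z → x * (y * z) ≡ y * (x * z)
    eq = solve-∀

  grid : ∀ q → (Δ * (W * q)) ≤V* (q * 3)
  grid q = ≤-within (≤-reflexive (sym (*-assoc Δ W q))) (scaleʳ q ΔW≤)

  none : 0 ≤V* 0
  none = within z≤n

  heads-≤V* : headSum Δ W B M ≤V* 65
  heads-≤V* = total
    where
    total = scaleʳ 1 1+Δ≤ ⊕ scaleʳ 1 1+M≤ ⊕ times 7 1≤V ⊕ scaleʳ 1 B≤ ⊕ scaleʳ 1 Δ≤ ⊕ scaleʳ 1 1+Δ≤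
      ⊕ grid 1 ⊕ grid 1 ⊕ grid 1 ⊕ scaleᵐ 3 Δ 1 (scaleʳ 1 Δ≤) ⊕ scaleᵐ 3 Δ 1 (scaleʳ 1 Δ≤) ⊕ none

  size-≤V* : ∀ {K} q → K ≤ headSum Δ W B M → (K * 3 + sizeSum Δ W B M q) ≤V* sizeFactor q
  size-≤V* {K} q K≤ = total
    where
    K≤V* : K ≤V* 65
    K≤V* = ≤-within K≤ heads-≤V*
    total = scaleʳ 3 K≤V*
      ⊕ scaleᵐ q (suc Δ) (suc Δ * suc Δ) cubed ⊕ scaleʳ 3 1+M≤ ⊕ 7 ⊗ (17 ⊗ 1+M≤)
      ⊕ scaleᵐ q B B BB≤ ⊕ scaleʳ q Δ≤ ⊕ scaleʳ q 1+Δ≤ ⊕ grid q ⊕ grid q ⊕ grid q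
      ⊕ scaleᵐ 3 Δ (q * Δ) (scaleᵐ q Δ Δ ΔΔ≤) ⊕ scaleᵐ 3 Δ q (scaleʳ q Δ≤) ⊕ none

module Bounds (n Δ' : ℕ) (1≤n : 1 ≤ n) where

  open Colouring n Δ' 1≤n
  open Totals {lg n} {Δ'} {W} {B} instrs

  M : ℕ
  M = length instrs

  -- As `logStar n` ≤ L, the Cole-Vishkin part is at most 8·(L + 2); the constant 16 + 11 = 27 is
  -- absorbed by L ≥ 1.
  M-≤ : M ≤ 35 * L + 3 ^ Δ
  M-≤ = begin
    M
      ≡⟨ trans (length-++ prepare) (cong₂ _+_ (length-++ (coleVishkin (logStar n + 2) W))
           (trans (length-++ (replicate (suc Δ) init)) (cong₂ _+_ (length-replicate (suc Δ)) (length-replicate (3 ^ Δ ∸ suc Δ))))) ⟩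
    length (coleVishkin (logStar n + 2) W) + 11 + (suc Δ + (3 ^ Δ ∸ suc Δ))
      ≡⟨ cong (length (coleVishkin (logStar n + 2) W) + 11 +_) (m+[n∸m]≡n (1+n≤3^n Δ)) ⟩
    length (coleVishkin (logStar n + 2) W) + 11 + 3 ^ Δ
      ≤⟨ +-monoˡ-≤ (3 ^ Δ) (+-monoˡ-≤ 11 (length-coleVishkin (logStar n + 2) W)) ⟩
    2 * W + 6 * (logStar n + 2) + 11 + 3 ^ Δ
      ≤⟨ +-monoˡ-≤ (3 ^ Δ) (+-monoˡ-≤ 11 (+-monoʳ-≤ (2 * W) (*-monoʳ-≤ 6 (+-monoˡ-≤ 2 (logStar≤lg n))))) ⟩
    2 * W + 6 * W + 11 + 3 ^ Δ
      ≡⟨ cong (_+ 3 ^ Δ) (eq L) ⟩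
    8 * L + 27 * 1 + 3 ^ Δ
      ≤⟨ +-monoˡ-≤ (3 ^ Δ) (+-monoʳ-≤ (8 * L) (*-monoʳ-≤ 27 {1} {L} (s≤s z≤n))) ⟩
    8 * L + 27 * L + 3 ^ Δ
      ≡⟨ cong (_+ 3 ^ Δ) (*-distribʳ-+ L 8 27) ⟨
    35 * L + 3 ^ Δ ∎
    where
    open ≤-Reasoning
    eq : ∀ l → 2 * (l + 2) + 6 * (l + 2) + 11 ≡ 8 * l + 27 * 1
    eq = solve-∀

  rounds-≤ : M ≤ 36 * (L * lg L * logStar n + Δ * 3 ^ Δ)
  rounds-≤ = begin
    M                                                    ≤⟨ M-≤ ⟩
    35 * L + 3 ^ Δ                                       ≤⟨ +-mono-≤ (*-monoʳ-≤ 35 L≤) 3^Δ≤ ⟩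
    35 * U + U                                           ≡⟨ +-comm (35 * U) U ⟩
    36 * U                                               ∎
    where
    open ≤-Reasoning
    U = L * lg L * logStar n + Δ * 3 ^ Δ
    3^Δ≤ : 3 ^ Δ ≤ U
    3^Δ≤ = ≤-trans (m≤n*m (3 ^ Δ) Δ) (m≤n+m (Δ * 3 ^ Δ) (L * lg L * logStar n))
    -- For n = 1 the factor `logStar n` is 0 and the product vanishes; then L = 1 is covered by
    -- Δ·3^Δ.
    small-n : ∀ s → n ≤ tower s → L ≤ L * lg L * s + Δ * 3 ^ Δ
    small-n zero    n≤1 = ≤-trans (≤-trans (s≤s (≤2^⇒⌊log₂⌋≤ {n} {0} n≤1)) (≤-trans (m^n>0 3 Δ) (m≤n*m (3 ^ Δ) Δ)))
                                  (m≤n+m (Δ * 3 ^ Δ) (L * lg L * 0))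
    small-n (suc s) _   = ≤-trans (≤-trans (m≤m*n L (lg L)) (m≤m*n (L * lg L) (suc s))) (m≤m+n (L * lg L * suc s) (Δ * 3 ^ Δ))
    L≤ : L ≤ U
    L≤ = small-n (logStar n) (≤tower-logStar n)

  W≤3L : W ≤ 3 * L
  W≤3L = +-monoʳ-≤ L (*-monoʳ-≤ 2 {1} {L} (s≤s z≤n))

  -- The carry clauses of the counter add up to order B², and B is logarithmic in L.
  B²≤8L : B * B ≤ 8 * L
  B²≤8L = begin
    B * B                      ≤⟨ square-≤2^ ⌊log₂ (W ∸ 1) ⌋ ⟩
    4 * 2 ^ ⌊log₂ (W ∸ 1) ⌋    ≤⟨ *-monoʳ-≤ 4 (2^⌊log₂⌋≤ (W ∸ 1) (≤-pred (≤-trans 2≤W (m≤n+m∸n W 1)))) ⟩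
    4 * (W ∸ 1)                ≡⟨ cong (4 *_) (+-∸-assoc L {2} {1} (s≤s z≤n)) ⟩
    4 * (L + 1)                ≤⟨ *-monoʳ-≤ 4 (+-monoʳ-≤ L {1} {L} (s≤s z≤n)) ⟩
    4 * (L + L)                ≡⟨ eq L ⟩
    8 * L                      ∎
    where
    open ≤-Reasoning
    eq : ∀ l → 4 * (l + l) ≡ 8 * l
    eq = solve-∀

  module _ {V : ℕ} (ΔL≤V : Δ * L ≤ V) (3^Δ≤V : 3 ^ Δ ≤ V) where

    open Totalling {V} {Δ} {L} {W} {B} {M} (s≤s z≤n) (s≤s z≤n) ΔL≤V 3^Δ≤V W≤3L (<⇒≤ B<W) B²≤8L M-≤

    heads-≤ : k P ≤ 65 * V
    heads-≤ = ≤-trans K-≤ (_≤V*_.bound heads-≤V*)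

    size-≤ : ∀ {c q} → tableSize 9 ≤ c → 9 + 7 * c ≤ q → progSize P ≤ sizeFactor q * V
    size-≤ {q = q} h h' = ≤-trans (progSize-≤ h h') (_≤V*_.bound (size-≤V* q K-≤))

module _ {c q C : ℕ} (tableSize9≤c : tableSize 9 ≤ c) (9+7c≤q : 9 + 7 * c ≤ q)
         (size≤C : sizeFactor q ≤ C) (heads≤C : 65 ≤ C) (rounds≤C : 36 ≤ C) where

  colouring-program : (n Δ : ℕ) → 1 ≤ n → 1 ≤ Δ →
    Σ (Program (lg n) Δ) (λ P →
    ProgramWF P
    × ColorsProperlyWithin n Δ P (C * (lg n * lg (lg n) * logStar n + Δ * 3 ^ Δ))
    × k P ≤ C * (Δ * lg n + 3 ^ Δ)
    × progSize P ≤ C * (Δ * Δ * lg n + 3 ^ Δ)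
    × ExactlyGCR n Δ P (logStar n + (3 ^ Δ ∸ Δ) + 11))
  colouring-program n Δ@(suc Δ') 1≤n _ =
      P , Machine.program-wf (lg n) Δ' W B instrs
    , colours (≤-trans rounds-≤ (*-monoˡ-≤ (L * lg L * logStar n + Δ * 3 ^ Δ) rounds≤C))
    , ≤-trans (heads-≤ (m≤m+n (Δ * L) (3 ^ Δ)) (m≤n+m (3 ^ Δ) (Δ * L)))
              (*-monoˡ-≤ (Δ * L + 3 ^ Δ) heads≤C)
    , ≤-trans (size-≤ (≤-trans (*-monoˡ-≤ L (m≤n*m Δ Δ)) (m≤m+n (Δ * Δ * L) (3 ^ Δ))) (m≤n+m (3 ^ Δ) (Δ * Δ * L))
                      tableSize9≤c 9+7c≤q)
              (*-monoˡ-≤ (Δ * Δ * L + 3 ^ Δ) size≤C)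
    , communication
    where
    open Colouring n Δ' 1≤n hiding (Δ)
    open Bounds n Δ' 1≤n

theorem7 : Σ ℕ (λ C → (n Δ : ℕ) → 1 ≤ n → 1 ≤ Δ →
    Σ (Program (lg n) Δ) (λ P →
    ProgramWF P
    × ColorsProperlyWithin n Δ P (C * (lg n * lg (lg n) * logStar n + Δ * 3 ^ Δ))
    × k P ≤ C * (Δ * lg n + 3 ^ Δ)
    × progSize P ≤ C * (Δ * Δ * lg n + 3 ^ Δ)
    × ExactlyGCR n Δ P (logStar n + (3 ^ Δ ∸ Δ) + 11)))
-- `tableSize 9` is 6645 and 46524 = 9 + 7 · 6645; `sizeFactor 46524` is 1540001, the largest of the
-- three demands on the constant.
theorem7 = 2000000 , colouring-program {tableSize 9} {46524} {2000000} ≤-refl ≤-lit ≤-lit ≤-lit ≤-lit
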